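{- Let $a=(a_i)_{i\in\mathbb Z}$ be the special parameter sequence $a_i=i-\tfrac12$. For every Young diagram $\mu$, let $FS_\mu$ denote the unique element of $\Lambda$ such that for every Young diagram $\nu=(p_1,\dots,p_d\mid q_1,\dots,q_d)$ with $|\nu|=n\ge m=|\mu|$, $$\frac{\dim(\mu,\nu)}{\dim\nu}=\frac{FS_\mu(p_1+\tfrac12,\dots,p_d+\tfrac12;\,q_1+\tfrac12,\dots,q_d+\tfrac12)}{n(n-1)\cdots(n-m+1)}$$ (such an element exists, is unique, and has the form $s_\mu+{}$lower degree terms). Then $FS_\mu=s_{\mu;a}$ for every Young diagram $\mu$.
   Context: $\Lambda$ is the algebra of symmetric functions over $\mathbb C$, with complete homogeneous symmetric functions $h_k$, elementary symmetric functions $e_k$, power sums $\mathbf p_k$ and Schur functions $s_\mu$. For a sequence $a=(a_i)_{i\in\mathbb Z}$ of complex numbers define $h_{k;a}\in\Lambda$ for $k\ge1$ by $h_{k;a}=\sum_{i=1}^k(-1)^{k-i}e_{k-i}(a_1,\dots,a_{k-1})h_i$ (equivalently, $1+\sum_{k\ge1}\frac{h_{k;a}}{(u-a_1)\cdots(u-a_k)}=1+\sum_{k\ge1}h_ku^{ -k}$ in $\Lambda[[u^{ -1}]]$); set $h_{0;a}=1$ and $h_{k;a}=0$ for $k<0$. For $r\in\mathbb Z$ let $\tau^ra$ be the sequence $(\tau^ra)_i=a_{i+r}$. The multiparameter Schur function is $s_{\mu;a}=\det[h_{\mu_i-i+j;\,\tau^{1-j}a}]_{i,j=1}^N$ for any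 $N\ge\ell(\mu)$ (the number of rows of $\mu$). Each $f\in\Lambda$ is identified with a function $f(x;y)$ of two vectors $x=(x_1,x_2,\dots)$, $y=(y_1,y_2,\dots)$ with finitely many nonzero coordinates, via the algebra homomorphism $\mathbf p_k\mapsto\sum_ix_i^k+(-1)^{k-1}\sum_jy_j^k$; for $x\in\mathbb C^m,y\in\mathbb C^n$, $f(x;y)$ means evaluation with all further coordinates set to $0$. Frobenius notation: a Young diagram $\nu$ with $d$ diagonal boxes is written $\nu=(p_1,\dots,p_d\mid q_1,\dots,q_d)$ with $p_i=\nu_i-i$, $q_i=\nu'_i-i$, where $\nu'$ is the transposed diagram; for $\nu=\varnothing$ the evaluation point is $(0;0)$. $\dim(\mu,\nu)$ is the number of standard tableaux of skew shape $\nu/\mu$ if $\mu\subseteq\nu$ and $0$ otherwise; $\dim\nu=\dim(\varnothing,\nu)$. -}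

module Defs where

open import Algebra.Apartness.Bundles using (HeytingField; HeytingCommutativeRing)
open import Algebra.Bundles using (CommutativeRing)
open import Algebra.Bundles.Raw using (RawRing)
open import Algebra.Morphism.Structures using (module RingMorphisms)
import Algebra.Definitions.RawSemiring as RawSemiringDefinitions
import Algebra.Properties.CommutativeMonoid.Sum as Summation
import Algebra.Properties.Ring as RingProperties
import Algebra.Properties.CommutativeSemigroup as CommutativeSemigroupProperties
open import Data.Bool.Base using (true; false; if_then_else_)
open import Data.Fin.Base as Fin using (Fin; zero; suc; toℕ)
import Data.Fin.Properties as Fin
open import Data.Integer.Base as ℤ using (ℤ; +_; -[1+_])
open import Data.List.Base using (List; []; _∷_; length; filter; map; concatMap; upTo; allFin)
import Data.List.Base as List
open import Data.List.Membership.Propositional using (_∈_; lose)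
open import Data.List.Membership.Propositional.Properties using (∈-map⁺; ∈-concatMap⁺; ∈-allFin; ∈-lookup)
import Data.List.Properties as List
open import Data.List.Relation.Binary.Permutation.Propositional using (_↭_; ↭-sym; ↭-trans; ↭-reflexive)
import Data.List.Relation.Binary.Permutation.Propositional as Perm
import Data.List.Relation.Binary.Permutation.Propositional.Properties as Perm
open import Data.List.Relation.Unary.All as All using (All)
import Data.List.Relation.Unary.All.Properties as All
open import Data.List.Relation.Unary.AllPairs as AllPairs using (AllPairs)
import Data.List.Relation.Unary.AllPairs.Properties as AllPairs
open import Data.List.Relation.Unary.Any using (Any; here; there)
open import Data.List.Relation.Unary.Linked using (Linked)
open import Data.Nat.Base as ℕ using (ℕ; zero; suc; NonZero; z≤n; s≤s; _≤_; _<_; _≥_; _∸_; _⊔_)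
open import Data.Nat.Combinatorics using (_P_)
open import Data.Nat.Combinatorics.Base using (_P′_)
open import Data.Nat.ListAction using (sum)
open import Data.Nat.ListAction.Properties using (sum-↭)
import Data.Nat.Properties as ℕ
open import Data.Product.Base using (_×_; _,_; proj₁)
open import Data.Sum.Base using (_⊎_; inj₁; inj₂)
open import Data.Vec.Base as Vec using (Vec; []; _∷_)
import Data.Vec.Properties as Vec
open import Data.Vec.Functional using (Vector; head; tail; removeAt)
open import Function.Base using (_∘_; id)
import Level
open import Relation.Binary.Definitions using (tri<; tri≈; tri>)
open import Relation.Binary.PropositionalEquality as ≡ using (_≡_; _≢_)
open import Relation.Nullary.Decidable using (Dec; yes; no; does; ¬?; _×-dec_; _→-dec_)
open import Relation.Nullary.Negation using (¬_; contradiction)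

------------------------------------------------------------------------

record Diagram : Set where
  field
    parts      : List ℕ
    decreasing : Linked _≥_ parts
    positive   : All (0 <_) parts

open Diagram public

∅ : Diagram
∅ = record { parts = [] ; decreasing = Linked.[] ; positive = All.[] }

ℓ : Diagram → ℕ
ℓ μ = length (parts μ)

size : Diagram → ℕ
size μ = sum (parts μ)

entry : List ℕ → ℕ → ℕ
entry []       _       = 0
entry (x ∷ xs) zero    = x
entry (x ∷ xs) (suc i) = entry xs i

-- Rows and columns are numbered from 0: row μ i = μᵢ₊₁, col μ j = μ′ⱼ₊₁.
row : Diagram → ℕ → ℕ
row μ = entry (parts μ)

col : Diagram → ℕ → ℕ
col μ j = length (filter (j ℕ.<?_) (parts μ))

infix 4 _⊆_ _⊆?_

_⊆_ : Diagram → Diagram → Set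
μ ⊆ ν = ∀ (i : Fin (ℓ μ)) → row μ (toℕ i) ≤ row ν (toℕ i)

_⊆?_ : ∀ μ ν → Dec (μ ⊆ ν)
μ ⊆? ν = Fin.all? (λ i → row μ (toℕ i) ℕ.≤? row ν (toℕ i))

------------------------------------------------------------------------

Cell : Set
Cell = ℕ × ℕ

cells : Diagram → List Cell
cells ν = concatMap (λ i → map (i ,_) (upTo (row ν i))) (upTo (ℓ ν))

skewCells : Diagram → Diagram → List Cell
skewCells μ ν = filter (λ (i , j) → row μ i ℕ.≤? j) (cells ν)

-- A filling of k cells by entries from Fin k; the entry 0 plays the role of 1.
Filling : List Cell → Set
Filling cs = Vec (Fin (length cs)) (length cs)

Standard : ∀ cs → Filling cs → Set
Standard cs T = ∀ s t →
  let (i , j) = List.lookup cs s ; (i′ , j′) = List.lookup cs t in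
    (s ≢ t → Vec.lookup T s ≢ Vec.lookup T t)
  × (i ≡ i′ → j < j′ → Vec.lookup T s Fin.< Vec.lookup T t)
  × (j ≡ j′ → i < i′ → Vec.lookup T s Fin.< Vec.lookup T t)

standard? : ∀ cs T → Dec (Standard cs T)
standard? cs T = Fin.all? λ s → Fin.all? λ t →
  let (i , j) = List.lookup cs s ; (i′ , j′) = List.lookup cs t in
        (¬? (s Fin.≟ t) →-dec ¬? (Vec.lookup T s Fin.≟ Vec.lookup T t))
  ×-dec ((i ℕ.≟ i′) →-dec (j ℕ.<? j′) →-dec (Vec.lookup T s Fin.<? Vec.lookup T t))
  ×-dec ((j ℕ.≟ j′) →-dec (i ℕ.<? i′) →-dec (Vec.lookup T s Fin.<? Vec.lookup T t))

vectors : ∀ {A : Set} → List A → ∀ n → List (Vec A n)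
vectors xs zero    = [] ∷ []
vectors xs (suc n) = concatMap (λ x → map (x ∷_) (vectors xs n)) xs

fillings : ∀ cs → List (Filling cs)
fillings cs = vectors (allFin (length cs)) (length cs)

standardTableaux : ∀ cs → List (Filling cs)
standardTableaux cs = filter (standard? cs) (fillings cs)

dim : Diagram → Diagram → ℕ
dim μ ν = if does (μ ⊆? ν) then length (standardTableaux (skewCells μ ν)) else 0

------------------------------------------------------------------------
-- Numbering the cells in row-reading order gives a standard tableau of
-- shape ν, so dim ∅ ν is nonzero.

private
  infix 4 _≺_

  _≺_ : Cell → Cell → Set
  (i , j) ≺ (i′ , j′) = i < i′ ⊎ (i ≡ i′ × j < j′)

  AllPairs-upTo : ∀ n → AllPairs _<_ (upTo n)
  AllPairs-upTo n = AllPairs.applyUpTo⁺₁ id n (λ i<j _ → i<j)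

  rows-≺ : ∀ (f : ℕ → ℕ) {is} → AllPairs _<_ is →
           AllPairs _≺_ (concatMap (λ i → map (i ,_) (upTo (f i))) is)
  rows-≺ f AllPairs.[]         = AllPairs.[]
  rows-≺ f (i<is AllPairs.∷ ps) = AllPairs.++⁺
    (AllPairs.map⁺ (AllPairs.map (λ j<j′ → inj₂ (≡.refl , j<j′)) (AllPairs-upTo _)))
    (rows-≺ f ps)
    (All.map⁺ (All.universal (λ _ → All.concat⁺ (All.map⁺
      (All.map (λ i<i′ → All.map⁺ (All.universal (λ _ → inj₁ i<i′) _)) i<is))) _))

  lookup-≺ : ∀ {cs} → AllPairs _≺_ cs → ∀ {s t} → s Fin.< t →
             List.lookup cs s ≺ List.lookup cs t
  lookup-≺ (c≺cs AllPairs.∷ _) {zero}  {suc t} _         = All.lookup c≺cs (∈-lookup t)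
  lookup-≺ (_ AllPairs.∷ ps)   {suc s} {suc t} (s≤s s<t) = lookup-≺ ps s<t

  ≺-irrefl-row : ∀ {i i′ j j′} → i ≡ i′ → j < j′ → ¬ ((i′ , j′) ≺ (i , j))
  ≺-irrefl-row i≡i′ _    (inj₁ i′<i)       = ℕ.<-irrefl (≡.sym i≡i′) i′<i
  ≺-irrefl-row _    j<j′ (inj₂ (_ , j′<j)) = ℕ.<-asym j<j′ j′<j

  ≺-irrefl-col : ∀ {i i′ j j′} → j ≡ j′ → i < i′ → ¬ ((i′ , j′) ≺ (i , j))
  ≺-irrefl-col _ i<i′ (inj₁ i′<i)       = ℕ.<-asym i<i′ i′<i
  ≺-irrefl-col _ i<i′ (inj₂ (i′≡i , _)) = ℕ.<-irrefl (≡.sym i′≡i) i<i′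

  allFin-standard : ∀ {cs} → AllPairs _≺_ cs → Standard cs (Vec.allFin (length cs))
  allFin-standard {cs} ps s t
    rewrite Vec.lookup-allFin s | Vec.lookup-allFin t
    = id , (λ i≡i′ j<j′ → increasing (≺-irrefl-row i≡i′ j<j′) (λ { ≡.refl → ℕ.<-irrefl ≡.refl j<j′ }))
         , (λ j≡j′ i<i′ → increasing (≺-irrefl-col j≡j′ i<i′) (λ { ≡.refl → ℕ.<-irrefl ≡.refl i<i′ }))
    where
    increasing : ¬ (List.lookup cs t ≺ List.lookup cs s) → s ≢ t → s Fin.< t
    increasing t⊀s s≢t with Fin.<-cmp s t
    ... | tri< s<t _ _ = s<t
    ... | tri≈ _ s≡t _ = contradiction s≡t s≢t
    ... | tri> _ _ t<s = contradiction (lookup-≺ ps t<s) t⊀s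

  ∈-vectors : ∀ {A : Set} {xs : List A} {n} (v : Vec A n) →
              (∀ i → Vec.lookup v i ∈ xs) → v ∈ vectors xs n
  ∈-vectors []      _  = here ≡.refl
  ∈-vectors (x ∷ v) x∈ = ∈-concatMap⁺ _
    (lose (x∈ zero) (∈-map⁺ (x ∷_) (∈-vectors v (x∈ ∘ suc))))

dim∅≢0 : ∀ ν → NonZero (dim ∅ ν)
dim∅≢0 ν = ℕ.>-nonZero (List.filter-some (standard? cs)
  (lose (∈-vectors (Vec.allFin _) (λ _ → ∈-allFin _))
        (allFin-standard (AllPairs.filter⁺ _ (rows-≺ (row ν) (AllPairs-upTo (ℓ ν)))))))
  where cs = skewCells ∅ ν

------------------------------------------------------------------------

diagonal : Diagram → ℕ
diagonal ν = length (filter (λ i → i ℕ.<? row ν i) (upTo (ℓ ν)))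

-- frobeniusP ν i = pᵢ₊₁ and frobeniusQ ν i = qᵢ₊₁; the subtraction is
-- not truncated, because the box (i , i) lies in ν for i < diagonal ν.
frobeniusP frobeniusQ : ∀ ν → Fin (diagonal ν) → ℕ
frobeniusP ν i = row ν (toℕ i) ∸ suc (toℕ i)
frobeniusQ ν i = col ν (toℕ i) ∸ suc (toℕ i)

P≢0 : ∀ {m n} → m ≤ n → NonZero (n P m)
P≢0 {m} {n} m≤n with m ℕ.≤ᵇ n | ℕ.≤⇒≤ᵇ m≤n
... | true | _ = P′≢0 m≤n
  where
  P′≢0 : ∀ {m} → m ≤ n → NonZero (n P′ m)
  P′≢0 {zero}  _   = _
  P′≢0 {suc m} m<n = ℕ.m*n≢0 (n ∸ m) (n P′ m)
    {{ℕ.>-nonZero (ℕ.m<n⇒0<n∸m m<n)}} {{P′≢0 (ℕ.<⇒≤ m<n)}}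

------------------------------------------------------------------------

module Determinant {c r} (R : RawRing c r) where
  open RawRing R
  open RawSemiringDefinitions rawSemiring using (_^_) renaming (sum to ∑)

  det : ∀ {n} → (Fin n → Fin n → Carrier) → Carrier
  det {zero}  M = 1#
  det {suc n} M = ∑ λ j →
    (- 1#) ^ toℕ j * M zero j * det (λ i → removeAt (M (suc i)) j)

------------------------------------------------------------------------

-- The scalars are those of any field of characteristic zero, such as ℂ.
-- Apartness from 0 makes n · 1 invertible.
CharacteristicZero : ∀ {c ℓ₁ ℓ₂} → HeytingField c ℓ₁ ℓ₂ → Set ℓ₂
CharacteristicZero K = ∀ n → .{{NonZero n}} → (n · 1#) # 0#
  where
  open HeytingField K
  open RawSemiringDefinitions
    (RawRing.rawSemiring (CommutativeRing.rawRing
      (HeytingCommutativeRing.commutativeRing heytingCommutativeRing)))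
    renaming (_×_ to _·_)

module SymmetricFunctions
  {c ℓ₁ ℓ₂} (K : HeytingField c ℓ₁ ℓ₂) (char0 : CharacteristicZero K) where

  open HeytingField K using (#⇒invertible)
  private
    commutativeRing : CommutativeRing c ℓ₁
    commutativeRing = HeytingCommutativeRing.commutativeRing (HeytingField.heytingCommutativeRing K)
  open CommutativeRing commutativeRing hiding (zero)
  open RawSemiringDefinitions (RawRing.rawSemiring rawRing) using (_^_) renaming (_×_ to _·_; sum to ∑)
  private
    module ∑ = Summation +-commutativeMonoid
    module K = RingProperties ring

  fromℕ : ℕ → Carrier
  fromℕ n = n · 1#

  fromℤ : ℤ → Carrier
  fromℤ (+ n)    = fromℕ n
  fromℤ -[1+ n ] = - fromℕ (suc n)

  infixl 7 _/_

  _/_ : Carrier → (n : ℕ) → .{{NonZero n}} → Carrier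
  x / n = x * proj₁ (#⇒invertible (char0 n))

  ½ : Carrier
  ½ = 1# / 2

  ----------------------------------------------------------------------

  -- coeff f (α₁ ∷ … ∷ αₙ ∷ []) is the coefficient of x₁^α₁ ⋯ xₙ^αₙ in a
  -- formal power series in x₁, x₂, … of bounded degree.  A list stands
  -- for the exponent sequence obtained by padding it with zeros; given
  -- symmetry, padding may as well be done in front.
  record Λ : Set (c Level.⊔ ℓ₁) where
    field
      coeff     : List ℕ → Carrier
      padding   : ∀ α → coeff (0 ∷ α) ≈ coeff α
      symmetric : ∀ {α β} → α ↭ β → coeff α ≈ coeff β
      degree    : ℕ
      bounded   : ∀ α → degree < sum α → coeff α ≈ 0#

  open Λ public

  infix 4 _≈Λ_

  _≈Λ_ : Λ → Λ → Set ℓ₁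
  f ≈Λ g = ∀ α → coeff f α ≈ coeff g α

  indicator : ∀ {P : Set} → Dec P → Carrier
  indicator P? = if does P? then 1# else 0#

  indicator-cong : ∀ {P Q : Set} (P? : Dec P) (Q? : Dec Q) →
                   (P → Q) → (Q → P) → indicator P? ≈ indicator Q?
  indicator-cong (yes _) (yes _) _ _ = refl
  indicator-cong (yes p) (no ¬q) f _ = contradiction (f p) ¬q
  indicator-cong (no ¬p) (yes q) _ g = contradiction (g q) ¬p
  indicator-cong (no _)  (no _)  _ _ = refl

  indicator-no : ∀ {P : Set} (P? : Dec P) → ¬ P → indicator P? ≈ 0#
  indicator-no (yes p) ¬p = contradiction p ¬p
  indicator-no (no _)  _  = refl

  -- hₖ is the sum of all monomials of degree k.
  h : ℕ → Λ
  h k = record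
    { coeff     = λ α → indicator (sum α ℕ.≟ k)
    ; padding   = λ α → refl
    ; symmetric = λ {α} {β} α↭β → indicator-cong (sum α ℕ.≟ k) (sum β ℕ.≟ k)
                    (≡.trans (≡.sym (sum-↭ α↭β))) (≡.trans (sum-↭ α↭β))
    ; degree    = k
    ; bounded   = λ α k<∣α∣ → indicator-no (sum α ℕ.≟ k) (ℕ.>⇒≢ k<∣α∣)
    }

  support : List ℕ → List ℕ
  support = filter (0 ℕ.<?_)

  sum-support : ∀ α → sum (support α) ≡ sum α
  sum-support []          = ≡.refl
  sum-support (zero  ∷ α) = sum-support α
  sum-support (suc a ∷ α) = ≡.cong (suc a ℕ.+_) (sum-support α)

  _≟ᴸ_ : (α β : List ℕ) → Dec (α ≡ β)
  _≟ᴸ_ = List.≡-dec ℕ._≟_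

  -- pₖ = ∑ᵢ xᵢᵏ, for k ≥ 1.
  p : (k : ℕ) → .{{NonZero k}} → Λ
  p k = record
    { coeff     = λ α → indicator (support α ≟ᴸ (k ∷ []))
    ; padding   = λ α → refl
    ; symmetric = λ {α} {β} α↭β → indicator-cong (support α ≟ᴸ (k ∷ [])) (support β ≟ᴸ (k ∷ []))
                    (resp (↭-sym α↭β)) (resp α↭β)
    ; degree    = k
    ; bounded   = λ α k<∣α∣ → indicator-no (support α ≟ᴸ (k ∷ []))
                    (λ eq → ℕ.<-irrefl (sum≡k α eq) k<∣α∣)
    }
    where
    resp : ∀ {α β} → α ↭ β → support β ≡ k ∷ [] → support α ≡ k ∷ []
    resp α↭β eq = Perm.↭-singleton-inv (↭-trans (Perm.filter-↭ (0 ℕ.<?_) α↭β) (↭-reflexive eq))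

    sum≡k : ∀ α → support α ≡ k ∷ [] → k ≡ sum α
    sum≡k α eq = ≡.trans (≡.trans (≡.sym (ℕ.+-identityʳ k)) (≡.cong sum (≡.sym eq))) (sum-support α)

  infix  8 -Λ_
  infixl 7 _*Λ_
  infixr 7 _•_
  infixl 6 _+Λ_

  0Λ 1Λ : Λ
  0Λ = record
    { coeff     = λ _ → 0#
    ; padding   = λ _ → refl
    ; symmetric = λ _ → refl
    ; degree    = 0
    ; bounded   = λ _ _ → refl
    }
  1Λ = h 0

  _+Λ_ : Λ → Λ → Λ
  f +Λ g = record
    { coeff     = λ α → coeff f α + coeff g α
    ; padding   = λ α → +-cong (padding f α) (padding g α)
    ; symmetric = λ α↭β → +-cong (symmetric f α↭β) (symmetric g α↭β)
    ; degree    = degree f ⊔ degree g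
    ; bounded   = λ α d<∣α∣ → trans
        (+-cong (bounded f α (ℕ.≤-<-trans (ℕ.m≤m⊔n _ _) d<∣α∣))
                (bounded g α (ℕ.≤-<-trans (ℕ.m≤n⊔m (degree f) _) d<∣α∣)))
        (+-identityˡ 0#)
    }

  _•_ : Carrier → Λ → Λ
  x • f = record
    { coeff     = λ α → x * coeff f α
    ; padding   = λ α → *-congˡ (padding f α)
    ; symmetric = λ α↭β → *-congˡ (symmetric f α↭β)
    ; degree    = degree f
    ; bounded   = λ α d<∣α∣ → trans (*-congˡ (bounded f α d<∣α∣)) (zeroʳ x)
    }

  -Λ_ : Λ → Λ
  -Λ f = record
    { coeff     = λ α → - coeff f α
    ; padding   = λ α → -‿cong (padding f α)
    ; symmetric = λ α↭β → -‿cong (symmetric f α↭β)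
    ; degree    = degree f
    ; bounded   = λ α d<∣α∣ → trans (-‿cong (bounded f α d<∣α∣)) K.-0#≈0#
    }

  -- The coefficient of x^α in a product: the sum of F β * G γ over all
  -- β, γ with β + γ = α.
  convolution : (F G : List ℕ → Carrier) → List ℕ → Carrier
  convolution F G []      = F [] * G []
  convolution F G (a ∷ α) = ∑ {suc a} λ i →
    convolution (F ∘ (toℕ i ∷_)) (G ∘ (a ∸ toℕ i ∷_)) α

  convolution-cong : ∀ {F F′ G G′ : List ℕ → Carrier} →
    (∀ α → F α ≈ F′ α) → (∀ α → G α ≈ G′ α) →
    ∀ α → convolution F G α ≈ convolution F′ G′ α
  convolution-cong F≈ G≈ []      = *-cong (F≈ []) (G≈ [])
  convolution-cong F≈ G≈ (a ∷ α) = ∑.sum-cong-≋ {suc a} λ i →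
    convolution-cong (F≈ ∘ (toℕ i ∷_)) (G≈ ∘ (a ∸ toℕ i ∷_)) α

  Symmetric : (List ℕ → Carrier) → Set ℓ₁
  Symmetric F = ∀ {α β} → α ↭ β → F α ≈ F β

  convolution-symmetric : ∀ {F G} → Symmetric F → Symmetric G → Symmetric (convolution F G)
  convolution-symmetric F-sym G-sym Perm.refl = refl
  convolution-symmetric F-sym G-sym (Perm.prep a α↭β) = ∑.sum-cong-≋ {suc a} λ i →
    convolution-symmetric (F-sym ∘ Perm.prep (toℕ i)) (G-sym ∘ Perm.prep (a ∸ toℕ i)) α↭β
  convolution-symmetric {F} {G} F-sym G-sym {_ ∷ _ ∷ α} {_ ∷ _ ∷ β}
      (Perm.swap a b α↭β) = trans
    (∑.∑-comm {suc a} {suc b} λ i j →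
      convolution (F ∘ (toℕ i ∷_) ∘ (toℕ j ∷_)) (G ∘ (a ∸ toℕ i ∷_) ∘ (b ∸ toℕ j ∷_)) α)
    (∑.sum-cong-≋ {suc b} λ j → ∑.sum-cong-≋ {suc a} λ i → trans
      (convolution-symmetric
        (F-sym ∘ Perm.prep (toℕ i) ∘ Perm.prep (toℕ j))
        (G-sym ∘ Perm.prep (a ∸ toℕ i) ∘ Perm.prep (b ∸ toℕ j)) α↭β)
      (convolution-cong
        (λ _ → F-sym (Perm.swap (toℕ i) (toℕ j) Perm.refl))
        (λ _ → G-sym (Perm.swap (a ∸ toℕ i) (b ∸ toℕ j) Perm.refl)) β))
  convolution-symmetric F-sym G-sym (Perm.trans α↭β β↭γ) =
    trans (convolution-symmetric F-sym G-sym α↭β) (convolution-symmetric F-sym G-sym β↭γ)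

  convolution-zero : ∀ F G α →
    (∀ β γ → sum β ℕ.+ sum γ ≡ sum α → F β * G γ ≈ 0#) → convolution F G α ≈ 0#
  convolution-zero F G []      FG≈0 = FG≈0 [] [] ≡.refl
  convolution-zero F G (a ∷ α) FG≈0 = trans
    (∑.sum-cong-≋ {suc a} λ i → convolution-zero _ _ α λ β γ eq →
      FG≈0 (toℕ i ∷ β) (a ∸ toℕ i ∷ γ) (≡.trans
        (CommutativeSemigroupProperties.interchange ℕ.+-commutativeSemigroup
          (toℕ i) (sum β) (a ∸ toℕ i) (sum γ))
        (≡.cong₂ ℕ._+_ (ℕ.m+[n∸m]≡n (Fin.toℕ≤pred[n] i)) eq)))
    (∑.sum-replicate-zero (suc a))

  _*Λ_ : Λ → Λ → Λ
  f *Λ g = record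
    { coeff     = convolution (coeff f) (coeff g)
    ; padding   = λ α → trans (+-identityʳ _) (convolution-cong (padding f) (padding g) α)
    ; symmetric = convolution-symmetric (symmetric f) (symmetric g)
    ; degree    = degree f ℕ.+ degree g
    ; bounded   = λ α d<∣α∣ → convolution-zero _ _ α λ β γ eq → product-zero β γ
        (≡.subst (degree f ℕ.+ degree g <_) (≡.sym eq) d<∣α∣)
    }
    where
    product-zero : ∀ β γ → degree f ℕ.+ degree g < sum β ℕ.+ sum γ → coeff f β * coeff g γ ≈ 0#
    product-zero β γ lt with degree f ℕ.<? sum β
    ... | yes d<∣β∣ = trans (*-congʳ (bounded f β d<∣β∣)) (zeroˡ _)
    ... | no  d≮∣β∣ = trans (*-congˡ (bounded g γ
      (ℕ.+-cancelˡ-< (degree f) _ _ (ℕ.<-≤-trans lt (ℕ.+-monoˡ-≤ (sum γ) (ℕ.≮⇒≥ d≮∣β∣)))))) (zeroʳ _)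

  Λ-rawRing : RawRing (c Level.⊔ ℓ₁) ℓ₁
  Λ-rawRing = record
    { Carrier = Λ
    ; _≈_     = _≈Λ_
    ; _+_     = _+Λ_
    ; _*_     = _*Λ_
    ; -_      = -Λ_
    ; 0#      = 0Λ
    ; 1#      = 1Λ
    }

  infix 4 _hasDegree<_

  _hasDegree<_ : Λ → ℕ → Set ℓ₁
  f hasDegree< d = ∀ α → d ≤ sum α → coeff f α ≈ 0#

  ----------------------------------------------------------------------

  open RingMorphisms Λ-rawRing rawRing using (IsRingHomomorphism)

  record IsAlgebraHomomorphism (φ : Λ → Carrier) : Set (c Level.⊔ ℓ₁) where
    field
      isRingHomomorphism : IsRingHomomorphism φ
      •-homo             : ∀ x f → φ (x • f) ≈ x * φ f

  -- φ is the homomorphism f ↦ f(x; y); there is exactly one such φ,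
  -- because the power sums generate Λ freely in characteristic zero.
  record IsValueAt {m n} (x : Vector Carrier m) (y : Vector Carrier n)
                   (φ : Λ → Carrier) : Set (c Level.⊔ ℓ₁) where
    field
      isAlgebraHomomorphism : IsAlgebraHomomorphism φ
      power-sum : ∀ k .{{_ : NonZero k}} →
        φ (p k) ≈ ∑ (λ i → x i ^ k) + (- 1#) ^ (k ∸ 1) * ∑ (λ j → y j ^ k)

  ----------------------------------------------------------------------

  -- elementary k (x₁, …, xₙ) = eₖ(x₁, …, xₙ)
  elementary : ∀ {n} → ℕ → Vector Carrier n → Carrier
  elementary         zero    x = 1#
  elementary {zero}  (suc k) x = 0#
  elementary {suc n} (suc k) x = elementary (suc k) (tail x) + head x * elementary k (tail x)

  shift : ℤ → (ℤ → Carrier) → (ℤ → Carrier)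
  shift r a i = a (i ℤ.+ r)

  open RawSemiringDefinitions (RawRing.rawSemiring Λ-rawRing) using () renaming (sum to ∑Λ)

  -- In the sum for h_{k+1;a} the index i runs over 0, …, k, and the
  -- summand is that of h_{i+1}.
  hₐ : (ℤ → Carrier) → ℤ → Λ
  hₐ a -[1+ _ ]  = 0Λ
  hₐ a (+ zero)  = 1Λ
  hₐ a (+ suc k) = ∑Λ {suc k} λ i →
    ((- 1#) ^ (k ∸ toℕ i) * elementary (k ∸ toℕ i) (λ (j : Fin k) → a (+ suc (toℕ j))))
      • h (suc (toℕ i))

  hℤ : ℤ → Λ
  hℤ -[1+ _ ] = 0Λ
  hℤ (+ k)    = h k

  open Determinant Λ-rawRing using (det)

  -- i and j count from 0, so that 1 - j in the shift becomes - j.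
  multiSchur : (N : ℕ) → Diagram → (ℤ → Carrier) → Λ
  multiSchur N μ a = det {N} λ i j →
    hₐ (shift (ℤ.- (+ toℕ j)) a) (+ row μ (toℕ i) ℤ.- + toℕ i ℤ.+ + toℕ j)

  schur : Diagram → Λ
  schur μ = det {ℓ μ} λ i j → hℤ (+ row μ (toℕ i) ℤ.- + toℕ i ℤ.+ + toℕ j)

  ----------------------------------------------------------------------

  halfIntegers : ℤ → Carrier
  halfIntegers i = fromℤ i - ½

  IsFrobeniusSchur : Diagram → Λ → Set (c Level.⊔ ℓ₁)
  IsFrobeniusSchur μ f = ∀ ν (m≤n : size μ ≤ size ν) φ →
    IsValueAt (λ i → fromℕ (frobeniusP ν i) + ½) (λ i → fromℕ (frobeniusQ ν i) + ½) φ →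
    let instance
          _ = dim∅≢0 ν
          _ = P≢0 m≤n
    in fromℕ (dim μ ν) / dim ∅ ν ≈ φ f / (size ν P size μ)

{-# OPTIONS --safe #-}
-- Put lᵢ = νᵢ + N − i, mᵢ = μᵢ + N − i and n = |ν|, m = |μ|.  Removing the
-- box with the largest entry shows that dim(μ, ν) ∏ lᵢ! and
-- (n − m)! det[lⱼ (lⱼ − 1) ⋯ (lⱼ − mᵢ + 1)] obey the same recurrence, so
-- they agree.  At the Frobenius coordinates of ν the generating function
-- of the hₖ is ∏ᵢ (1 + (i − ½) t) / (1 − xᵢ t) with xᵢ = νᵢ − i + ½, so the
-- (i , j) entry of the Jacobi–Trudi matrix of s_{μ;a} is the coefficient
-- of t^mᵢ in c(t) t^(N−j) d(t) / ∏ (1 − xᵢ t), where c depends only on i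
-- and d only on j.  Column operations replace d by any other product of
-- the same shape, and then pass from divided differences to 1 / (1 − xⱼ t);
-- this turns the matrix into the one of falling factorials at the cost of
-- a factor that does not depend on μ.  Hence s_{μ;a}(ν) is a ratio of two
-- such determinants, for μ and for ∅, which is the dimension formula.
--
-- For uniqueness, an element of Λ whose values at all large ν vanish is a
-- polynomial in the xᵢ that vanishes at all large partitions, and is
-- therefore zero, one variable at a time.
module Submission where

open import Algebra.Apartness.Bundles using (HeytingField; HeytingCommutativeRing)
open import Algebra.Bundles using (CommutativeRing; RawRing)
import Algebra.Definitions.RawSemiring as RawSemiringDefinitions
open import Algebra.Morphism.Structures using (module RingMorphisms)
import Algebra.Properties.CommutativeMonoid.Sum as Summation
import Algebra.Properties.CommutativeSemigroup as CommutativeSemigroupProperties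
import Algebra.Properties.Ring as RingProperties
import Algebra.Properties.Semiring.Mult as SemiringMultiples
import Algebra.Properties.Semiring.Mult.TCOptimised as SemiringMult
import Algebra.Properties.Semiring.Sum as SemiringSum
import Algebra.Solver.Ring as RingSolver
import Algebra.Solver.Ring.NaturalCoefficients.Default as SemiringSolver
open import Algebra.Solver.Ring.AlmostCommutativeRing using (fromCommutativeRing; _-Raw-AlmostCommutative⟶_)
open import Data.Bool.Base using (if_then_else_; true)
open import Data.Fin.Base as Fin using (Fin; zero; suc; toℕ; inject₁; fromℕ<; punchIn; punchOut)
import Data.Fin.Properties as Fin
open import Data.Integer.Base as ℤ using (ℤ; +_; -[1+_]; _⊖_)
import Data.Integer.Properties as ℤ
open import Data.List.Base as List using (List; []; _∷_; _++_; length; filter; map; concatMap; upTo; applyUpTo; allFin; replicate)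
import Data.List.Properties as List
open import Data.List.Membership.Propositional using (_∈_; lose; find)
open import Data.List.Membership.Propositional.Properties
open import Data.List.Relation.Binary.Permutation.Propositional as Perm using (_↭_; ↭-sym; ↭-trans; ↭-refl; ↭⇒↭ₛ; prep)
import Data.List.Relation.Binary.Permutation.Propositional.Properties as Perm
import Data.List.Relation.Binary.Permutation.Setoid.Properties as SetoidPerm
open import Data.List.Relation.Unary.All as All using (All)
import Data.List.Relation.Unary.All.Properties as All
open import Data.List.Relation.Unary.AllPairs as AllPairs using (AllPairs)
import Data.List.Relation.Unary.AllPairs.Properties as AllPairs
open import Data.List.Relation.Unary.Any as Any using (Any; here; there)
open import Data.List.Relation.Unary.Linked as Linked using (Linked)
open import Data.List.Relation.Unary.Unique.Propositional using (Unique)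
import Data.List.Relation.Unary.Unique.Propositional.Properties as Unique
open import Data.Maybe.Base using (Maybe; just; nothing)
open import Data.Nat.Base as ℕ using (ℕ; zero; suc; _≤_; _<_; _≥_; z≤n; s≤s; s≤s⁻¹; _∸_; _⊓_; _⊔_; _!; NonZero)
open import Data.Nat.ListAction using (sum)
open import Data.Nat.ListAction.Properties using (sum-↭)
import Data.Nat.Properties as ℕ
open import Data.Product using (_×_; _,_; proj₁; proj₂; ∃₂; ∃-syntax; ∃!)
open import Data.Product.Properties using (,-injectiveʳ)
open import Data.Sum.Base using (_⊎_; inj₁; inj₂)
open import Data.Vec.Base as Vec using (Vec)
import Data.Vec.Properties as Vec
open import Data.Vec.Functional using (Vector; tail; removeAt)
open import Defs
open import Function.Base using (_∘_; id)
import Level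
open import Relation.Binary.Definitions using (tri<; tri≈; tri>)
open import Relation.Binary.PropositionalEquality as ≡ using (_≡_; _≢_)
import Relation.Binary.Reasoning.Setoid as SetoidReasoning
open import Relation.Nullary.Decidable using (Dec; yes; no; does; dec-true; dec-false; ¬?; _×-dec_; _→-dec_)
open import Relation.Nullary.Negation using (¬_; contradiction)

-- `IsFrobeniusSchur` knows a point only through a homomorphism with prescribed power sums. In
-- characteristic zero Newton's identities recover its values at the hₖ, which is all that the
-- Jacobi-Trudi determinant needs. Conversely, an explicit homomorphism with these power sums has to
-- be built, since otherwise the condition might hold vacuously and uniqueness would fail. It
-- adjoins the N values xᵢ and cancels the N half-integers ½ - N, ..., -½; that the Frobenius
-- coordinates give the same power sums is a content sum over ν, taken along rows and along hooks.
--
-- The separation of row and column in a Jacobi-Trudi entry rests on half-integers: the parameters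
-- of the entry and the cancelled points are both runs of consecutive numbers, and two such runs can
-- exchange their tails.
--
-- Nothing is divided by the Vandermonde factor: the identities for μ and for ∅ share it, and the
-- factorials lᵢ! are cancelled instead. Nor is equality of scalars ever decided: roots are split
-- off only at points whose differences are nonzero integers.

-- A pair (a , b) is the integer coefficient a − b.
module IntegerCoefficients {c ℓ} (R : CommutativeRing c ℓ) where
  open CommutativeRing R hiding (zero)
  open RingProperties ring
  open SemiringMult semiring using (×-homo-+; ×1-homo-*) renaming (_×_ to _·_)
  open SetoidReasoning setoid
  private
    module S = SemiringSolver commutativeSemiring

    -- The solver compares normal forms syntactically, so coefficients
    -- have to be kept reduced.
    reduce : ℕ → ℕ → ℕ × ℕ
    reduce (suc a) (suc b) = reduce a b
    reduce a       b       = a , b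

    coefficients : RawRing _ _
    coefficients = record
      { Carrier = ℕ × ℕ
      ; _≈_     = _≡_
      ; _+_     = λ (a , b) (a′ , b′) → reduce (a ℕ.+ a′) (b ℕ.+ b′)
      ; _*_     = λ (a , b) (a′ , b′) → reduce (a ℕ.* a′ ℕ.+ b ℕ.* b′) (a ℕ.* b′ ℕ.+ b ℕ.* a′)
      ; -_      = λ (a , b) → b , a
      ; 0#      = 0 , 0
      ; 1#      = 1 , 0
      }

    module C = RawRing coefficients

    -- ⟦ 1 , 0 ⟧ has to be 1# on the nose, hence the first clause.
    ⟦_⟧ : ℕ × ℕ → Carrier
    ⟦ a , zero ⟧  = a · 1#
    ⟦ a , suc b ⟧ = a · 1# - suc b · 1#

    unfold : ∀ a b → ⟦ a , b ⟧ ≈ a · 1# - b · 1#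
    unfold a zero    = sym (trans (+-congˡ -0#≈0#) (+-identityʳ _))
    unfold a (suc b) = refl

    cross : ∀ {p q r s} → p + s ≈ r + q → p - q ≈ r - s
    cross {p} {q} {r} {s} eq = begin
      p - q           ≈⟨ +-congʳ (trans (sym (+-identityʳ p)) (+-congˡ (sym (-‿inverseʳ s)))) ⟩
      p + (s - s) - q ≈⟨ S.solve 4 (λ p q′ s s′ → (p S.:+ (s S.:+ s′)) S.:+ q′ S.:= ((p S.:+ s) S.:+ s′) S.:+ q′) refl p (- q) s (- s) ⟩
      p + s - s - q   ≈⟨ +-congʳ (+-congʳ eq) ⟩
      r + q - s - q   ≈⟨ S.solve 4 (λ r q q′ s′ → ((r S.:+ q) S.:+ s′) S.:+ q′ S.:= (r S.:+ s′) S.:+ (q S.:+ q′)) refl r q (- q) (- s) ⟩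
      r - s + (q - q) ≈⟨ trans (+-congˡ (-‿inverseʳ q)) (+-identityʳ _) ⟩
      r - s           ∎

    unfold-reduce : ∀ a b → ⟦ reduce a b ⟧ ≈ a · 1# - b · 1#
    unfold-reduce zero    b       = unfold zero b
    unfold-reduce (suc a) zero    = unfold (suc a) zero
    unfold-reduce (suc a) (suc b) = begin
      ⟦ reduce a b ⟧                        ≈⟨ unfold-reduce a b ⟩
      a · 1# - b · 1#                       ≈⟨ cross (S.solve 3 (λ a b i → a S.:+ (i S.:+ b) S.:= (i S.:+ a) S.:+ b) refl (a · 1#) (b · 1#) 1#) ⟩
      (1# + a · 1#) - (1# + b · 1#)         ≈⟨ +-cong (×-homo-+ 1# 1 a) (-‿cong (×-homo-+ 1# 1 b)) ⟨
      suc a · 1# - suc b · 1#               ∎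

    ⟦⟧-+ : ∀ x y → ⟦ x C.+ y ⟧ ≈ ⟦ x ⟧ + ⟦ y ⟧
    ⟦⟧-+ (a , b) (a′ , b′) = begin
      ⟦ reduce (a ℕ.+ a′) (b ℕ.+ b′) ⟧           ≈⟨ unfold-reduce (a ℕ.+ a′) (b ℕ.+ b′) ⟩
      (a ℕ.+ a′) · 1# - (b ℕ.+ b′) · 1#          ≈⟨ +-cong (×-homo-+ 1# a a′) (trans (-‿cong (×-homo-+ 1# b b′)) (sym (-‿+-comm _ _))) ⟩
      (a · 1# + a′ · 1#) + (- (b · 1#) - b′ · 1#) ≈⟨ S.solve 4 (λ a a′ b b′ → (a S.:+ a′) S.:+ (b S.:+ b′) S.:= (a S.:+ b) S.:+ (a′ S.:+ b′)) refl _ _ _ _ ⟩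
      (a · 1# - b · 1#) + (a′ · 1# - b′ · 1#)    ≈⟨ +-cong (unfold a b) (unfold a′ b′) ⟨
      ⟦ a , b ⟧ + ⟦ a′ , b′ ⟧                    ∎

    ⟦⟧-* : ∀ x y → ⟦ x C.* y ⟧ ≈ ⟦ x ⟧ * ⟦ y ⟧
    ⟦⟧-* (a , b) (a′ , b′) = begin
      ⟦ reduce (a ℕ.* a′ ℕ.+ b ℕ.* b′) (a ℕ.* b′ ℕ.+ b ℕ.* a′) ⟧
        ≈⟨ unfold-reduce (a ℕ.* a′ ℕ.+ b ℕ.* b′) (a ℕ.* b′ ℕ.+ b ℕ.* a′) ⟩
      (a ℕ.* a′ ℕ.+ b ℕ.* b′) · 1# - (a ℕ.* b′ ℕ.+ b ℕ.* a′) · 1#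
        ≈⟨ +-cong (expand a a′ b b′) (-‿cong (expand a b′ b a′)) ⟩
      A * A′ + B * B′ - (A * B′ + B * A′)
        ≈⟨ +-cong (+-congˡ (sym (trans (sym (-‿distribˡ-* _ _)) (trans (-‿cong (sym (-‿distribʳ-* _ _))) (-‿involutive _)))))
                  (trans (sym (-‿+-comm _ _)) (+-cong (-‿distribʳ-* _ _) (-‿distribˡ-* _ _))) ⟩
      A * A′ + - B * - B′ + (A * - B′ + - B * A′)
        ≈⟨ S.solve 4 (λ a a′ b b′ → (a S.:* a′ S.:+ b S.:* b′) S.:+ (a S.:* b′ S.:+ b S.:* a′) S.:= (a S.:+ b) S.:* (a′ S.:+ b′)) refl A A′ (- B) (- B′) ⟩
      (A - B) * (A′ - B′)
        ≈⟨ *-cong (unfold a b) (unfold a′ b′) ⟨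
      ⟦ a , b ⟧ * ⟦ a′ , b′ ⟧ ∎
      where
      A = a · 1#
      B = b · 1#
      A′ = a′ · 1#
      B′ = b′ · 1#
      expand : ∀ a b c d → (a ℕ.* b ℕ.+ c ℕ.* d) · 1# ≈ a · 1# * b · 1# + c · 1# * d · 1#
      expand a b c d = trans (×-homo-+ 1# (a ℕ.* b) (c ℕ.* d)) (+-cong (×1-homo-* a b) (×1-homo-* c d))

    ⟦⟧-neg : ∀ x → ⟦ C.- x ⟧ ≈ - ⟦ x ⟧
    ⟦⟧-neg (a , b) = begin
      ⟦ b , a ⟧               ≈⟨ unfold b a ⟩
      b · 1# - a · 1#         ≈⟨ trans (+-comm _ _) (+-congˡ (sym (-‿involutive _))) ⟩
      - (a · 1#) - - (b · 1#) ≈⟨ -‿+-comm _ _ ⟩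
      - (a · 1# - b · 1#)     ≈⟨ -‿cong (unfold a b) ⟨
      - ⟦ a , b ⟧             ∎

    morphism : coefficients -Raw-AlmostCommutative⟶ fromCommutativeRing R
    morphism = record
      { ⟦_⟧    = ⟦_⟧
      ; +-homo = ⟦⟧-+
      ; *-homo = ⟦⟧-*
      ; -‿homo = ⟦⟧-neg
      ; 0-homo = refl
      ; 1-homo = refl
      }

    _≟_ : ∀ x y → Maybe (⟦ x ⟧ ≈ ⟦ y ⟧)
    (a , b) ≟ (a′ , b′) with a ℕ.+ b′ ℕ.≟ a′ ℕ.+ b
    ... | no _   = nothing
    ... | yes eq = just (trans (unfold a b) (trans (cross (begin
      a · 1# + b′ · 1#   ≈⟨ ×-homo-+ 1# a b′ ⟨
      (a ℕ.+ b′) · 1#    ≈⟨ reflexive (≡.cong (_· 1#) eq) ⟩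
      (a′ ℕ.+ b) · 1#    ≈⟨ ×-homo-+ 1# a′ b ⟩
      a′ · 1# + b · 1#   ∎)) (sym (unfold a′ b′))))

  open RingSolver coefficients (fromCommutativeRing R) morphism _≟_ public
    using (solve; _:=_; _:+_; _:*_; _:-_; :-_; con; Polynomial)

  :1 :0 : ∀ {n} → Polynomial n
  :1 = con (1 , 0)
  :0 = con (0 , 0)

-- Determinants expanded along the first row: column operations and zero patterns.

module Determinants {c ℓ} (R : CommutativeRing c ℓ) where
  open CommutativeRing R hiding (zero)
  open RingProperties ring
  open IntegerCoefficients R
  open SetoidReasoning setoid
  open RawSemiringDefinitions (RawRing.rawSemiring rawRing) using (_^_) renaming (sum to ∑)
  open Determinant rawRing using (det)
  private
    module ∑ = SemiringSum semiring
    module ∏ = Summation *-commutativeMonoid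

  Matrix : ℕ → Set c
  Matrix n = Fin n → Fin n → Carrier

  ∏ : ∀ {n} → (Fin n → Carrier) → Carrier
  ∏ = ∏.sum

  ∑-cong : ∀ {n} (f g : Fin n → Carrier) → (∀ i → f i ≈ g i) → ∑ f ≈ ∑ g
  ∑-cong f g f≈g = ∑.sum-cong-≋ f≈g

  ∑-zero : ∀ {n} (f : Fin n → Carrier) → (∀ i → f i ≈ 0#) → ∑ f ≈ 0#
  ∑-zero {n} f f≈0 = trans (∑-cong f (λ _ → 0#) f≈0) (∑.sum-replicate-zero n)

  minor : ∀ {n} → Matrix (suc n) → Fin (suc n) → Matrix n
  minor M j i = removeAt (M (suc i)) j

  term : ∀ {n} → Matrix (suc n) → Fin (suc n) → Carrier
  term M j = (- 1#) ^ toℕ j * M zero j * det (minor M j)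

  det-cong : ∀ {n} {M M′ : Matrix n} → (∀ i j → M i j ≈ M′ i j) → det M ≈ det M′
  det-cong {zero}  M≈M′ = refl
  det-cong {suc n} {M} {M′} M≈M′ = ∑-cong (term M) (term M′) λ j →
    *-cong (*-congˡ (M≈M′ zero j)) (det-cong λ i k → M≈M′ (suc i) (punchIn j k))

  -- In the expansion along the first row, the summand at `j = p` is linear through its entry, every
  -- other summand through its minor, where column `p` sits at `punchOut j≢p`.
  det-linear : ∀ {n} (p : Fin n) x {A B C : Matrix n} →
    (∀ i j → j ≢ p → B i j ≈ A i j) → (∀ i j → j ≢ p → C i j ≈ A i j) →
    (∀ i → C i p ≈ A i p + x * B i p) → det C ≈ det A + x * det B
  det-linear {suc n} p x {A} {B} {C} B≈A C≈A Cₚ = begin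
    det C                                ≈⟨ ∑-cong (term C) _ term-linear ⟩
    ∑ (λ j → term A j + x * term B j)    ≈⟨ ∑.∑-distrib-+ (term A) (λ j → x * term B j) ⟩
    det A + ∑ (λ j → x * term B j)       ≈⟨ +-congˡ (∑.*-distribˡ-sum x (term B)) ⟨
    det A + x * det B                    ∎
    where
    term-linear : ∀ j → term C j ≈ term A j + x * term B j
    term-linear j with j Fin.≟ p
    ... | yes ≡.refl = begin
      s * C zero p * det (minor C p)
        ≈⟨ *-cong (*-congˡ (Cₚ zero)) (det-cong λ i k → C≈A (suc i) _ (Fin.punchInᵢ≢i p k)) ⟩
      s * (A zero p + x * B zero p) * dA
        ≈⟨ solve 5 (λ s a x b d → s :* (a :+ x :* b) :* d := s :* a :* d :+ x :* (s :* b :* d)) refl _ _ _ _ _ ⟩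
      s * A zero p * dA + x * (s * B zero p * dA)
        ≈⟨ +-congˡ (*-congˡ (*-congˡ (det-cong λ i k → B≈A (suc i) _ (Fin.punchInᵢ≢i p k)))) ⟨
      term A p + x * term B p ∎
      where
      s = (- 1#) ^ toℕ p
      dA = det (minor A p)
    ... | no j≢p = begin
      s * C zero j * det (minor C j)
        ≈⟨ *-cong (*-congˡ (C≈A zero j j≢p)) (det-linear p′ x
             (λ i k k≢p′ → B≈A (suc i) _ (k≢p′ ∘ punched k))
             (λ i k k≢p′ → C≈A (suc i) _ (k≢p′ ∘ punched k))
             (λ i → ≡.subst (λ k → C (suc i) k ≈ A (suc i) k + x * B (suc i) k)
                      (≡.sym (Fin.punchIn-punchOut j≢p)) (Cₚ (suc i)))) ⟩
      s * A zero j * (det (minor A j) + x * det (minor B j))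
        ≈⟨ solve 5 (λ s a x d e → s :* a :* (d :+ x :* e) := s :* a :* d :+ x :* (s :* a :* e)) refl _ _ _ _ _ ⟩
      term A j + x * (s * A zero j * det (minor B j))
        ≈⟨ +-congˡ (*-congˡ (*-congʳ (*-congˡ (B≈A zero j j≢p)))) ⟨
      term A j + x * term B j ∎
      where
      s = (- 1#) ^ toℕ j
      p′ = punchOut j≢p
      punched : ∀ k → punchIn j k ≡ p → k ≡ p′
      punched k eq = Fin.punchIn-injective j k p′ (≡.trans eq (≡.sym (Fin.punchIn-punchOut j≢p)))

  private
    ∑-pair : ∀ {n} (p : Fin n) (f : Fin (suc n) → Carrier) →
      (∀ j → j ≢ inject₁ p → j ≢ suc p → f j ≈ 0#) → f (inject₁ p) + f (suc p) ≈ 0# → ∑ f ≈ 0#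
    ∑-pair {suc n} zero f f≈0 eq = begin
      f zero + (f (suc zero) + ∑ rest)   ≈⟨ +-assoc _ _ _ ⟨
      f zero + f (suc zero) + ∑ rest     ≈⟨ +-cong eq (∑-zero rest λ j → f≈0 (suc (suc j)) (λ ()) (λ ())) ⟩
      0# + 0#                                       ≈⟨ +-identityˡ 0# ⟩
      0#                                            ∎
      where
      rest : Fin n → Carrier
      rest j = f (suc (suc j))
    ∑-pair (suc p) f f≈0 eq = trans
      (+-cong (f≈0 zero (λ ()) (λ ()))
              (∑-pair p (f ∘ suc) (λ j ≢₁ ≢₂ → f≈0 (suc j) (≢₁ ∘ Fin.suc-injective) (≢₂ ∘ Fin.suc-injective)) eq))
      (+-identityˡ 0#)

    -- Deleting column `j` keeps the columns `p` and `p + 1` adjacent; `p′` and `p′ + 1` are their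
    -- places in the minor.
    data Away : ∀ {n} → Fin n → Fin (suc n) → Set where
      away : ∀ {n} {p : Fin (suc n)} {j} (p′ : Fin n) →
             punchIn j (inject₁ p′) ≡ inject₁ p → punchIn j (suc p′) ≡ suc p → Away p j

    away? : ∀ {n} (p : Fin n) j → j ≢ inject₁ p → j ≢ suc p → Away p j
    away? zero    zero          ≢₁ ≢₂ = contradiction ≡.refl ≢₁
    away? zero    (suc zero)    ≢₁ ≢₂ = contradiction ≡.refl ≢₂
    away? {suc (suc n)} zero (suc (suc j)) ≢₁ ≢₂ = away zero ≡.refl ≡.refl
    away? {suc (suc n)} (suc p) zero ≢₁ ≢₂ = away p ≡.refl ≡.refl
    away? (suc p) (suc j) ≢₁ ≢₂ with away? p j (≢₁ ∘ ≡.cong suc) (≢₂ ∘ ≡.cong suc)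
    ... | away p′ eq₁ eq₂ = away (suc p′) (≡.cong suc eq₁) (≡.cong suc eq₂)

    minors-agree : ∀ {n} (p : Fin n) {f : Fin (suc n) → Carrier} → f (inject₁ p) ≈ f (suc p) →
      ∀ k → f (punchIn (inject₁ p) k) ≈ f (punchIn (suc p) k)
    minors-agree zero    eq zero    = sym eq
    minors-agree zero    eq (suc k) = refl
    minors-agree (suc p) eq zero    = refl
    minors-agree (suc p) {f} eq (suc k) = minors-agree p {f ∘ suc} eq k

  -- Minors that keep both equal columns vanish by induction; the two that delete one of them
  -- coincide, and their signs are opposite. Adjacent columns suffice below, because every column
  -- operation involves a neighbour.
  det-adjacent : ∀ {n} (p : Fin n) (A : Matrix (suc n)) →
    (∀ i → A i (inject₁ p) ≈ A i (suc p)) → det A ≈ 0#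
  det-adjacent {suc n} p A eq = ∑-pair p (term A)
    (λ j ≢₁ ≢₂ → trans (*-congˡ {(- 1#) ^ toℕ j * A zero j} (vanish j (away? p j ≢₁ ≢₂))) (zeroʳ _))
    (begin
      (- 1#) ^ toℕ (inject₁ p) * A zero (inject₁ p) * det (minor A (inject₁ p)) + (- 1#) ^ suc (toℕ p) * A zero (suc p) * d
        ≈⟨ +-congʳ (*-cong (*-cong (reflexive (≡.cong ((- 1#) ^_) (Fin.toℕ-inject₁ p))) (eq zero))
             (det-cong λ i → minors-agree p {A (suc i)} (eq (suc i)))) ⟩
      s * A zero (suc p) * d + (- 1#) * s * A zero (suc p) * d
        ≈⟨ solve 3 (λ s a d → s :* a :* d :+ (:- :1) :* s :* a :* d := :0) refl _ _ _ ⟩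
      0# ∎)
    where
    s = (- 1#) ^ toℕ p
    d = det (minor A (suc p))
    vanish : ∀ j → Away p j → det (minor A j) ≈ 0#
    vanish j (away p′ eq₁ eq₂) = det-adjacent p′ (minor A j) λ i → begin
      A (suc i) (punchIn j (inject₁ p′)) ≈⟨ reflexive (≡.cong (A (suc i)) eq₁) ⟩
      A (suc i) (inject₁ p)              ≈⟨ eq (suc i) ⟩
      A (suc i) (suc p)                  ≈⟨ reflexive (≡.cong (A (suc i)) eq₂) ⟨
      A (suc i) (punchIn j (suc p′))     ∎

  -- Columns are now indexed by ℕ; only those below n enter detℕ n.
  detℕ : ∀ n → (Fin n → ℕ → Carrier) → Carrier
  detℕ n A = det {n} λ i j → A i (toℕ j)

  detℕ-cong : ∀ {n} (A B : Fin n → ℕ → Carrier) → (∀ i j → j < n → A i j ≈ B i j) → detℕ n A ≈ detℕ n B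
  detℕ-cong A B A≈B = det-cong λ i j → A≈B i (toℕ j) (Fin.toℕ<n j)

  detℕ-adjacent : ∀ {n} p → suc p < n → (A : Fin n → ℕ → Carrier) →
    (∀ i → A i p ≈ A i (suc p)) → detℕ n A ≈ 0#
  detℕ-adjacent {suc n} p (s≤s p<n) A eq = det-adjacent (fromℕ< p<n) (λ i j → A i (toℕ j)) λ i → begin
    A i (toℕ (inject₁ (fromℕ< p<n))) ≈⟨ reflexive (≡.cong (A i) (≡.trans (Fin.toℕ-inject₁ _) (Fin.toℕ-fromℕ< p<n))) ⟩
    A i p                            ≈⟨ eq i ⟩
    A i (suc p)                      ≈⟨ reflexive (≡.cong (A i ∘ suc) (Fin.toℕ-fromℕ< p<n)) ⟨
    A i (suc (toℕ (fromℕ< p<n)))     ∎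

  private
    detℕ-linear : ∀ {n} p → p < n → ∀ x {A B C : Fin n → ℕ → Carrier} →
      (∀ i j → j ≢ p → B i j ≈ A i j) → (∀ i j → j < n → j ≢ p → C i j ≈ A i j) →
      (∀ i → C i p ≈ A i p + x * B i p) → detℕ n C ≈ detℕ n A + x * detℕ n B
    detℕ-linear p p<n x {A} {B} {C} B≈A C≈A Cₚ = det-linear (fromℕ< p<n) x
      (λ i j j≢p → B≈A i _ (j≢p ∘ toℕ≡)) (λ i j j≢p → C≈A i _ (Fin.toℕ<n j) (j≢p ∘ toℕ≡))
      (λ i → ≡.subst (λ q → C i q ≈ A i q + x * B i q) (≡.sym (Fin.toℕ-fromℕ< p<n)) (Cₚ i))
      where
      toℕ≡ : ∀ {j} → toℕ j ≡ p → j ≡ fromℕ< p<n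
      toℕ≡ eq = Fin.toℕ-injective (≡.trans eq (≡.sym (Fin.toℕ-fromℕ< p<n)))

    replace : ∀ {n} → ℕ → ℕ → (Fin n → ℕ → Carrier) → Fin n → ℕ → Carrier
    replace q q′ A i j = if does (j ℕ.≟ q) then A i q′ else A i j

    replace-≡ : ∀ {n} q q′ (A : Fin n → ℕ → Carrier) i → replace q q′ A i q ≡ A i q′
    replace-≡ q q′ A i rewrite dec-true (q ℕ.≟ q) ≡.refl = ≡.refl

    replace-≢ : ∀ {n} q q′ (A : Fin n → ℕ → Carrier) i {j} → j ≢ q → replace q q′ A i j ≡ A i j
    replace-≢ q q′ A i {j} j≢q rewrite dec-false (j ℕ.≟ q) j≢q = ≡.refl

    detℕ-replaceˡ : ∀ {n} p → suc p < n → (A : Fin n → ℕ → Carrier) → detℕ n (replace p (suc p) A) ≈ 0#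
    detℕ-replaceˡ p p<n A = detℕ-adjacent p p<n (replace p (suc p) A) λ i → reflexive
      (≡.trans (replace-≡ p (suc p) A i) (≡.sym (replace-≢ p (suc p) A i ℕ.1+n≢n)))

    detℕ-replaceʳ : ∀ {n} p → suc p < n → (A : Fin n → ℕ → Carrier) → detℕ n (replace (suc p) p A) ≈ 0#
    detℕ-replaceʳ p p<n A = detℕ-adjacent p p<n (replace (suc p) p A) λ i → reflexive
      (≡.trans (replace-≢ (suc p) p A i (ℕ.1+n≢n ∘ ≡.sym)) (≡.sym (replace-≡ (suc p) p A i)))

    detℕ-add : ∀ {n} q q′ → q < n → ∀ x {A B : Fin n → ℕ → Carrier} → detℕ n (replace q q′ A) ≈ 0# →
      (∀ i j → j < n → j ≢ q → B i j ≈ A i j) → (∀ i → B i q ≈ A i q + x * A i q′) → detℕ n B ≈ detℕ n A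
    detℕ-add {n} q q′ q<n x {A} {B} repl≈0 B≈A B_q = begin
      detℕ n B                                ≈⟨ detℕ-linear q q<n x (λ i j j≢q → reflexive (replace-≢ q q′ A i j≢q)) B≈A
                                                   (λ i → trans (B_q i) (+-congˡ (*-congˡ (reflexive (≡.sym (replace-≡ q q′ A i)))))) ⟩
      detℕ n A + x * detℕ n (replace q q′ A)  ≈⟨ +-congˡ (trans (*-congˡ repl≈0) (zeroʳ x)) ⟩
      detℕ n A + 0#                           ≈⟨ +-identityʳ _ ⟩
      detℕ n A                                ∎

    hybrid : ∀ {n} → ℕ → (A B : Fin n → ℕ → Carrier) → Fin n → ℕ → Carrier
    hybrid t A B i j = if does (j ℕ.<? t) then A i j else B i j

    hybrid-< : ∀ {n t} (A B : Fin n → ℕ → Carrier) i {j} → j < t → hybrid t A B i j ≡ A i j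
    hybrid-< {t = t} A B i {j} j<t rewrite dec-true (j ℕ.<? t) j<t = ≡.refl

    hybrid-≥ : ∀ {n t} (A B : Fin n → ℕ → Carrier) i {j} → t ≤ j → hybrid t A B i j ≡ B i j
    hybrid-≥ {t = t} A B i {j} t≤j rewrite dec-false (j ℕ.<? t) (ℕ.≤⇒≯ t≤j) = ≡.refl

    hybrid-≢ : ∀ {n} t (A B : Fin n → ℕ → Carrier) i {j} → j ≢ t → hybrid t A B i j ≡ hybrid (suc t) A B i j
    hybrid-≢ t A B i {j} j≢t with j ℕ.<? t
    ... | yes j<t = ≡.trans (hybrid-< A B i j<t) (≡.sym (hybrid-< A B i (ℕ.m<n⇒m<1+n j<t)))
    ... | no  j≮t = ≡.trans (hybrid-≥ A B i (ℕ.≮⇒≥ j≮t)) (≡.sym (hybrid-≥ A B i (ℕ.≤∧≢⇒< (ℕ.≮⇒≥ j≮t) (j≢t ∘ ≡.sym))))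

    hybrid-induction : ∀ {n} (A B : Fin n → ℕ → Carrier) →
      (∀ t → t < n → detℕ n (hybrid t A B) ≈ detℕ n (hybrid (suc t) A B)) → detℕ n B ≈ detℕ n A
    hybrid-induction {n} A B step = begin
      detℕ n B              ≈⟨ detℕ-cong (hybrid 0 A B) B (λ i j _ → reflexive (hybrid-≥ A B i z≤n)) ⟨
      detℕ n (hybrid 0 A B) ≈⟨ climb n ℕ.≤-refl ⟩
      detℕ n (hybrid n A B) ≈⟨ detℕ-cong (hybrid n A B) A (λ i j j<n → reflexive (hybrid-< A B i j<n)) ⟩
      detℕ n A              ∎
      where
      climb : ∀ t → t ≤ n → detℕ n (hybrid 0 A B) ≈ detℕ n (hybrid t A B)
      climb zero    _   = refl
      climb (suc t) t<n = trans (climb t (ℕ.<⇒≤ t<n)) (step t t<n)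

  -- The columns of `A` are changed from the last to the first, so that the left neighbour used at
  -- each step still belongs to `A`.
  sweepˡ : ∀ {n} (x : ℕ → Carrier) {A B : Fin n → ℕ → Carrier} → (∀ i → B i 0 ≈ A i 0) →
    (∀ i j → suc j < n → B i (suc j) ≈ A i (suc j) + x j * A i j) → detℕ n B ≈ detℕ n A
  sweepˡ {n} x {A} {B} B₀ Bₛ = hybrid-induction A B step
    where
    step : ∀ t → t < n → detℕ n (hybrid t A B) ≈ detℕ n (hybrid (suc t) A B)
    step zero _ = detℕ-cong (hybrid 0 A B) (hybrid 1 A B) λ { i zero _ → B₀ i ; i (suc j) _ → refl }
    step (suc t) t<n = detℕ-add (suc t) t t<n (x t) (detℕ-replaceʳ t t<n (hybrid (suc (suc t)) A B))
      (λ i j _ j≢t → reflexive (hybrid-≢ (suc t) A B i j≢t))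
      (λ i → begin
        hybrid (suc t) A B i (suc t)
          ≈⟨ reflexive (hybrid-≥ A B i ℕ.≤-refl) ⟩
        B i (suc t)
          ≈⟨ Bₛ i t t<n ⟩
        A i (suc t) + x t * A i t
          ≈⟨ +-cong (reflexive (hybrid-< A B i ℕ.≤-refl)) (*-congˡ (reflexive (hybrid-< A B i (ℕ.m<n⇒m<1+n ℕ.≤-refl)))) ⟨
        hybrid (suc (suc t)) A B i (suc t) + x t * hybrid (suc (suc t)) A B i t ∎)

  -- The mirror image: the columns are changed from the first to the last, and the right neighbour
  -- used at each step still belongs to `A`.
  sweepʳ : ∀ {n} (x : ℕ → Carrier) {A B : Fin n → ℕ → Carrier} → (∀ i j → suc j ≡ n → B i j ≈ A i j) →
    (∀ i j → suc j < n → B i j ≈ A i j + x j * A i (suc j)) → detℕ n A ≈ detℕ n B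
  sweepʳ {n} x {A} {B} Bₗ Bⱼ = hybrid-induction B A λ t t<n → sym (step t (ℕ.m≤n⇒m<n∨m≡n t<n))
    where
    step : ∀ t → (suc t < n) ⊎ (suc t ≡ n) → detℕ n (hybrid (suc t) B A) ≈ detℕ n (hybrid t B A)
    step t (inj₂ t≡n) = detℕ-cong (hybrid (suc t) B A) (hybrid t B A) λ i j _ → same i j
      where
      same : ∀ i j → hybrid (suc t) B A i j ≈ hybrid t B A i j
      same i j with j ℕ.≟ t
      ... | no  j≢t    = reflexive (≡.sym (hybrid-≢ t B A i j≢t))
      ... | yes ≡.refl = trans (reflexive (hybrid-< B A i ℕ.≤-refl)) (trans (Bₗ i t t≡n) (reflexive (≡.sym (hybrid-≥ B A i ℕ.≤-refl))))
    step t (inj₁ t<n) = detℕ-add t (suc t) (ℕ.<⇒≤ t<n) (x t) (detℕ-replaceˡ t t<n (hybrid t B A))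
      (λ i j _ j≢t → reflexive (≡.sym (hybrid-≢ t B A i j≢t)))
      (λ i → begin
        hybrid (suc t) B A i t
          ≈⟨ reflexive (hybrid-< B A i ℕ.≤-refl) ⟩
        B i t
          ≈⟨ Bⱼ i t t<n ⟩
        A i t + x t * A i (suc t)
          ≈⟨ +-cong (reflexive (hybrid-≥ B A i ℕ.≤-refl)) (*-congˡ (reflexive (hybrid-≥ B A i (ℕ.n≤1+n t)))) ⟨
        hybrid t B A i t + x t * hybrid t B A i (suc t) ∎)

  det-scale : ∀ {n} (x : Fin n → Carrier) (A : Matrix n) → det (λ i j → x j * A i j) ≈ ∏ x * det A
  det-scale {zero}  x A = sym (*-identityˡ 1#)
  det-scale {suc n} x A = trans (∑-cong (term (λ i j → x j * A i j)) (λ j → ∏ x * term A j) λ j → begin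
    s j * (x j * A zero j) * det (λ i k → x (punchIn j k) * minor A j i k)
      ≈⟨ *-congˡ (det-scale (removeAt x j) (minor A j)) ⟩
    s j * (x j * A zero j) * (∏ (removeAt x j) * det (minor A j))
      ≈⟨ solve 5 (λ s x a p d → s :* (x :* a) :* (p :* d) := (x :* p) :* (s :* a :* d)) refl _ _ _ _ _ ⟩
    x j * ∏ (removeAt x j) * (s j * A zero j * det (minor A j))
      ≈⟨ *-congʳ (∏.sum-remove x) ⟨
    ∏ x * (s j * A zero j * det (minor A j)) ∎)
    (sym (∑.*-distribˡ-sum (∏ x) (term A)))
    where
    s : Fin (suc n) → Carrier
    s j = (- 1#) ^ toℕ j

  weigh : ∀ {n} → (Fin n → Carrier) → Fin n → Matrix n → Matrix n
  weigh w r M i j = if does (j Fin.≟ r) then w i * M i j else M i j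

  weigh-≡ : ∀ {n} (w : Fin n → Carrier) r M i → weigh w r M i r ≡ w i * M i r
  weigh-≡ w r M i rewrite dec-true (r Fin.≟ r) ≡.refl = ≡.refl

  weigh-≢ : ∀ {n} (w : Fin n → Carrier) r M i {j} → j ≢ r → weigh w r M i j ≡ M i j
  weigh-≢ w r M i {j} j≢r rewrite dec-false (j Fin.≟ r) j≢r = ≡.refl

  -- The diagonal matrix w acts as a derivation on the top exterior power.
  ∑-det-weigh : ∀ {n} (w : Fin n → Carrier) M → ∑ (λ r → det (weigh w r M)) ≈ ∑ w * det M
  ∑-det-weigh {zero}  w M = sym (zeroˡ _)
  ∑-det-weigh {suc n} w M = begin
    ∑ (λ r → ∑ (λ j → t r j))  ≈⟨ ∑.∑-comm t ⟩
    ∑ (λ j → ∑ (λ r → t r j))  ≈⟨ ∑-cong (λ j → ∑ (λ r → t r j)) (λ j → ∑ w * term M j) column ⟩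
    ∑ (λ j → ∑ w * term M j)   ≈⟨ ∑.*-distribˡ-sum (∑ w) (term M) ⟨
    ∑ w * det M                ∎
    where
    t : Fin (suc n) → Fin (suc n) → Carrier
    t r = term (weigh w r M)

    weigh-minor : ∀ j r i k → minor (weigh w (punchIn j r) M) j i k ≡ weigh (w ∘ suc) r (minor M j) i k
    weigh-minor j r i k with k Fin.≟ r
    ... | yes ≡.refl = weigh-≡ w (punchIn j k) M (suc i)
    ... | no  k≢r    = weigh-≢ w (punchIn j r) M (suc i) (k≢r ∘ Fin.punchIn-injective j k r)

    -- In the summand for column `j`, the choice `r = j` weights the top entry, while the other `r`
    -- weight the minor, where induction applies; together they give `w zero + ∑ (w ∘ suc)`.
    column : ∀ j → ∑ (λ r → t r j) ≈ ∑ w * term M j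
    column j = begin
      ∑ (λ r → t r j)
        ≈⟨ ∑.sum-remove {i = j} (λ r → t r j) ⟩
      t j j + ∑ (λ r → t (punchIn j r) j)
        ≈⟨ +-cong
             (*-cong (*-congˡ (reflexive (weigh-≡ w j M zero)))
               (det-cong λ i k → reflexive (weigh-≢ w j M (suc i) (Fin.punchInᵢ≢i j k))))
             (∑-cong (λ r → t (punchIn j r) j) _ λ r → *-cong (*-congˡ (reflexive (weigh-≢ w (punchIn j r) M zero (Fin.punchInᵢ≢i j r ∘ ≡.sym))))
               (det-cong λ i k → reflexive (weigh-minor j r i k))) ⟩
      s * (w zero * m) * d + ∑ (λ r → s * m * det (weigh (w ∘ suc) r (minor M j)))
        ≈⟨ +-congˡ (∑.*-distribˡ-sum (s * m) (λ r → det (weigh (w ∘ suc) r (minor M j)))) ⟨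
      s * (w zero * m) * d + s * m * ∑ (λ r → det (weigh (w ∘ suc) r (minor M j)))
        ≈⟨ +-congˡ (*-congˡ (∑-det-weigh (w ∘ suc) (minor M j))) ⟩
      s * (w zero * m) * d + s * m * (∑ (w ∘ suc) * d)
        ≈⟨ solve 5 (λ s w m d v → s :* (w :* m) :* d :+ s :* m :* (v :* d) := (w :+ v) :* (s :* m :* d)) refl _ _ _ _ _ ⟩
      ∑ w * (s * m * d) ∎
      where
      s = (- 1#) ^ toℕ j
      m = M zero j
      d = det (minor M j)

  punchIn-≥ : ∀ {n} (j : Fin (suc n)) k → toℕ j ≤ toℕ k → toℕ (punchIn j k) ≡ suc (toℕ k)
  punchIn-≥ zero    k       _         = ≡.refl
  punchIn-≥ (suc j) (suc k) (s≤s j≤k) = ≡.cong suc (punchIn-≥ j k j≤k)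

  private
    zero-entry : ∀ {n} (M : Matrix (suc n)) j → M zero j ≈ 0# → term M j ≈ 0#
    zero-entry M j M≈0 = trans (*-congʳ (trans (*-congˡ M≈0) (zeroʳ ((- 1#) ^ toℕ j)))) (zeroˡ _)

    zero-minor : ∀ {n} (M : Matrix (suc n)) j → det (minor M j) ≈ 0# → term M j ≈ 0#
    zero-minor M j d≈0 = trans (*-congˡ d≈0) (zeroʳ _)

  -- Rows `0, …, r` live on only `r` columns, so they are dependent. In the expansion, a column from
  -- `r` on has a zero entry, and deleting an earlier one leaves a block of the same kind in the
  -- minor.
  det-zero-block : ∀ {n} (r : Fin n) (M : Matrix n) →
    (∀ i j → toℕ i ≤ toℕ r → toℕ r ≤ toℕ j → M i j ≈ 0#) → det M ≈ 0#
  det-zero-block zero M M≈0 = ∑-zero (term M) λ j → zero-entry M j (M≈0 zero j z≤n z≤n)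
  det-zero-block (suc r) M M≈0 = ∑-zero (term M) term≈0
    where
    term≈0 : ∀ j → term M j ≈ 0#
    term≈0 j with suc (toℕ r) ℕ.≤? toℕ j
    ... | yes r<j = zero-entry M j (M≈0 zero j z≤n r<j)
    ... | no  r≮j = zero-minor M j (det-zero-block r (minor M j) λ i k i≤r r≤k →
      M≈0 (suc i) (punchIn j k) (s≤s i≤r)
        (≡.subst (suc (toℕ r) ≤_) (≡.sym (punchIn-≥ j k (ℕ.≤-trans (ℕ.≮⇒≥ r≮j) r≤k))) (s≤s r≤k)))

  det-lower-triangular : ∀ {n} (M : Matrix n) → (∀ i j → toℕ i < toℕ j → M i j ≈ 0#) → det M ≈ ∏ (λ i → M i i)
  det-lower-triangular {zero}  M M≈0 = refl
  det-lower-triangular {suc n} M M≈0 = begin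
    1# * M zero zero * det (minor M zero) + ∑ (λ j → (- 1#) ^ suc (toℕ j) * M zero (suc j) * det (minor M (suc j)))
      ≈⟨ +-cong (*-cong (*-identityˡ _) (det-lower-triangular (minor M zero) λ i j i<j → M≈0 (suc i) (suc j) (s≤s i<j)))
           (∑-zero (term M ∘ suc) λ j → zero-entry M (suc j) (M≈0 zero (suc j) (s≤s z≤n))) ⟩
    ∏ (λ i → M i i) + 0#
      ≈⟨ +-identityʳ _ ⟩
    ∏ (λ i → M i i) ∎

  det-zero-row : ∀ {n} (p : Fin n) (M : Matrix n) → (∀ j → M p j ≈ 0#) → det M ≈ 0#
  det-zero-row zero    M M≈0 = det-zero-block zero M λ { zero j _ _ → M≈0 j }
  det-zero-row (suc p) M M≈0 = ∑-zero (term M) λ j →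
    zero-minor M j (det-zero-row p (minor M j) λ k → M≈0 (punchIn j k))

  private
    punchIn-fromℕ : ∀ {n} (j : Fin (suc n)) → punchIn (inject₁ j) (Fin.fromℕ n) ≡ Fin.fromℕ (suc n)
    punchIn-fromℕ zero = ≡.refl
    punchIn-fromℕ {suc n} (suc j) = ≡.cong suc (punchIn-fromℕ j)

    punchIn-fromℕˡ : ∀ n (k : Fin n) → punchIn (Fin.fromℕ n) k ≡ inject₁ k
    punchIn-fromℕˡ (suc n) zero    = ≡.refl
    punchIn-fromℕˡ (suc n) (suc k) = ≡.cong suc (punchIn-fromℕˡ n k)

    punchIn-inject₁ : ∀ {n} (j : Fin (suc n)) k → punchIn (inject₁ j) (inject₁ k) ≡ inject₁ (punchIn j k)
    punchIn-inject₁ zero    k       = ≡.refl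
    punchIn-inject₁ (suc j) zero    = ≡.refl
    punchIn-inject₁ (suc j) (suc k) = ≡.cong suc (punchIn-inject₁ j k)

  -- The definition expands along the first row, so the last one is reached by induction: deleting
  -- the last column leaves a zero row, and every other minor again ends in a unit row.
  det-last-row : ∀ {n} (M : Matrix (suc n)) → (∀ j → M (Fin.fromℕ n) (inject₁ j) ≈ 0#) → M (Fin.fromℕ n) (Fin.fromℕ n) ≈ 1# →
    det M ≈ det (λ i j → M (inject₁ i) (inject₁ j))
  det-last-row {zero} M M≈0 M≈1 = begin
    1# * M zero zero * 1# + 0# ≈⟨ solve 1 (λ m → :1 :* m :* :1 :+ :0 := m) refl _ ⟩
    M zero zero                ≈⟨ M≈1 ⟩
    1#                         ∎
  det-last-row {suc n} M M≈0 M≈1 = begin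
    det M
      ≈⟨ ∑.sum-init-last (term M) ⟩
    ∑ (term M ∘ inject₁) + term M (Fin.fromℕ (suc n))
      ≈⟨ +-cong (∑-cong (term M ∘ inject₁) (term (λ i j → M (inject₁ i) (inject₁ j))) λ j →
             *-cong (*-congʳ (reflexive (≡.cong ((- 1#) ^_) (Fin.toℕ-inject₁ j)))) (inner j))
           (zero-minor M (Fin.fromℕ (suc n)) (det-zero-row (Fin.fromℕ n) (minor M (Fin.fromℕ (suc n))) λ k →
             trans (reflexive (≡.cong (M (Fin.fromℕ (suc n))) (punchIn-fromℕˡ (suc n) k))) (M≈0 k))) ⟩
    det (λ i j → M (inject₁ i) (inject₁ j)) + 0#
      ≈⟨ +-identityʳ _ ⟩
    det (λ i j → M (inject₁ i) (inject₁ j)) ∎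
    where
    inner : ∀ j → det (minor M (inject₁ j)) ≈ det (λ i k → M (inject₁ (suc i)) (inject₁ (punchIn j k)))
    inner j = trans (det-last-row (minor M (inject₁ j))
      (λ k → trans (reflexive (≡.cong (M (Fin.fromℕ (suc n))) (punchIn-inject₁ j k))) (M≈0 (punchIn j k)))
      (trans (reflexive (≡.cong (M (Fin.fromℕ (suc n))) (punchIn-fromℕ j))) M≈1))
      (det-cong λ i k → reflexive (≡.cong (M (suc (inject₁ i))) (punchIn-inject₁ j k)))

  module _ {a b} (A : RawRing a b) {φ : RawRing.Carrier A → Carrier}
           (isHom : RingMorphisms.IsRingHomomorphism A rawRing φ) where
    private
      module A = RawRing A
      module φ = RingMorphisms.IsRingHomomorphism isHom
    open RawSemiringDefinitions A.rawSemiring using () renaming (sum to ∑ᴬ; _^_ to _^ᴬ_)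

    homo-∑ : ∀ {n} (f : Fin n → A.Carrier) → φ (∑ᴬ f) ≈ ∑ (φ ∘ f)
    homo-∑ {zero}  f = φ.0#-homo
    homo-∑ {suc n} f = trans (φ.+-homo _ _) (+-congˡ (homo-∑ (f ∘ suc)))

    homo-^ : ∀ x n → φ (x ^ᴬ n) ≈ φ x ^ n
    homo-^ x zero    = φ.1#-homo
    homo-^ x (suc n) = trans (φ.*-homo _ _) (*-congˡ (homo-^ x n))

    homo-det : ∀ {n} (M : Fin n → Fin n → A.Carrier) →
      φ (Determinant.det A M) ≈ det (λ i j → φ (M i j))
    homo-det {zero}  M = φ.1#-homo
    homo-det {suc n} M = trans (homo-∑ termᴬ) (∑-cong (φ ∘ termᴬ) (term (λ i j → φ (M i j))) λ j → trans (φ.*-homo _ _)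
      (*-cong (trans (φ.*-homo _ _) (*-congʳ (trans (homo-^ (A.- A.1#) (toℕ j)) (^-cong (toℕ j) (trans (φ.-‿homo _) (-‿cong φ.1#-homo))))))
              (homo-det (λ i → removeAt (M (suc i)) j))))
      where
      termᴬ : Fin (suc n) → A.Carrier
      termᴬ j = ((A.- A.1#) ^ᴬ toℕ j) A.* M zero j A.* Determinant.det A (λ i → removeAt (M (suc i)) j)

      ^-cong : ∀ n {x y} → x ≈ y → x ^ n ≈ y ^ n
      ^-cong zero    x≈y = refl
      ^-cong (suc n) x≈y = *-cong x≈y (^-cong n x≈y)

-- Formal power series, and column operations on determinants of linear functionals.

∸-step : ∀ {m n} → n < m → m ∸ n ≡ suc (m ∸ suc n)
∸-step {suc m} {zero}  _         = ≡.refl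
∸-step {suc m} {suc n} (s≤s n<m) = ∸-step n<m

-- Sequences s stand for formal power series ∑ₖ s k tᵏ.
module PowerSeries {c ℓ} (R : CommutativeRing c ℓ) where
  open CommutativeRing R hiding (zero)
  open IntegerCoefficients R
  open Determinants R
  open SetoidReasoning setoid

  Seq : Set c
  Seq = ℕ → Carrier

  infix 4 _≋_

  _≋_ : Seq → Seq → Set ℓ
  s ≋ s′ = ∀ k → s k ≈ s′ k

  ≋-trans : ∀ {s s′ s″} → s ≋ s′ → s′ ≋ s″ → s ≋ s″
  ≋-trans eq eq′ k = trans (eq k) (eq′ k)

  ≋-sym : ∀ {s s′} → s ≋ s′ → s′ ≋ s
  ≋-sym eq k = sym (eq k)

  δ : Seq
  δ zero    = 1#
  δ (suc _) = 0#

  -- Multiplication by 1 − c t, by 1 / (1 − x t), and by t.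
  M : Carrier → Seq → Seq
  M c s zero    = s zero
  M c s (suc k) = s (suc k) - c * s k

  G : Carrier → Seq → Seq
  G x s zero    = s zero
  G x s (suc k) = s (suc k) + x * G x s k

  T : Seq → Seq
  T s zero    = 0#
  T s (suc k) = s k

  M-cong : ∀ {c d s s′} → c ≈ d → s ≋ s′ → M c s ≋ M d s′
  M-cong c≈d eq zero    = eq zero
  M-cong c≈d eq (suc k) = +-cong (eq (suc k)) (-‿cong (*-cong c≈d (eq k)))

  G-cong : ∀ {x y s s′} → x ≈ y → s ≋ s′ → G x s ≋ G y s′
  G-cong x≈y eq zero    = eq zero
  G-cong x≈y eq (suc k) = +-cong (eq (suc k)) (*-cong x≈y (G-cong x≈y eq k))

  T-cong : ∀ {s s′} → s ≋ s′ → T s ≋ T s′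
  T-cong eq zero    = refl
  T-cong eq (suc k) = eq k

  M-comm : ∀ c d s → M c (M d s) ≋ M d (M c s)
  M-comm c d s zero          = refl
  M-comm c d s (suc zero)    = solve 4 (λ c d s₁ s₀ → s₁ :- d :* s₀ :- c :* s₀ := s₁ :- c :* s₀ :- d :* s₀) refl c d _ _
  M-comm c d s (suc (suc k)) = solve 5 (λ c d s₂ s₁ s₀ →
    s₂ :- d :* s₁ :- c :* (s₁ :- d :* s₀) := s₂ :- c :* s₁ :- d :* (s₁ :- c :* s₀)) refl c d _ _ _

  M-T : ∀ c s → M c (T s) ≋ T (M c s)
  M-T c s zero          = refl
  M-T c s (suc zero)    = solve 2 (λ c s → s :- c :* :0 := s) refl c _
  M-T c s (suc (suc k)) = refl

  M-G : ∀ x s → M x (G x s) ≋ s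
  M-G x s zero    = refl
  M-G x s (suc k) = solve 3 (λ x s g → s :+ x :* g :- x :* g := s) refl x _ _

  G-M : ∀ x s → G x (M x s) ≋ s
  G-M x s zero    = refl
  G-M x s (suc k) = trans (+-congˡ (*-congˡ (G-M x s k)))
    (solve 3 (λ x s s₀ → s :- x :* s₀ :+ x :* s₀ := s) refl x _ _)

  G-T : ∀ x s → G x (T s) ≋ T (G x s)
  G-T x s zero          = refl
  G-T x s (suc zero)    = solve 2 (λ x s → s :+ x :* :0 := s) refl x _
  G-T x s (suc (suc k)) = +-congˡ (*-congˡ (G-T x s (suc k)))

  -- Both sides are inverse to multiplication by (1 - x t)(1 - y t), whose factors commute.
  G-comm : ∀ x y s → G x (G y s) ≋ G y (G x s)
  G-comm x y s = ≋-trans (G-cong refl (G-cong refl (≋-sym s≋)))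
    (≋-trans (G-cong refl (G-M y _)) (≋-trans (G-M x _) (G-cong refl (G-cong refl (λ _ → refl)))))
    where
    s≋ : M y (M x (G y (G x s))) ≋ s
    s≋ = ≋-trans (M-comm y x _) (≋-trans (M-cong refl (M-G y _)) (M-G x s))

  M-split : ∀ c s k → M c s k ≈ s k + - c * T s k
  M-split c s zero    = solve 2 (λ c s → s := s :+ (:- c) :* :0) refl c _
  M-split c s (suc k) = solve 3 (λ c s₁ s₀ → s₁ :- c :* s₀ := s₁ :+ (:- c) :* s₀) refl c _ _

  G-split : ∀ x s k → G x s k ≈ s k + x * T (G x s) k
  G-split x s zero    = solve 2 (λ x s → s := s :+ x :* :0) refl x _
  G-split x s (suc k) = refl

  -- The identity 1 / (1 - x t) - 1 / (1 - y t) = (x - y) t / ((1 - x t)(1 - y t)), from which the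
  -- divided differences arise.
  G-difference : ∀ x y s k → G x s k ≈ G y s k + (x - y) * T (G x (G y s)) k
  G-difference x y s k = begin
    G x s k
      ≈⟨ solve 3 (λ g y t → g := g :+ y :* t :- y :* t) refl _ y (T (G y (G x s)) k) ⟩
    G x s k + y * T (G y (G x s)) k - y * T (G y (G x s)) k
      ≈⟨ +-congʳ (trans (G-comm x y s k) (G-split y (G x s) k)) ⟨
    G x (G y s) k - y * T (G y (G x s)) k
      ≈⟨ +-cong (G-split x (G y s) k) (-‿cong (*-congˡ (T-cong (G-comm y x s) k))) ⟩
    G y s k + x * t - y * t
      ≈⟨ solve 4 (λ g x y t → g :+ x :* t :- y :* t := g :+ (x :- y) :* t) refl _ x y t ⟩
    G y s k + (x - y) * t ∎
    where t = T (G x (G y s)) k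

  Tⁿ : ℕ → Seq → Seq
  Tⁿ zero    s = s
  Tⁿ (suc n) s = T (Tⁿ n s)

  Tⁿ-cong : ∀ n {s s′} → s ≋ s′ → Tⁿ n s ≋ Tⁿ n s′
  Tⁿ-cong zero    eq = eq
  Tⁿ-cong (suc n) eq = T-cong (Tⁿ-cong n eq)

  Tⁿ-commutes : ∀ n (F : Seq → Seq) → (∀ s → F (T s) ≋ T (F s)) → ∀ s → F (Tⁿ n s) ≋ Tⁿ n (F s)
  Tⁿ-commutes zero    F F-T s = λ _ → refl
  Tⁿ-commutes (suc n) F F-T s = ≋-trans (F-T (Tⁿ n s)) (T-cong (Tⁿ-commutes n F F-T s))

  Tⁿ-+ : ∀ n s k → Tⁿ n s (n ℕ.+ k) ≡ s k
  Tⁿ-+ zero    s k = ≡.refl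
  Tⁿ-+ (suc n) s k = Tⁿ-+ n s k

  Tⁿ-< : ∀ n s {k} → k < n → Tⁿ n s k ≡ 0#
  Tⁿ-< (suc n) s {zero}  _         = ≡.refl
  Tⁿ-< (suc n) s {suc k} (s≤s k<n) = Tⁿ-< n s k<n

  -- Multiplication by ∏ (1 - dᵢ t) and by ∏ 1 / (1 - xᵢ t) over i < n. `Mⁿ` peels off the last
  -- factor, as in a growing flag; `Gⁿ` the first, as `evaluate` does.
  Mⁿ Gⁿ : ℕ → (ℕ → Carrier) → Seq → Seq
  Mⁿ zero    d s = s
  Mⁿ (suc n) d s = M (d n) (Mⁿ n d s)
  Gⁿ zero    x s = s
  Gⁿ (suc n) x s = G (x 0) (Gⁿ n (x ∘ suc) s)

  Mⁿ-cong : ∀ n d {s s′} → s ≋ s′ → Mⁿ n d s ≋ Mⁿ n d s′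
  Mⁿ-cong zero    d eq = eq
  Mⁿ-cong (suc n) d eq = M-cong refl (Mⁿ-cong n d eq)

  Gⁿ-cong : ∀ n {x y s} → (∀ i → x i ≈ y i) → Gⁿ n x s ≋ Gⁿ n y s
  Gⁿ-cong zero    x≈y = λ _ → refl
  Gⁿ-cong (suc n) x≈y = G-cong (x≈y 0) (Gⁿ-cong n (x≈y ∘ suc))

  Mⁿ-head : ∀ n d s → Mⁿ (suc n) d s ≋ Mⁿ n (d ∘ suc) (M (d 0) s)
  Mⁿ-head zero    d s = λ _ → refl
  Mⁿ-head (suc n) d s = M-cong refl (Mⁿ-head n d s)

  Gⁿ-snoc : ∀ n x s → Gⁿ (suc n) x s ≋ G (x n) (Gⁿ n x s)
  Gⁿ-snoc zero    x s = λ _ → refl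
  Gⁿ-snoc (suc n) x s = ≋-trans (G-cong refl (Gⁿ-snoc n (x ∘ suc) s)) (G-comm _ _ _)

  Mⁿ-Gⁿ : ∀ j n x s → Mⁿ j x (Gⁿ (j ℕ.+ n) x s) ≋ Gⁿ n (x ∘ (j ℕ.+_)) s
  Mⁿ-Gⁿ zero    n x s = λ _ → refl
  Mⁿ-Gⁿ (suc j) n x s = ≋-trans (Mⁿ-head j x _)
    (≋-trans (Mⁿ-cong j _ (M-G (x 0) _)) (Mⁿ-Gⁿ j n (x ∘ suc) s))

  -- Multiplication by ∏ (1 - (c + i) t) over i < n. The parameters of a Jacobi-Trudi entry and the
  -- points cancelled at ν are both such runs.
  Q : Carrier → ℕ → Seq → Seq
  Q c zero    s = s
  Q c (suc n) s = M c (Q (c + 1#) n s)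

  Q-cong : ∀ n {c d s s′} → c ≈ d → s ≋ s′ → Q c n s ≋ Q d n s′
  Q-cong zero    c≈d eq = eq
  Q-cong (suc n) c≈d eq = M-cong c≈d (Q-cong n (+-congʳ c≈d) eq)

  Q-M : ∀ n c d s → Q c n (M d s) ≋ M d (Q c n s)
  Q-M zero    c d s = λ _ → refl
  Q-M (suc n) c d s = ≋-trans (M-cong refl (Q-M n (c + 1#) d s)) (M-comm c d _)

  Q-comm : ∀ m n c d s → Q c m (Q d n s) ≋ Q d n (Q c m s)
  Q-comm m zero    c d s = λ _ → refl
  Q-comm m (suc n) c d s = ≋-trans (Q-M m c d _) (M-cong refl (Q-comm m n c (d + 1#) s))

  Q-T : ∀ n c s → Q c n (T s) ≋ T (Q c n s)
  Q-T zero    c s = λ _ → refl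
  Q-T (suc n) c s = ≋-trans (M-cong refl (Q-T n (c + 1#) s)) (M-T c _)

  Q-zero : ∀ n c s → Q c n s 0 ≡ s 0
  Q-zero zero    c s = ≡.refl
  Q-zero (suc n) c s = Q-zero n (c + 1#) s

  open RawSemiringDefinitions (RawRing.rawSemiring rawRing) using () renaming (_×_ to _·_)

  Q-+ : ∀ e n b s → Q b (e ℕ.+ n) s ≋ Q b e (Q (b + e · 1#) n s)
  Q-+ zero    n b s = Q-cong n (sym (+-identityʳ b)) (λ _ → refl)
  Q-+ (suc e) n b s = M-cong refl (≋-trans (Q-+ e n (b + 1#) s)
    (Q-cong e refl (Q-cong n (+-assoc b 1# _) (λ _ → refl))))

  -- Both sides consist of the `e` factors from `b` on and of two runs, of lengths `a` and `j`, from
  -- `b + e` on. Attaching the first `e` factors to the run of length `a` instead of `j` is what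
  -- separates row from column in `value`.
  Q-exchange : ∀ e a j b s → Q (b + e · 1#) a (Q b (e ℕ.+ j) s) ≋ Q b (e ℕ.+ a) (Q (b + e · 1#) j s)
  Q-exchange e a j b s = ≋-trans (Q-cong a refl (Q-+ e j b s))
    (≋-trans (Q-comm a e _ b _) (≋-sym (Q-+ e a b _)))

  falling : Carrier → ℕ → Carrier
  falling y zero    = 1#
  falling y (suc n) = y * falling (y - 1#) n

  falling-cong : ∀ n {x y} → x ≈ y → falling x n ≈ falling y n
  falling-cong zero    x≈y = refl
  falling-cong (suc n) x≈y = *-cong x≈y (falling-cong n (+-congʳ x≈y))

  -- Past degree `n`, each factor 1 - (c + i) t replaces x^(k+1) by x^(k+1) - (c + i) x^k = (x - c -
  -- i) x^k. This is the source of the falling factorials.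
  Q-geometric : ∀ n c x k → Q c n (G x δ) (n ℕ.+ k) ≈ falling (x - c) n * G x δ k
  Q-geometric zero    c x k = sym (*-identityˡ _)
  Q-geometric (suc n) c x k = begin
    q (suc (n ℕ.+ k)) - c * q (n ℕ.+ k)
      ≈⟨ +-cong (trans (reflexive (≡.cong q (≡.sym (ℕ.+-suc n k)))) (Q-geometric n (c + 1#) x (suc k)))
                (-‿cong (*-congˡ (Q-geometric n (c + 1#) x k))) ⟩
    f * (0# + x * g) - c * (f * g)
      ≈⟨ solve 4 (λ f x g c → f :* (:0 :+ x :* g) :- c :* (f :* g) := (x :- c) :* f :* g) refl f x g c ⟩
    (x - c) * f * g
      ≈⟨ *-congʳ (*-congˡ (falling-cong n (solve 2 (λ x c → x :- (c :+ :1) := x :- c :- :1) refl x c))) ⟩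
    falling (x - c) (suc n) * g ∎
    where
    q = Q (c + 1#) n (G x δ)
    f = falling (x - (c + 1#)) n
    g = G x δ k

  record IsLinear (L : Seq → Carrier) : Set (c Level.⊔ ℓ) where
    field
      cong   : ∀ {s s′} → s ≋ s′ → L s ≈ L s′
      linear : ∀ s x s′ → L (λ k → s k + x * s′ k) ≈ L s + x * L s′

  Q-linear : ∀ n c s x s′ → Q c n (λ k → s k + x * s′ k) ≋ λ k → Q c n s k + x * Q c n s′ k
  Q-linear zero    c s x s′ = λ _ → refl
  Q-linear (suc n) c s x s′ = ≋-trans (M-cong refl (Q-linear n (c + 1#) s x s′)) M-linear
    where
    M-linear : ∀ {c s s′} → M c (λ k → s k + x * s′ k) ≋ λ k → M c s k + x * M c s′ k
    M-linear zero    = refl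
    M-linear (suc k) = solve 6 (λ a b a′ b′ x c → a :+ x :* b :- c :* (a′ :+ x :* b′) := a :- c :* a′ :+ x :* (b :- c :* b′)) refl _ _ _ _ x _

  Q-isLinear : ∀ n c k → IsLinear (λ s → Q c n s k)
  Q-isLinear n c k = record
    { cong   = λ eq → Q-cong n refl eq k
    ; linear = λ s x s′ → Q-linear n c s x s′ k
    }

  -- `weight u j` is the difference of the points `j` and `j + u + 1`, or 1 if the second does not
  -- exist; `partial N` is the product over all pairs. They are grouped by distance, since each
  -- round of divided differences yields one group.
  module Vandermonde (N : ℕ) (x : ℕ → Carrier) where
    weight : ℕ → ℕ → Carrier
    weight u j = if does (u ℕ.<? N ∸ suc j) then x j - x (j ℕ.+ suc u) else 1#

    partial : ℕ → Carrier
    partial zero    = 1#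
    partial (suc u) = partial u * ∏ {N} (λ j → weight u (toℕ j))

  vandermonde : ℕ → (ℕ → Carrier) → Carrier
  vandermonde N x = Vandermonde.partial N x N

  module _ {N : ℕ} (L : Fin N → Seq → Carrier) (L-linear : ∀ i → IsLinear (L i)) where

    private
      L-split : ∀ i {s s₁ s₂} x → (∀ k → s k ≈ s₁ k + x * s₂ k) → L i s ≈ L i s₁ + x * L i s₂
      L-split i x eq = trans (IsLinear.cong (L-linear i) eq) (IsLinear.linear (L-linear i) _ x _)

      L-cong : ∀ i {s s′} → s ≋ s′ → L i s ≈ L i s′
      L-cong i = IsLinear.cong (L-linear i)

      Tⁿ-split : ∀ n {s s₁ s₂} x → (∀ k → s k ≈ s₁ k + x * s₂ k) → ∀ k → Tⁿ n s k ≈ Tⁿ n s₁ k + x * Tⁿ n s₂ k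
      Tⁿ-split zero    x eq k       = eq k
      Tⁿ-split (suc n) x eq zero    = solve 1 (λ x → :0 := :0 :+ x :* :0) refl x
      Tⁿ-split (suc n) x eq (suc k) = Tⁿ-split n x eq k

    -- Column j of the Jacobi–Trudi matrix, before and after its factors
    -- 1 − dᵢ t, i < j, are cut down to those with i < u.
    module Flags (d : ℕ → Carrier) (s : Seq) where
      column : ℕ → Fin N → ℕ → Carrier
      column u i j = L i (Tⁿ (N ∸ suc j) (Mⁿ (j ⊓ u) d s))

      private
        coefficient : ℕ → ℕ → Carrier
        coefficient u j = if does (u ℕ.≤? j) then - d u else 0#

        step : ∀ u i j → suc j < N → column (suc u) i (suc j) ≈ column u i (suc j) + coefficient u j * column u i j
        step u i j j<N with u ℕ.≤? j
        ... | no u≰j rewrite dec-false (u ℕ.≤? j) u≰j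
                | ℕ.m≤n⇒m⊓n≡m (ℕ.<⇒≤ (ℕ.≰⇒> u≰j)) | ℕ.m≤n⇒m⊓n≡m (ℕ.≰⇒> u≰j) =
          solve 2 (λ a b → a := a :+ :0 :* b) refl _ _
        ... | yes u≤j rewrite dec-true (u ℕ.≤? j) u≤j
                | ℕ.m≥n⇒m⊓n≡n u≤j | ℕ.m≥n⇒m⊓n≡n (ℕ.m≤n⇒m≤1+n u≤j) | ∸-step j<N =
          L-split i (- d u) λ k → trans (Tⁿ-split (N ∸ suc (suc j)) (- d u) (M-split (d u) (Mⁿ u d s)) k)
            (+-congˡ (*-congˡ (shift (N ∸ suc (suc j)) k)))
          where
          shift : ∀ n → Tⁿ n (T (Mⁿ u d s)) ≋ T (Tⁿ n (Mⁿ u d s))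
          shift n = ≋-sym (Tⁿ-commutes n T (λ _ _ → refl) (Mⁿ u d s))

      -- Passing from `suc u` to `u` removes the factor 1 - d u t from all columns after `u`. The
      -- part with t has the power of t of the left neighbour, and is therefore a multiple of that
      -- column.
      det-flag : ∀ u → detℕ N (column u) ≈ detℕ N (column 0)
      det-flag zero    = refl
      det-flag (suc u) = trans (sweepˡ (coefficient u) {column u} {column (suc u)} (λ i → refl) (step u)) (det-flag u)

      -- The right side does not involve `d`, so any two flags over the same `s` have equal
      -- determinants.
      det-full-flag : detℕ N (λ i j → L i (Tⁿ (N ∸ suc j) (Mⁿ j d s))) ≈ detℕ N (λ i j → L i (Tⁿ (N ∸ suc j) s))
      det-full-flag = trans
        (detℕ-cong _ (column N) λ i j j<N → reflexive (≡.cong (λ n → L i (Tⁿ (N ∸ suc j) (Mⁿ n d s))) (≡.sym (ℕ.m≤n⇒m⊓n≡m (ℕ.<⇒≤ j<N)))))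
        (trans (det-flag N) (detℕ-cong (column 0) _ λ i j _ →
          reflexive (≡.cong (λ n → L i (Tⁿ (N ∸ suc j) (Mⁿ n d s))) (ℕ.⊓-zeroʳ j))))

    -- Column j runs through the divided differences of 1 / (1 − x t) at
    -- the points xⱼ, …, xⱼ₊ₙ, where n is capped by u.
    module DividedDifferences (x : ℕ → Carrier) where
      open Vandermonde N x

      θ : ℕ → ℕ → Seq
      θ j n = Tⁿ n (Gⁿ (suc n) (λ i → x (j ℕ.+ i)) δ)

      -- `G-difference` for the two extreme points, applied to the product over the points in
      -- between.
      θ-recursion : ∀ j n k → θ j n k ≈ θ (suc j) n k + (x j - x (j ℕ.+ suc n)) * θ j (suc n) k
      θ-recursion j n k = begin
        Tⁿ n (G (y 0) W) k
          ≈⟨ Tⁿ-split n (y 0 - y (suc n)) (G-difference (y 0) (y (suc n)) W) k ⟩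
        Tⁿ n (G (y (suc n)) W) k + (y 0 - y (suc n)) * Tⁿ n (T (G (y 0) (G (y (suc n)) W))) k
          ≈⟨ +-cong (Tⁿ-cong n G-W k) (*-cong (+-congʳ (reflexive (≡.cong x (ℕ.+-identityʳ j))))
               (≋-trans (Tⁿ-cong n (T-cong (G-cong refl (≋-sym (Gⁿ-snoc n (y ∘ suc) δ)))))
                 (≋-sym (Tⁿ-commutes n T (λ _ _ → refl) _)) k)) ⟩
        θ (suc j) n k + (x j - y (suc n)) * θ j (suc n) k ∎
        where
        y : ℕ → Carrier
        y i = x (j ℕ.+ i)
        W = Gⁿ n (y ∘ suc) δ
        G-W : G (y (suc n)) W ≋ Gⁿ (suc n) (λ i → x (suc j ℕ.+ i)) δ
        G-W = ≋-trans (≋-sym (Gⁿ-snoc n (y ∘ suc) δ))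
          (Gⁿ-cong (suc n) λ i → reflexive (≡.cong x (ℕ.+-suc j i)))

      column : ℕ → Fin N → ℕ → Carrier
      column u i j = L i (θ j ((N ∸ suc j) ⊓ u))

      private
        coefficient : ℕ → ℕ → Carrier
        coefficient u j = if does (u ℕ.<? N ∸ suc j) then - 1# else 0#

        weighted : ℕ → Fin N → ℕ → Carrier
        weighted u i j = weight u j * column (suc u) i j

        last : ∀ u i j → suc j ≡ N → weighted u i j ≈ column u i j
        last u i j ≡.refl rewrite ℕ.n∸n≡0 j = *-identityˡ _

        step : ∀ u i j → suc j < N → weighted u i j ≈ column u i j + coefficient u j * column u i (suc j)
        step u i j j<N with u ℕ.<? N ∸ suc j
        ... | no u≮ rewrite dec-false (u ℕ.<? N ∸ suc j) u≮
                | ℕ.m≤n⇒m⊓n≡m (ℕ.m≤n⇒m≤1+n (ℕ.≮⇒≥ u≮)) | ℕ.m≤n⇒m⊓n≡m (ℕ.≮⇒≥ u≮) =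
          solve 2 (λ a b → :1 :* a := a :+ :0 :* b) refl _ _
        ... | yes u< rewrite dec-true (u ℕ.<? N ∸ suc j) u<
                | ℕ.m≥n⇒m⊓n≡n u< | ℕ.m≥n⇒m⊓n≡n (ℕ.<⇒≤ u<)
                | ℕ.m≥n⇒m⊓n≡n (s≤s⁻¹ (≡.subst (u <_) (∸-step j<N) u<)) = begin
          w * L i (θ j (suc u))
            ≈⟨ solve 2 (λ a b → b := a :+ b :+ (:- :1) :* a) refl (L i (θ (suc j) u)) _ ⟩
          L i (θ (suc j) u) + w * L i (θ j (suc u)) + - 1# * L i (θ (suc j) u)
            ≈⟨ +-congʳ (L-split i w (θ-recursion j u)) ⟨
          L i (θ j u) + - 1# * L i (θ (suc j) u) ∎
          where w = x j - x (j ℕ.+ suc u)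

      -- Round `u` subtracts from column `j` its right neighbour; the difference is x j - x (j + u +
      -- 1) times the next divided difference, and these factors are pulled out. Columns without a
      -- point `j + u + 1` are finished and stay.
      det-divided : ∀ u → detℕ N (column 0) ≈ partial u * detℕ N (column u)
      det-divided zero    = sym (*-identityˡ _)
      det-divided (suc u) = begin
        detℕ N (column 0)
          ≈⟨ det-divided u ⟩
        partial u * detℕ N (column u)
          ≈⟨ *-congˡ (sweepʳ (coefficient u) {column u} {weighted u} (last u) (step u)) ⟩
        partial u * detℕ N (weighted u)
          ≈⟨ *-congˡ (det-scale {N} (λ j → weight u (toℕ j)) (λ i j → column (suc u) i (toℕ j))) ⟩
        partial u * (∏ {N} (λ j → weight u (toℕ j)) * detℕ N (column (suc u)))
          ≈⟨ *-assoc _ _ _ ⟨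
        partial (suc u) * detℕ N (column (suc u)) ∎

    -- After `N` rounds column `j` is the divided difference at all points from `x j` on, that is,
    -- the full product `Gⁿ N x δ` with its first `j` factors cancelled: a flag along `x`. Two uses
    -- of `det-full-flag` exchange it for a flag along `d`.
    det-geometric : ∀ (x d : ℕ → Carrier) →
      detℕ N (λ i j → L i (G (x j) δ)) ≈
      vandermonde N x * detℕ N (λ i j → L i (Tⁿ (N ∸ suc j) (Mⁿ j d (Gⁿ N x δ))))
    det-geometric x d = begin
      detℕ N (λ i j → L i (G (x j) δ))
        ≈⟨ detℕ-cong _ (column 0) (λ i j _ → first i j) ⟩
      detℕ N (column 0)
        ≈⟨ det-divided N ⟩
      vandermonde N x * detℕ N (column N)
        ≈⟨ *-congˡ (detℕ-cong (column N) (λ i j → L i (Tⁿ (N ∸ suc j) (Mⁿ j x (Gⁿ N x δ)))) final) ⟩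
      vandermonde N x * detℕ N (λ i j → L i (Tⁿ (N ∸ suc j) (Mⁿ j x (Gⁿ N x δ))))
        ≈⟨ *-congˡ (trans (Flags.det-full-flag x (Gⁿ N x δ)) (sym (Flags.det-full-flag d (Gⁿ N x δ)))) ⟩
      vandermonde N x * detℕ N (λ i j → L i (Tⁿ (N ∸ suc j) (Mⁿ j d (Gⁿ N x δ)))) ∎
      where
      open DividedDifferences x
      first : ∀ i j → L i (G (x j) δ) ≈ column 0 i j
      first i j rewrite ℕ.⊓-zeroʳ (N ∸ suc j) = L-cong i (G-cong (reflexive (≡.cong x (≡.sym (ℕ.+-identityʳ j)))) (λ _ → refl))
      final : ∀ i j → j < N → column N i j ≈ L i (Tⁿ (N ∸ suc j) (Mⁿ j x (Gⁿ N x δ)))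
      final i j j<N rewrite ℕ.m≤n⇒m⊓n≡m (ℕ.m∸n≤m N (suc j)) = L-cong i (Tⁿ-cong (N ∸ suc j)
        (≋-trans (≋-sym (Mⁿ-Gⁿ j (suc (N ∸ suc j)) x δ))
          (λ k → reflexive (≡.cong (λ n → Mⁿ j x (Gⁿ n x δ) k) (≡.trans (ℕ.+-suc j _) (ℕ.m+[n∸m]≡n j<N))))))

-- Standard tableaux: splitting off the largest entry.

module Tableaux where
  open import Data.Fin.Base using (fromℕ; lower₁)
  open import Data.Vec.Base using ([]; _∷_)
  open import Relation.Binary.PropositionalEquality using (refl; sym; trans; cong; cong₂; subst)

  module _ {A : Set} where

    Unique-≡⇒↭ : ∀ {xs ys : List A} → Unique xs → Unique ys →
      (∀ {z} → z ∈ xs → z ∈ ys) → (∀ {z} → z ∈ ys → z ∈ xs) → xs ↭ ys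
    Unique-≡⇒↭ {[]} {[]}     _ _ _ _   = ↭-refl
    Unique-≡⇒↭ {[]} {y ∷ ys} _ _ _ ys⊆ with () ← ys⊆ (here refl)
    Unique-≡⇒↭ {x ∷ xs} (x∉xs AllPairs.∷ xs!) ys! xs⊆ ys⊆ with ∈-∃++ (xs⊆ (here refl))
    ... | as , bs , refl = ↭-trans (prep x (Unique-≡⇒↭ xs! (AllPairs.tail x∷!) to from)) (↭-sym shift)
      where
      shift : as ++ x ∷ bs ↭ x ∷ as ++ bs
      shift = Perm.shift x as bs
      x∷! : Unique (x ∷ as ++ bs)
      x∷! = SetoidPerm.Unique-resp-↭ (≡.setoid A) (↭⇒↭ₛ shift) ys!
      to : ∀ {z} → z ∈ xs → z ∈ as ++ bs
      to z∈xs with Perm.∈-resp-↭ shift (xs⊆ (there z∈xs))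
      ... | here refl = contradiction refl (All.lookup x∉xs z∈xs)
      ... | there z∈  = z∈
      from : ∀ {z} → z ∈ as ++ bs → z ∈ xs
      from z∈ with ys⊆ (Perm.∈-resp-↭ (↭-sym shift) (there z∈))
      ... | here refl = contradiction refl (All.lookup (AllPairs.head x∷!) z∈)
      ... | there z∈xs = z∈xs

    lookup-injective : ∀ {xs : List A} → Unique xs → ∀ i j → List.lookup xs i ≡ List.lookup xs j → i ≡ j
    lookup-injective {_ ∷ _} _ zero zero _ = refl
    lookup-injective {_ ∷ _} (x∉ AllPairs.∷ _) zero (suc j) eq = contradiction eq (All.lookup x∉ (∈-lookup j))
    lookup-injective {_ ∷ _} (x∉ AllPairs.∷ _) (suc i) zero eq = contradiction (sym eq) (All.lookup x∉ (∈-lookup i))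
    lookup-injective {_ ∷ _} (_ AllPairs.∷ xs!) (suc i) (suc j) eq = cong suc (lookup-injective xs! i j eq)

  module _ {A B : Set} where

    Unique-concatMap : ∀ (f : A → List B) {xs} → Unique xs → (∀ x → Unique (f x)) →
      (∀ {x y z} → z ∈ f x → z ∈ f y → x ≡ y) → Unique (concatMap f xs)
    Unique-concatMap f {xs} xs! f! f-disjoint = Unique.concat⁺ (All.map⁺ (All.universal f! xs))
      (AllPairs.map⁺ (AllPairs.map (λ x≢y {_} (z∈x , z∈y) → x≢y (f-disjoint z∈x z∈y)) xs!))

    length-concatMap : ∀ (f : A → List B) xs → length (concatMap f xs) ≡ sum (map (length ∘ f) xs)
    length-concatMap f []       = refl
    length-concatMap f (x ∷ xs) = trans (List.length-++ (f x)) (cong (length (f x) ℕ.+_) (length-concatMap f xs))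

    ∈-concatMap⁺′ : ∀ (f : A → List B) {xs x y} → x ∈ xs → y ∈ f x → y ∈ concatMap f xs
    ∈-concatMap⁺′ f x∈ y∈ = ∈-concatMap⁺ f (lose x∈ y∈)

    ∈-concatMap⁻′ : ∀ (f : A → List B) {xs y} → y ∈ concatMap f xs → ∃[ x ] x ∈ xs × y ∈ f x
    ∈-concatMap⁻′ f y∈ = find (∈-concatMap⁻ f y∈)

  ∈-vectors : ∀ {k n} (v : Vec (Fin k) n) → v ∈ vectors (allFin k) n
  ∈-vectors []      = here refl
  ∈-vectors (x ∷ v) = ∈-concatMap⁺′ _ (∈-allFin x) (∈-map⁺ (x ∷_) (∈-vectors v))

  vectors-! : ∀ {A : Set} {xs : List A} → Unique xs → ∀ n → Unique (vectors xs n)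
  vectors-! xs! zero    = All.[] AllPairs.∷ AllPairs.[]
  vectors-! xs! (suc n) = Unique-concatMap _ xs!
    (λ x → Unique.map⁺ Vec.∷-injectiveʳ (vectors-! xs! n))
    λ z∈x z∈y → Vec.∷-injectiveˡ (trans (sym (proj₂ (proj₂ (∈-map⁻ _ z∈x)))) (proj₂ (proj₂ (∈-map⁻ _ z∈y))))

  -- `Standard` with the cells given as a function on `Fin k`: deleting cell `s` is then composition
  -- with `punchIn s`.
  IsStandard : ∀ {k} → (Fin k → Cell) → Vec (Fin k) k → Set
  IsStandard c v = ∀ s t →
    let (i , j) = c s ; (i′ , j′) = c t in
      (s ≢ t → Vec.lookup v s ≢ Vec.lookup v t)
    × (i ≡ i′ → j < j′ → Vec.lookup v s Fin.< Vec.lookup v t)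
    × (j ≡ j′ → i < i′ → Vec.lookup v s Fin.< Vec.lookup v t)

  isStandard? : ∀ {k} (c : Fin k → Cell) v → Dec (IsStandard c v)
  isStandard? c v = Fin.all? λ s → Fin.all? λ t →
    let (i , j) = c s ; (i′ , j′) = c t in
          (¬? (s Fin.≟ t) →-dec ¬? (Vec.lookup v s Fin.≟ Vec.lookup v t))
    ×-dec ((i ℕ.≟ i′) →-dec (j ℕ.<? j′) →-dec (Vec.lookup v s Fin.<? Vec.lookup v t))
    ×-dec ((j ℕ.≟ j′) →-dec (i ℕ.<? i′) →-dec (Vec.lookup v s Fin.<? Vec.lookup v t))

  standards : ∀ k → (Fin k → Cell) → List (Vec (Fin k) k)
  standards k c = filter (isStandard? c) (vectors (allFin k) k)

  standards-! : ∀ k c → Unique (standards k c)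
  standards-! k c = Unique.filter⁺ (isStandard? c) (vectors-! (Unique.allFin⁺ k) k)

  ∈-standards⁺ : ∀ {k c v} → IsStandard c v → v ∈ standards k c
  ∈-standards⁺ {k} {c} {v} std = ∈-filter⁺ (isStandard? c) (∈-vectors v) std

  ∈-standards⁻ : ∀ {k c v} → v ∈ standards k c → IsStandard c v
  ∈-standards⁻ {k} {c} v∈ = proj₂ (∈-filter⁻ (isStandard? c) {xs = vectors (allFin k) k} v∈)

  standards-cong : ∀ {k} {c c′ : Fin k → Cell} → (∀ i → c i ≡ c′ i) →
    length (standards k c) ≡ length (standards k c′)
  standards-cong {k} {c} {c′} eq = Perm.↭-length (Unique-≡⇒↭ (standards-! k c) (standards-! k c′)
    (λ {v} v∈ → ∈-standards⁺ (resp eq v (∈-standards⁻ v∈))) (λ {v} v∈ → ∈-standards⁺ (resp (sym ∘ eq) v (∈-standards⁻ v∈))))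
    where
    resp : ∀ {c c′ : Fin k → Cell} → (∀ i → c i ≡ c′ i) → ∀ v → IsStandard c v → IsStandard c′ v
    resp eq v std s t rewrite sym (eq s) | sym (eq t) = std s t

  -- Cell s may carry the largest entry of a standard filling.
  Maximal : ∀ {k} → (Fin k → Cell) → Fin k → Set
  Maximal c s = ∀ t → let (i , j) = c s ; (i′ , j′) = c t in
    (i ≡ i′ → ¬ (j < j′)) × (j ≡ j′ → ¬ (i < i′))

  maximal? : ∀ {k} (c : Fin k → Cell) s → Dec (Maximal c s)
  maximal? c s = Fin.all? λ t → let (i , j) = c s ; (i′ , j′) = c t in
    ((i ℕ.≟ i′) →-dec ¬? (j ℕ.<? j′)) ×-dec ((j ℕ.≟ j′) →-dec ¬? (i ℕ.<? i′))

  maximals : ∀ {k} → (Fin k → Cell) → List (Fin k)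
  maximals {k} c = filter (maximal? c) (allFin k)

  private
    insertMax : ∀ {k} → Fin (suc k) → Vec (Fin k) k → Vec (Fin (suc k)) (suc k)
    insertMax {k} s v = Vec.insertAt (Vec.map inject₁ v) s (fromℕ k)

    lookup-insertMax : ∀ {k} (s : Fin (suc k)) v → Vec.lookup (insertMax s v) s ≡ fromℕ k
    lookup-insertMax s v = Vec.insertAt-lookup _ s _

    lookup-insertMax-punchIn : ∀ {k} (s : Fin (suc k)) v u →
      Vec.lookup (insertMax s v) (punchIn s u) ≡ inject₁ (Vec.lookup v u)
    lookup-insertMax-punchIn s v u = trans (Vec.insertAt-punchIn _ s _ u) (Vec.lookup-map u inject₁ v)

    inject₁<fromℕ : ∀ {k} (i : Fin k) → inject₁ i Fin.< fromℕ k
    inject₁<fromℕ {k} i = subst (toℕ (inject₁ i) <_) (sym (Fin.toℕ-fromℕ k)) (subst (_< k) (sym (Fin.toℕ-inject₁ i)) (Fin.toℕ<n i))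

    inject₁-mono : ∀ {k} {i j : Fin k} → i Fin.< j → inject₁ i Fin.< inject₁ j
    inject₁-mono {i = i} {j} i<j rewrite Fin.toℕ-inject₁ i | Fin.toℕ-inject₁ j = i<j

    inject₁-cancel : ∀ {k} {i j : Fin k} → inject₁ i Fin.< inject₁ j → i Fin.< j
    inject₁-cancel {i = i} {j} i<j rewrite Fin.toℕ-inject₁ i | Fin.toℕ-inject₁ j = i<j

    fromℕ≮ : ∀ {k} (i : Fin (suc k)) → ¬ (fromℕ k Fin.< i)
    fromℕ≮ {k} i lt = ℕ.<⇒≱ lt (subst (toℕ i ≤_) (sym (Fin.toℕ-fromℕ k)) (Fin.toℕ≤pred[n] i))

    data Punched {k} (s : Fin (suc k)) : Fin (suc k) → Set where
      self  : Punched s s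
      other : ∀ u → Punched s (punchIn s u)

    punched : ∀ {k} (s t : Fin (suc k)) → Punched s t
    punched s t with s Fin.≟ t
    ... | yes refl = self
    ... | no s≢t   = subst (Punched s) (Fin.punchIn-punchOut s≢t) (other (punchOut s≢t))

    insertMax-standard : ∀ {k} (c : Fin (suc k) → Cell) s v → Maximal c s →
      IsStandard (c ∘ punchIn s) v → IsStandard c (insertMax s v)
    insertMax-standard c s v max std t t′ with punched s t | punched s t′
    ... | self | self = contradiction refl , (λ _ j<j → contradiction j<j (ℕ.<-irrefl refl)) , (λ _ i<i → contradiction i<i (ℕ.<-irrefl refl))
    ... | self | other u =
        (λ _ eq → Fin.fromℕ≢inject₁ (trans (sym (lookup-insertMax s v)) (trans eq (lookup-insertMax-punchIn s v u))))
      , (λ i≡ j< → contradiction j< (proj₁ (max (punchIn s u)) i≡))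
      , (λ j≡ i< → contradiction i< (proj₂ (max (punchIn s u)) j≡))
    ... | other u | self rewrite lookup-insertMax s v | lookup-insertMax-punchIn s v u =
        (λ _ eq → Fin.fromℕ≢inject₁ (sym eq)) , (λ _ _ → inject₁<fromℕ _) , (λ _ _ → inject₁<fromℕ _)
    ... | other u | other u′ rewrite lookup-insertMax-punchIn s v u | lookup-insertMax-punchIn s v u′ =
      let (≢ , row , col) = std u u′ in
        (λ s≢ eq → ≢ (s≢ ∘ cong (punchIn s)) (Fin.inject₁-injective eq))
      , (λ i≡ j< → inject₁-mono (row i≡ j<)) , (λ j≡ i< → inject₁-mono (col j≡ i<))

    insertMax-injective : ∀ {k} s {v w : Vec (Fin k) k} → insertMax s v ≡ insertMax s w → v ≡ w
    insertMax-injective s {v} {w} eq = trans (sym (Vec.tabulate∘lookup v))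
      (trans (Vec.tabulate-cong λ u → Fin.inject₁-injective (trans (sym (lookup-insertMax-punchIn s v u))
        (trans (cong (λ x → Vec.lookup x (punchIn s u)) eq) (lookup-insertMax-punchIn s w u)))) (Vec.tabulate∘lookup w))

    insertMax-position : ∀ {k} {s s′} {v w : Vec (Fin k) k} → insertMax s v ≡ insertMax s′ w → s ≡ s′
    insertMax-position {s = s} {s′} {v} {w} eq with punched s′ s
    ... | self    = refl
    ... | other u = contradiction (trans (sym (lookup-insertMax s v)) (trans (cong (λ x → Vec.lookup x (punchIn s′ u)) eq) (lookup-insertMax-punchIn s′ w u))) Fin.fromℕ≢inject₁

    -- Pigeonhole: a largest value missed by `f` could be punched out, which would inject k + 1
    -- elements into k.
    ∃-max : ∀ {k} (f : Fin (suc k) → Fin (suc k)) → (∀ {s t} → f s ≡ f t → s ≡ t) → ∃[ s ] f s ≡ fromℕ k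
    ∃-max {k} f inj with Fin.any? (λ s → f s Fin.≟ fromℕ k)
    ... | yes ∃s = ∃s
    ... | no ∄s  = contradiction (Fin.injective⇒≤ {f = λ s → punchOut (avoid s)}
                     (λ {s} {t} eq → inj (Fin.punchOut-injective (avoid s) (avoid t) eq))) (ℕ.<⇒≱ ℕ.≤-refl)
      where
      avoid : ∀ s → fromℕ k ≢ f s
      avoid s eq = ∄s (s , sym eq)

    removeMax : ∀ {k} (c : Fin (suc k) → Cell) w → IsStandard c w →
      ∃₂ λ s v → Maximal c s × IsStandard (c ∘ punchIn s) v × insertMax s v ≡ w
    removeMax {k} c w std = s , v , max , v-std , eq
      where
      inj : ∀ {s t} → Vec.lookup w s ≡ Vec.lookup w t → s ≡ t
      inj {s} {t} eq with s Fin.≟ t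
      ... | yes s≡t = s≡t
      ... | no s≢t  = contradiction eq (proj₁ (std s t) s≢t)
      s = proj₁ (∃-max (Vec.lookup w) inj)
      s-max : Vec.lookup w s ≡ fromℕ k
      s-max = proj₂ (∃-max (Vec.lookup w) inj)
      max : Maximal c s
      max t = (λ i≡ j< → fromℕ≮ _ (subst (Fin._< Vec.lookup w t) s-max (proj₁ (proj₂ (std s t)) i≡ j<)))
            , (λ j≡ i< → fromℕ≮ _ (subst (Fin._< Vec.lookup w t) s-max (proj₂ (proj₂ (std s t)) j≡ i<)))
      k≢ : ∀ u → k ≢ toℕ (Vec.lookup w (punchIn s u))
      k≢ u eq = Fin.punchInᵢ≢i s u (inj (trans (Fin.toℕ-injective (trans (sym eq) (sym (Fin.toℕ-fromℕ k)))) (sym s-max)))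
      v : Vec (Fin k) k
      v = Vec.tabulate λ u → lower₁ (Vec.lookup w (punchIn s u)) (k≢ u)
      lookup-v : ∀ u → inject₁ (Vec.lookup v u) ≡ Vec.lookup w (punchIn s u)
      lookup-v u = trans (cong inject₁ (Vec.lookup∘tabulate _ u)) (Fin.inject₁-lower₁ _ (k≢ u))
      lower : ∀ {u u′} → Vec.lookup w (punchIn s u) Fin.< Vec.lookup w (punchIn s u′) → Vec.lookup v u Fin.< Vec.lookup v u′
      lower {u} {u′} lt = inject₁-cancel (≡.subst₂ Fin._<_ (sym (lookup-v u)) (sym (lookup-v u′)) lt)
      v-std : IsStandard (c ∘ punchIn s) v
      v-std u u′ = let (≢ , row , col) = std (punchIn s u) (punchIn s u′) in
          (λ u≢ eq → ≢ (u≢ ∘ Fin.punchIn-injective s u u′) (trans (sym (lookup-v u)) (trans (cong inject₁ eq) (lookup-v u′))))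
        , (λ i≡ j< → lower (row i≡ j<)) , (λ j≡ i< → lower (col j≡ i<))
      eq : insertMax s v ≡ w
      eq = trans (sym (Vec.tabulate∘lookup _)) (trans (Vec.tabulate-cong agree) (Vec.tabulate∘lookup w))
        where
        agree : ∀ t → Vec.lookup (insertMax s v) t ≡ Vec.lookup w t
        agree t with punched s t
        ... | self    = trans (lookup-insertMax s v) (sym s-max)
        ... | other u = trans (lookup-insertMax-punchIn s v u) (lookup-v u)

  -- `insertMax` and `removeMax` match the standard fillings with the pairs of a maximal cell and a
  -- standard filling of the other cells.
  length-standards : ∀ k (c : Fin (suc k) → Cell) →
    length (standards (suc k) c) ≡ sum (map (λ s → length (standards k (c ∘ punchIn s))) (maximals c))
  length-standards k c = trans (Perm.↭-length (Unique-≡⇒↭ (standards-! (suc k) c) extended-! to from))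
    (trans (length-concatMap extend (maximals c)) (cong sum (List.map-cong (λ s → List.length-map (insertMax s) (standards k (c ∘ punchIn s))) (maximals c))))
    where
    extend : Fin (suc k) → List (Vec (Fin (suc k)) (suc k))
    extend s = map (insertMax s) (standards k (c ∘ punchIn s))
    extended-! : Unique (concatMap extend (maximals c))
    extended-! = Unique-concatMap extend (Unique.filter⁺ (maximal? c) (Unique.allFin⁺ (suc k)))
      (λ s → Unique.map⁺ (insertMax-injective s) (standards-! k (c ∘ punchIn s)))
      (λ z∈s z∈s′ → insertMax-position (trans (sym (proj₂ (proj₂ (∈-map⁻ _ z∈s)))) (proj₂ (proj₂ (∈-map⁻ _ z∈s′)))))
    to : ∀ {w} → w ∈ standards (suc k) c → w ∈ concatMap extend (maximals c)
    to {w} w∈ =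
      let s , v , max , std , eq = removeMax c w (∈-standards⁻ w∈) in
      subst (_∈ concatMap extend (maximals c)) eq (∈-concatMap⁺′ extend
        (∈-filter⁺ (maximal? c) (∈-allFin s) max) (∈-map⁺ (insertMax s) (∈-standards⁺ std)))
    from : ∀ {w} → w ∈ concatMap extend (maximals c) → w ∈ standards (suc k) c
    from w∈ =
      let s , s∈ , w∈′ = ∈-concatMap⁻′ extend {maximals c} w∈
          v , v∈ , eq  = ∈-map⁻ (insertMax s) w∈′
      in subst (_∈ standards (suc k) c) (sym eq) (∈-standards⁺
           (insertMax-standard c s v (proj₂ (∈-filter⁻ (maximal? c) {xs = allFin (suc k)} s∈)) (∈-standards⁻ v∈)))

  -- Sealed, so that goals mention the count and its recurrence instead of the enumeration of all
  -- fillings.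
  abstract
    #standard : List Cell → ℕ
    #standard cs = length (standardTableaux cs)

    private
      lookup-removeAt : ∀ {A : Set} (x : A) xs s (eq : length (List.removeAt (x ∷ xs) s) ≡ length xs) i →
        List.lookup (List.removeAt (x ∷ xs) s) i ≡ List.lookup (x ∷ xs) (punchIn s (Fin.cast eq i))
      lookup-removeAt x xs       zero    eq i       = cong (List.lookup xs) (sym (Fin.cast-is-id eq i))
      lookup-removeAt x (y ∷ xs) (suc s) eq zero    = refl
      lookup-removeAt x (y ∷ xs) (suc s) eq (suc i) = lookup-removeAt y xs s (cong ℕ.pred eq) i

      #standard-cast : ∀ ds k (c : Fin k → Cell) (eq : length ds ≡ k) → (∀ i → List.lookup ds i ≡ c (Fin.cast eq i)) →
        #standard ds ≡ length (standards k c)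
      #standard-cast ds _ c refl eq = standards-cong λ i → trans (eq i) (cong c (Fin.cast-is-id refl i))

    #standard-recurrence : ∀ x xs → #standard (x ∷ xs) ≡
      sum (map (λ s → #standard (List.removeAt (x ∷ xs) s)) (maximals (List.lookup (x ∷ xs))))
    #standard-recurrence x xs = trans (length-standards (length xs) (List.lookup (x ∷ xs)))
      (cong sum (List.map-cong (λ s → sym (#standard-cast (List.removeAt (x ∷ xs) s) (length xs) _ (List.length-removeAt (x ∷ xs) s) (lookup-removeAt x xs s (List.length-removeAt (x ∷ xs) s))))
        (maximals (List.lookup (x ∷ xs)))))

    #standard-[] : #standard [] ≡ 1
    #standard-[] = refl

    dim-#standard : ∀ μ ν → dim μ ν ≡ (if does (μ ⊆? ν) then #standard (skewCells μ ν) else 0)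
    dim-#standard μ ν = refl

  decrement : ℕ → (ℕ → ℕ) → ℕ → ℕ
  decrement r ρ i = if does (i ℕ.≟ r) then ρ i ∸ 1 else ρ i

  decrement-≡ : ∀ r ρ → decrement r ρ r ≡ ρ r ∸ 1
  decrement-≡ r ρ rewrite dec-true (r ℕ.≟ r) refl = refl

  decrement-≢ : ∀ {r i} ρ → i ≢ r → decrement r ρ i ≡ ρ i
  decrement-≢ {r} {i} ρ i≢r rewrite dec-false (i ℕ.≟ r) i≢r = refl

  -- Shapes are functions from row numbers to row lengths, so that removing a box changes one value
  -- and trailing empty rows are harmless. For the rows of diagrams, `skew` unfolds to `skewCells`.
  module Skew (μ : ℕ → ℕ) where

    private
      P? : (x : Cell) → Dec (μ (proj₁ x) ≤ proj₂ x)
      P? = λ (i , j) → μ i ℕ.≤? j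

      rowCells : (ℕ → ℕ) → ℕ → List Cell
      rowCells ρ i = map (i ,_) (upTo (ρ i))

    skew : (ℕ → ℕ) → List ℕ → List Cell
    skew ρ is = filter P? (concatMap (rowCells ρ) is)

    skew-∷ : ∀ ρ i is → skew ρ (i ∷ is) ≡ filter P? (rowCells ρ i) ++ skew ρ is
    skew-∷ ρ i is = List.filter-++ P? (rowCells ρ i) _

    ∈-skew⁺ : ∀ {ρ is i j} → i ∈ is → μ i ≤ j → j < ρ i → (i , j) ∈ skew ρ is
    ∈-skew⁺ {ρ} i∈ μ≤j j<ρ = ∈-filter⁺ P? (∈-concatMap⁺′ (rowCells ρ) i∈ (∈-map⁺ _ (∈-upTo⁺ j<ρ))) μ≤j

    ∈-skew⁻ : ∀ {ρ is i j} → (i , j) ∈ skew ρ is → i ∈ is × μ i ≤ j × j < ρ i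
    ∈-skew⁻ {ρ} {is} x∈ with ∈-filter⁻ P? {xs = concatMap (rowCells ρ) is} x∈
    ... | x∈′ , μ≤j with ∈-concatMap⁻′ (rowCells ρ) x∈′
    ... | i , i∈ , x∈″ with ∈-map⁻ (i ,_) x∈″
    ... | j , j∈ , refl = i∈ , μ≤j , ∈-upTo⁻ j∈

    skew-! : ∀ {ρ is} → Unique is → Unique (skew ρ is)
    skew-! {ρ} is! = Unique.filter⁺ P? (Unique-concatMap (rowCells ρ) is!
      (λ i → Unique.map⁺ ,-injectiveʳ (Unique.upTo⁺ (ρ i)))
      (λ z∈x z∈y → trans (sym (cong proj₁ (proj₂ (proj₂ (∈-map⁻ _ z∈x))))) (cong proj₁ (proj₂ (proj₂ (∈-map⁻ _ z∈y))))))

    skew-cong : ∀ {ρ ρ′ is} → All (λ i → ρ i ≡ ρ′ i) is → skew ρ is ≡ skew ρ′ is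
    skew-cong All.[] = refl
    skew-cong {ρ} {ρ′} {i ∷ is} (eq All.∷ eqs) rewrite skew-∷ ρ i is | skew-∷ ρ′ i is | eq | skew-cong eqs = refl

    -- The tableau recurrence deletes a box by its position in the list; shortening row `r` has to
    -- leave the same list, in the same order.
    skew-remove : ∀ {ρ r is} → Unique is → r ∈ is → μ r < ρ r →
      ∃₂ λ ys zs → skew ρ is ≡ ys ++ (r , ρ r ∸ 1) ∷ zs × skew (decrement r ρ) is ≡ ys ++ zs
    skew-remove {ρ} {r} {_ ∷ is} (r∉is AllPairs.∷ is!) (here refl) μ<ρ =
      filter P? (map (r ,_) (upTo (ρ r ∸ 1))) , skew ρ is
      , trans (skew-∷ ρ r is) (trans (cong (_++ skew ρ is) last-cell) (List.++-assoc (filter P? (map (r ,_) (upTo (ρ r ∸ 1)))) _ _))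
      , trans (skew-∷ _ r is) (cong₂ _++_ (cong (λ n → filter P? (map (r ,_) (upTo n))) (decrement-≡ r ρ))
          (skew-cong (All.map (λ r≢i → decrement-≢ ρ (r≢i ∘ sym)) r∉is)))
      where
      suc-pred : ∀ {m n} → m < n → n ≡ suc (n ∸ 1)
      suc-pred (s≤s _) = refl
      last-cell : filter P? (rowCells ρ r) ≡ filter P? (map (r ,_) (upTo (ρ r ∸ 1))) ++ (r , ρ r ∸ 1) ∷ []
      last-cell = trans (cong (filter P?) (trans (cong (map (r ,_)) (trans (cong upTo (suc-pred μ<ρ)) (sym (List.upTo-∷ʳ (ρ r ∸ 1)))))
                    (List.map-++ (r ,_) (upTo (ρ r ∸ 1)) _)))
        (trans (List.filter-++ P? (map (r ,_) (upTo (ρ r ∸ 1))) _)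
          (cong (filter P? (map (r ,_) (upTo (ρ r ∸ 1))) ++_) (List.filter-accept P? (s≤s⁻¹ (subst (μ r <_) (suc-pred μ<ρ) μ<ρ)))))
    skew-remove {ρ} {r} {i ∷ is} (i∉is AllPairs.∷ is!) (there r∈) μ<ρ with skew-remove is! r∈ μ<ρ
    ... | ys , zs , eq , eq′ = filter P? (rowCells ρ i) ++ ys , zs
      , trans (skew-∷ ρ i is) (trans (cong (filter P? (rowCells ρ i) ++_) eq) (sym (List.++-assoc (filter P? (rowCells ρ i)) ys _)))
      , trans (skew-∷ _ i is) (trans (cong₂ _++_ (cong (λ n → filter P? (map (i ,_) (upTo n))) (decrement-≢ ρ (λ { refl → All.lookup i∉is r∈ refl }))) eq′)
          (sym (List.++-assoc (filter P? (rowCells ρ i)) ys zs)))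

    skew-empty : ∀ {ρ is} → All (λ i → ρ i ≤ μ i) is → skew ρ is ≡ []
    skew-empty All.[] = refl
    skew-empty {ρ} {i ∷ is} (ρ≤μ All.∷ ρ≤μs) = trans (skew-∷ ρ i is) (cong₂ _++_
      (List.filter-none P? (All.map⁺ (All.tabulate λ j∈ → ℕ.<⇒≱ (ℕ.<-≤-trans (∈-upTo⁻ j∈) ρ≤μ)))) (skew-empty ρ≤μs))

    skew-extend : ∀ e {ρ n} → (∀ i → n ≤ i → ρ i ≡ 0) → skew ρ (upTo (e ℕ.+ n)) ≡ skew ρ (upTo n)
    skew-extend zero    ρ≡0 = refl
    skew-extend (suc e) {ρ} {n} ρ≡0 = trans (cong (filter P?) (trans (cong (concatMap (rowCells ρ)) (sym (List.upTo-∷ʳ (e ℕ.+ n))))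
      (trans (List.concatMap-++ (rowCells ρ) (upTo (e ℕ.+ n)) _) (trans (cong (concatMap (rowCells ρ) (upTo (e ℕ.+ n)) ++_)
        (cong (λ m → map (e ℕ.+ n ,_) (upTo m) ++ []) (ρ≡0 (e ℕ.+ n) (ℕ.m≤n+m n e)))) (List.++-identityʳ _)))))
      (skew-extend e ρ≡0)

    Removable : (ℕ → ℕ) → ℕ → Set
    Removable ρ r = μ r < ρ r × ρ (suc r) < ρ r

    removable? : ∀ ρ r → Dec (Removable ρ r)
    removable? ρ r = (μ r ℕ.<? ρ r) ×-dec (ρ (suc r) ℕ.<? ρ r)

    module _ (μ-anti : ∀ {i j} → i ≤ j → μ j ≤ μ i) {ρ : ℕ → ℕ} (ρ-anti : ∀ {i j} → i ≤ j → ρ j ≤ ρ i)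
             {N : ℕ} (ρ≡0 : ρ N ≡ 0) where

      private
        below : ∀ {i j} → j < ρ i → i < N
        below {i} {j} j<ρ = ℕ.≰⇒> λ N≤i → ℕ.n≮0 (ℕ.<-≤-trans j<ρ (ℕ.≤-trans (ρ-anti N≤i) (ℕ.≤-reflexive ρ≡0)))

        ∈-skew : ∀ {i j} → μ i ≤ j → j < ρ i → (i , j) ∈ skew ρ (upTo N)
        ∈-skew μ≤j j<ρ = ∈-skew⁺ (∈-upTo⁺ (below j<ρ)) μ≤j j<ρ

        splice : ∀ {A : Set} {x : A} {cs} ys zs → cs ≡ ys ++ x ∷ zs →
          ∃[ s ] List.lookup cs s ≡ x × List.removeAt cs s ≡ ys ++ zs
        splice []       zs refl = zero , refl , refl
        splice (y ∷ ys) zs refl with splice ys zs refl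
        ... | s , eq , eq′ = suc s , eq , cong (y ∷_) eq′

        pred< : ∀ {m n} → m < n → n ∸ 1 < n
        pred< (s≤s _) = ℕ.n<1+n _

      -- A cell is maximal exactly if it ends its row and the next row is shorter. So `rowOf` maps
      -- the maximal cells bijectively onto the removable rows, and the recurrence for lists of
      -- cells becomes one for shapes.
      #standard-skew : ∀ {x xs} → skew ρ (upTo N) ≡ x ∷ xs → #standard (skew ρ (upTo N)) ≡
        sum (map (λ r → #standard (skew (decrement r ρ) (upTo N))) (filter (removable? ρ) (upTo N)))
      #standard-skew {x} {xs} cs≡ = trans (cong #standard cs≡) (trans (#standard-recurrence x xs)
        (trans (cong sum (trans (map-cong-∈ removed) (List.map-∘ (maximals c)))) (sum-↭ (Perm.map⁺ _ rows↭))))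
        where
        cs = x ∷ xs
        c = List.lookup cs

        rowOf : Fin (length cs) → ℕ
        rowOf s = proj₁ (c s)

        cs! : Unique cs
        cs! = subst Unique cs≡ (skew-! (Unique.upTo⁺ N))

        ∈cs : ∀ {i j} → μ i ≤ j → j < ρ i → ∃[ s ] c s ≡ (i , j)
        ∈cs μ≤j j<ρ = Any.index x∈ , sym (lookup-index x∈)
          where
          x∈ = subst (_ ∈_) cs≡ (∈-skew μ≤j j<ρ)
          lookup-index : ∀ {A : Set} {y : A} {ys} (y∈ : y ∈ ys) → y ≡ List.lookup ys (Any.index y∈)
          lookup-index (here eq)  = eq
          lookup-index (there y∈) = lookup-index y∈

        cs∋ : ∀ s → μ (rowOf s) ≤ proj₂ (c s) × proj₂ (c s) < ρ (rowOf s)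
        cs∋ s = proj₂ (∈-skew⁻ {ρ} {upTo N} (subst (c s ∈_) (sym cs≡) (∈-lookup s)))

        ∈-maximals⁻ : ∀ {s} → s ∈ maximals c → Maximal c s
        ∈-maximals⁻ s∈ = proj₂ (∈-filter⁻ (maximal? c) {xs = allFin _} s∈)

        maximal-cell : ∀ s → Maximal c s → proj₂ (c s) ≡ ρ (rowOf s) ∸ 1 × Removable ρ (rowOf s)
        maximal-cell s max = j≡ , ℕ.≤-<-trans μ≤j j<ρ , ρ-drop
          where
          μ≤j = proj₁ (cs∋ s)
          j<ρ = proj₂ (cs∋ s)
          j≡ : proj₂ (c s) ≡ ρ (rowOf s) ∸ 1
          j≡ with ℕ.m≤n⇒m<n∨m≡n j<ρ
          ... | inj₂ eq = cong (_∸ 1) eq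
          ... | inj₁ lt with ∈cs (ℕ.m≤n⇒m≤1+n μ≤j) lt
          ... | t , eq = contradiction (subst (proj₂ (c s) <_) (sym (cong proj₂ eq)) ℕ.≤-refl) (proj₁ (max t) (sym (cong proj₁ eq)))
          -- Were the next row as long, the box below would lie in the skew shape, because `μ` is
          -- antitone, and would contradict maximality.
          ρ-drop : ρ (suc (rowOf s)) < ρ (rowOf s)
          ρ-drop = ℕ.≰⇒> λ ρ≤ → let t , eq = ∈cs (ℕ.≤-trans (μ-anti (ℕ.n≤1+n _)) μ≤j) (ℕ.<-≤-trans j<ρ ρ≤) in
            proj₂ (max t) (sym (cong proj₂ eq)) (subst (rowOf s <_) (sym (cong proj₁ eq)) ℕ.≤-refl)

        removed : ∀ {s} → s ∈ maximals c →
          #standard (List.removeAt cs s) ≡ #standard (skew (decrement (rowOf s) ρ) (upTo N))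
        removed {s} s∈ with maximal-cell s (∈-maximals⁻ s∈)
        ... | j≡ , μ<ρ , _ with skew-remove {ρ} (Unique.upTo⁺ N) (∈-upTo⁺ (below μ<ρ)) μ<ρ
        ... | ys , zs , eq , eq′ with splice ys zs (trans (sym cs≡) eq)
        ... | t , look , rem = cong #standard (trans (cong (List.removeAt cs) s≡t) (trans rem (sym eq′)))
          where
          s≡t : s ≡ t
          s≡t = lookup-injective cs! s t (trans (cong (rowOf s ,_) j≡) (sym look))

        map-cong-∈ : ∀ {f g : Fin (length cs) → ℕ} {ss} → (∀ {s} → s ∈ ss → f s ≡ g s) → map f ss ≡ map g ss
        map-cong-∈ {ss = []}     eq = refl
        map-cong-∈ {ss = s ∷ ss} eq = cong₂ _∷_ (eq (here refl)) (map-cong-∈ (eq ∘ there))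

        corner : ∀ {r} → Removable ρ r → ∃[ s ] c s ≡ (r , ρ r ∸ 1) × Maximal c s
        corner {r} (μ<ρ , ρ-drop) with ∈cs (ℕ.<⇒≤pred μ<ρ) (pred< μ<ρ)
        ... | s , eq = s , eq , max
          where
          max : Maximal c s
          max t rewrite eq =
              (λ { refl j< → ℕ.<⇒≱ (proj₂ (cs∋ t)) (subst (_≤ proj₂ (c t)) (ℕ.m+[n∸m]≡n (ℕ.≤-<-trans z≤n μ<ρ)) j<) })
            , (λ j≡ i< → ℕ.<⇒≱ ρ-drop (ℕ.≤-trans (ℕ.≤-reflexive (trans (sym (ℕ.m+[n∸m]≡n (ℕ.≤-<-trans z≤n μ<ρ))) (cong suc j≡)))
                    (ℕ.≤-trans (proj₂ (cs∋ t)) (ρ-anti i<))))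

        rows↭ : map rowOf (maximals c) ↭ filter (removable? ρ) (upTo N)
        rows↭ = Unique-≡⇒↭ rows! (Unique.filter⁺ (removable? ρ) (Unique.upTo⁺ N)) to from
          where
          same-row : ∀ {s t} → s ∈ maximals c → t ∈ maximals c → rowOf s ≡ rowOf t → s ≡ t
          same-row {s} {t} s∈ t∈ eq = lookup-injective cs! s t (cong₂ _,_ eq
            (trans (proj₁ (maximal-cell s (∈-maximals⁻ s∈))) (trans (cong (λ r → ρ r ∸ 1) eq) (sym (proj₁ (maximal-cell t (∈-maximals⁻ t∈)))))))
          map! : ∀ ss → (∀ {s t} → s ∈ ss → t ∈ ss → rowOf s ≡ rowOf t → s ≡ t) → Unique ss → Unique (map rowOf ss)
          map! []       inj _ = AllPairs.[]
          map! (s ∷ ss) inj (s∉ AllPairs.∷ ss!) =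
            All.map⁺ (All.tabulate λ t∈ eq → All.lookup s∉ t∈ (inj (here refl) (there t∈) eq))
            AllPairs.∷ map! ss (λ s∈ t∈ → inj (there s∈) (there t∈)) ss!
          rows! : Unique (map rowOf (maximals c))
          rows! = map! (maximals c) same-row (Unique.filter⁺ (maximal? c) (Unique.allFin⁺ _))
          to : ∀ {r} → r ∈ map rowOf (maximals c) → r ∈ filter (removable? ρ) (upTo N)
          to r∈ with ∈-map⁻ rowOf r∈
          ... | s , s∈ , refl with maximal-cell s (∈-maximals⁻ s∈)
          ... | _ , rem = ∈-filter⁺ (removable? ρ) (∈-upTo⁺ (below (proj₁ rem))) rem
          from : ∀ {r} → r ∈ filter (removable? ρ) (upTo N) → r ∈ map rowOf (maximals c)
          from r∈ with corner (proj₂ (∈-filter⁻ (removable? ρ) {xs = upTo N} r∈))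
          ... | s , eq , max = subst (_∈ map rowOf (maximals c)) (cong proj₁ eq)
                                 (∈-map⁺ rowOf (∈-filter⁺ (maximal? c) (∈-allFin s) max))

open Tableaux

-- Dimensions of skew diagrams as determinants of falling factorials.

Antitone : (ℕ → ℕ) → Set
Antitone ρ = ∀ {i j} → i ≤ j → ρ j ≤ ρ i

total : ℕ → (ℕ → ℕ) → ℕ
total zero    ρ = 0
total (suc n) ρ = ρ 0 ℕ.+ total n (ρ ∘ suc)

total-mono : ∀ n {μ ρ} → (∀ i → i < n → μ i ≤ ρ i) → total n μ ≤ total n ρ
total-mono zero    μ≤ρ = z≤n
total-mono (suc n) μ≤ρ = ℕ.+-mono-≤ (μ≤ρ 0 (s≤s z≤n)) (total-mono n (λ i i<n → μ≤ρ (suc i) (s≤s i<n)))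

total-≡ : ∀ n {μ ρ} → (∀ i → μ i ≤ ρ i) → total n ρ ≡ total n μ → ∀ i → i < n → ρ i ≡ μ i
total-≡ (suc n) {μ} {ρ} μ≤ρ eq = pointwise
  where
  head≡ : ρ 0 ≡ μ 0
  head≡ = ℕ.≤-antisym (ℕ.+-cancelʳ-≤ (total n (ρ ∘ suc)) _ _ (ℕ.≤-trans (ℕ.≤-reflexive eq)
    (ℕ.+-monoʳ-≤ (μ 0) (total-mono n λ i _ → μ≤ρ (suc i))))) (μ≤ρ 0)
  pointwise : ∀ i → i < suc n → ρ i ≡ μ i
  pointwise zero    _         = head≡
  pointwise (suc i) (s≤s i<n) = total-≡ n (μ≤ρ ∘ suc)
    (ℕ.+-cancelˡ-≡ (μ 0) _ _ (≡.trans (≡.cong (ℕ._+ total n (ρ ∘ suc)) (≡.sym head≡)) eq)) i i<n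

total-zero : ∀ n → total n (λ _ → 0) ≡ 0
total-zero zero    = ≡.refl
total-zero (suc n) = total-zero n

total-decrement : ∀ n {r} ρ → r < n → 0 < ρ r → suc (total n (decrement r ρ)) ≡ total n ρ
total-decrement (suc n) {zero} ρ _ 0<ρ = ≡.cong (ℕ._+ total n (ρ ∘ suc)) (ℕ.m+[n∸m]≡n 0<ρ)
total-decrement (suc n) {suc r} ρ (s≤s r<n) 0<ρ = ≡.trans (≡.sym (ℕ.+-suc (ρ 0) _))
  (≡.cong (ρ 0 ℕ.+_) (total-decrement n (ρ ∘ suc) r<n 0<ρ))

-- The shifted row lengths, `l` or `m` of the overview, with rows numbered from 0.
β : ℕ → (ℕ → ℕ) → ℕ → ℕ
β N ρ i = ρ i ℕ.+ (N ∸ suc i)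

β-< : ∀ {N μ ρ} → Antitone μ → Antitone ρ → ∀ {r i j} → ρ r < μ r → i ≤ r → r ≤ j → β N ρ j < β N μ i
β-< {N} μ-anti ρ-anti ρ<μ i≤r r≤j = ℕ.+-mono-<-≤
  (ℕ.≤-<-trans (ρ-anti r≤j) (ℕ.<-≤-trans ρ<μ (μ-anti i≤r))) (ℕ.∸-monoʳ-≤ N (s≤s (ℕ.≤-trans i≤r r≤j)))

module DimensionFormula {c ℓ} (R : CommutativeRing c ℓ) where
  open CommutativeRing R hiding (zero)
  open RingProperties ring using (-0#≈0#)
  open IntegerCoefficients R
  open Determinants R
  open PowerSeries R
  open SetoidReasoning setoid
  open Determinant rawRing using (det)
  open RawSemiringDefinitions (RawRing.rawSemiring rawRing) using () renaming (_×_ to _·_; sum to ∑)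
  private
    module ∑ = SemiringSum semiring
    module ∏ = Summation *-commutativeMonoid
    module · = SemiringMultiples semiring

  fromℕ : ℕ → Carrier
  fromℕ n = n · 1#

  fromℕ-pred : ∀ {n} → 0 < n → fromℕ (n ∸ 1) ≈ fromℕ n - 1#
  fromℕ-pred {suc n} _ = solve 1 (λ x → x := :1 :+ x :- :1) refl (fromℕ n)

  falling-zero : ∀ {l m} → l < m → falling (fromℕ l) m ≈ 0#
  falling-zero {zero}  (s≤s _)   = zeroˡ _
  falling-zero {suc l} {suc m} (s≤s l<m) = trans (*-congˡ (trans (falling-cong m (sym (fromℕ-pred {suc l} (s≤s z≤n)))) (falling-zero l<m))) (zeroʳ _)

  falling-self : ∀ n → falling (fromℕ n) n ≈ fromℕ (n !)
  falling-self zero    = sym (+-identityʳ 1#)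
  falling-self (suc n) = trans (*-congˡ (trans (falling-cong n (sym (fromℕ-pred {suc n} (s≤s z≤n)))) (falling-self n)))
    (sym (·.×1-homo-* (suc n) (n !)))

  -- Both sides are the falling factorial of length m + 1, split at its first and at its last
  -- factor. So lowering `l` by one turns an entry into (l - m) / l times itself, up to division.
  falling-lower : ∀ m y → y * falling (y - 1#) m ≈ (y - fromℕ m) * falling y m
  falling-lower zero    y = *-congʳ (sym (trans (+-congˡ -0#≈0#) (+-identityʳ y)))
  falling-lower (suc m) y = begin
    y * ((y - 1#) * falling (y - 1# - 1#) m)
      ≈⟨ *-congˡ (falling-lower m (y - 1#)) ⟩
    y * ((y - 1# - fromℕ m) * falling (y - 1#) m)
      ≈⟨ solve 3 (λ y n f → y :* ((y :- :1 :- n) :* f) := (y :- (:1 :+ n)) :* (y :* f)) refl y (fromℕ m) _ ⟩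
    (y - fromℕ (suc m)) * (y * falling (y - 1#) m) ∎

  fromℕ-total : ∀ n ρ → fromℕ (total n ρ) ≈ ∑ {n} (λ i → fromℕ (ρ (toℕ i)))
  fromℕ-total zero    ρ = refl
  fromℕ-total (suc n) ρ = trans (·.×-homo-+ 1# (ρ 0) _) (+-congˡ (fromℕ-total n (ρ ∘ suc)))

  fallingMatrix : ∀ N (μ ρ : ℕ → ℕ) → Matrix N
  fallingMatrix N μ ρ i j = falling (fromℕ (β N ρ (toℕ j))) (β N μ (toℕ i))

  private
    ∑-filter : ∀ {P : ℕ → Set} (P? : ∀ r → Dec (P r)) (f : ℕ → ℕ) n (g : ℕ → ℕ) →
      fromℕ (sum (map f (filter P? (applyUpTo g n)))) ≈
      ∑ {n} (λ r → if does (P? (g (toℕ r))) then fromℕ (f (g (toℕ r))) else 0#)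
    ∑-filter P? f zero    g = refl
    ∑-filter P? f (suc n) g with P? (g 0)
    ... | yes _ = trans (·.×-homo-+ 1# (f (g 0)) _) (+-congˡ (∑-filter P? f n (g ∘ suc)))
    ... | no _  = trans (∑-filter P? f n (g ∘ suc)) (sym (+-identityˡ _))

    det-adjacent′ : ∀ {n} (r : Fin n) → suc (toℕ r) < n → (A : Matrix n) →
      (∀ i j → toℕ j ≡ suc (toℕ r) → A i r ≈ A i j) → det A ≈ 0#
    det-adjacent′ {suc n} r r<n A eq = det-adjacent p A λ i → trans
      (reflexive (≡.cong (A i) (Fin.toℕ-injective (≡.trans (Fin.toℕ-inject₁ p) toℕ-p))))
      (eq i (suc p) (≡.cong suc toℕ-p))
      where
      p = fromℕ< (s≤s⁻¹ r<n)
      toℕ-p = Fin.toℕ-fromℕ< (s≤s⁻¹ r<n)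

  module _ (N : ℕ) {μ : ℕ → ℕ} (μ-anti : Antitone μ) where
    open Skew μ

    -- If row `r` of `μ` sticks out, then lⱼ < mᵢ for i ≤ r ≤ j, and the falling factorials in that
    -- block contain the factor zero.
    ⊈⇒det≈0 : ∀ {ρ} → Antitone ρ → ∀ {r} → r < N → ρ r < μ r → det (fallingMatrix N μ ρ) ≈ 0#
    ⊈⇒det≈0 {ρ} ρ-anti {r} r<N ρ<μ = det-zero-block (fromℕ< r<N) _ λ i j i≤r r≤j →
      falling-zero (β-< {N} μ-anti ρ-anti ρ<μ (≡.subst (toℕ i ≤_) (Fin.toℕ-fromℕ< r<N) i≤r) (≡.subst (_≤ toℕ j) (Fin.toℕ-fromℕ< r<N) r≤j))

    private
      module Step {ρ : ℕ → ℕ} (ρ-anti : Antitone ρ) (ρ≡0 : ρ N ≡ 0) (μ≤ρ : ∀ i → μ i ≤ ρ i) where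
        l : Fin N → Carrier
        l j = fromℕ (β N ρ (toℕ j))

        m : Fin N → Carrier
        m i = fromℕ (β N μ (toℕ i))

        F : Matrix N
        F = fallingMatrix N μ ρ

        lowered : Fin N → Matrix N
        lowered r i j = if does (j Fin.≟ r) then falling (l j - 1#) (β N μ (toℕ i)) else F i j

        lowered-≡ : ∀ r i → lowered r i r ≡ falling (l r - 1#) (β N μ (toℕ i))
        lowered-≡ r i rewrite dec-true (r Fin.≟ r) ≡.refl = ≡.refl

        lowered-≢ : ∀ r i {j} → j ≢ r → lowered r i j ≡ F i j
        lowered-≢ r i {j} j≢r rewrite dec-false (j Fin.≟ r) j≢r = ≡.refl

        -- By `falling-lower`, `l r` times the lowered column has the entries (l r - m i) F i r; its
        -- two parts give a multiple of `det F` and the weighted determinant.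
        det-lowered : ∀ r → l r * det (lowered r) ≈ l r * det F - det (weigh m r F)
        det-lowered r = begin
          l r * det (lowered r)
            ≈⟨ solve 2 (λ a b → b := a :+ b :- a) refl (det (weigh m r F)) _ ⟩
          det (weigh m r F) + l r * det (lowered r) - det (weigh m r F)
            ≈⟨ +-congʳ (det-linear r (l r)
                 (λ i j j≢r → reflexive (≡.trans (lowered-≢ r i j≢r) (≡.sym (weigh-≢ m r F i j≢r))))
                 (λ i j j≢r → reflexive (≡.trans (weigh-≢ (λ _ → l r) r F i j≢r) (≡.sym (weigh-≢ m r F i j≢r))))
                 column) ⟨
          det (weigh (λ _ → l r) r F) - det (weigh m r F)
            ≈⟨ +-congʳ (det-linear r (l r - 1#) (λ i j _ → refl) (λ i j j≢r → reflexive (weigh-≢ (λ _ → l r) r F i j≢r))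
                 λ i → trans (reflexive (weigh-≡ (λ _ → l r) r F i)) (solve 2 (λ x f → x :* f := f :+ (x :- :1) :* f) refl (l r) (F i r))) ⟩
          det F + (l r - 1#) * det F - det (weigh m r F)
            ≈⟨ +-congʳ (solve 2 (λ x f → f :+ (x :- :1) :* f := x :* f) refl (l r) (det F)) ⟩
          l r * det F - det (weigh m r F) ∎
          where
          column : ∀ i → weigh (λ _ → l r) r F i r ≈ weigh m r F i r + l r * lowered r i r
          column i rewrite weigh-≡ (λ _ → l r) r F i | weigh-≡ m r F i | lowered-≡ r i = begin
            l r * F i r                          ≈⟨ solve 3 (λ x y f → x :* f := y :* f :+ (x :- y) :* f) refl (l r) (m i) (F i r) ⟩
            m i * F i r + (l r - m i) * F i r    ≈⟨ +-congˡ (falling-lower (β N μ (toℕ i)) (l r)) ⟨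
            m i * F i r + l r * falling (l r - 1#) (β N μ (toℕ i)) ∎

        -- By `∑-det-weigh` the weighted determinants add up to `∑ m * det F`, and ∑ l - ∑ m is the
        -- number of boxes, as the staircase shifts cancel.
        ∑-lowered : ∀ {d} → total N ρ ≡ suc d ℕ.+ total N μ → ∑ (λ r → l r * det (lowered r)) ≈ fromℕ (suc d) * det F
        ∑-lowered {d} eq = begin
          ∑ (λ r → l r * det (lowered r))
            ≈⟨ ∑-cong _ (λ r → l r * det F + - 1# * det (weigh m r F)) (λ r → trans (det-lowered r)
                 (solve 2 (λ a b → a :- b := a :+ (:- :1) :* b) refl _ _)) ⟩
          ∑ (λ r → l r * det F + - 1# * det (weigh m r F))
            ≈⟨ ∑.∑-distrib-+ (λ r → l r * det F) _ ⟩
          ∑ (λ r → l r * det F) + ∑ (λ r → - 1# * det (weigh m r F))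
            ≈⟨ +-cong (sym (∑.*-distribʳ-sum (det F) l)) (sym (∑.*-distribˡ-sum (- 1#) (λ r → det (weigh m r F)))) ⟩
          ∑ l * det F + - 1# * ∑ (λ r → det (weigh m r F))
            ≈⟨ +-congˡ (*-congˡ (∑-det-weigh m F)) ⟩
          ∑ l * det F + - 1# * (∑ m * det F)
            ≈⟨ +-congʳ (*-congʳ l-sum) ⟩
          (fromℕ (suc d) + ∑ m) * det F + - 1# * (∑ m * det F)
            ≈⟨ solve 3 (λ a b f → (a :+ b) :* f :+ (:- :1) :* (b :* f) := a :* f) refl _ _ _ ⟩
          fromℕ (suc d) * det F ∎
          where
          s : Fin N → Carrier
          s j = fromℕ (N ∸ suc (toℕ j))
          split : ∀ κ → ∑ {N} (λ j → fromℕ (β N κ (toℕ j))) ≈ fromℕ (total N κ) + ∑ s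
          split κ = trans (∑-cong _ (λ j → fromℕ (κ (toℕ j)) + s j) λ j → ·.×-homo-+ 1# (κ (toℕ j)) _)
            (trans (∑.∑-distrib-+ (λ j → fromℕ (κ (toℕ j))) s) (+-congʳ (sym (fromℕ-total N κ))))
          l-sum : ∑ l ≈ fromℕ (suc d) + ∑ m
          l-sum = trans (split ρ) (trans (+-congʳ (trans (reflexive (≡.cong fromℕ eq)) (·.×-homo-+ 1# (suc d) _)))
            (trans (+-assoc _ _ _) (+-congˡ (sym (split μ)))))

        β-decrement-≢ : ∀ {r j} → j ≢ r → β N (decrement r ρ) j ≡ β N ρ j
        β-decrement-≢ {r} {j} j≢r = ≡.cong (ℕ._+ (N ∸ suc j)) (decrement-≢ ρ j≢r)

        β-decrement-≡ : ∀ {r} → 0 < ρ r → suc (β N (decrement r ρ) r) ≡ β N ρ r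
        β-decrement-≡ {r} 0<ρ = ≡.cong (ℕ._+ (N ∸ suc r)) (≡.trans (≡.cong suc (decrement-≡ r ρ)) (ℕ.m+[n∸m]≡n 0<ρ))

        det-decrement : ∀ r → 0 < ρ (toℕ r) → det (fallingMatrix N μ (decrement (toℕ r) ρ)) ≈ det (lowered r)
        det-decrement r 0<ρ = det-cong entry≈
          where
          entry≈ : ∀ i j → fallingMatrix N μ (decrement (toℕ r) ρ) i j ≈ lowered r i j
          entry≈ i j with j Fin.≟ r
          ... | yes ≡.refl = falling-cong (β N μ (toℕ i)) (fromℕ-pred′ (≡.sym (β-decrement-≡ 0<ρ)))
            where
            fromℕ-pred′ : ∀ {a b} → b ≡ suc a → fromℕ a ≈ fromℕ b - 1#
            fromℕ-pred′ {a} ≡.refl = fromℕ-pred {suc a} (s≤s z≤n)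
          ... | no j≢r = falling-cong (β N μ (toℕ i)) (reflexive (≡.cong fromℕ (β-decrement-≢ (j≢r ∘ Fin.toℕ-injective))))

        factorials : (ℕ → ℕ) → Carrier
        factorials κ = ∏ {N} (λ j → fromℕ (β N κ (toℕ j) !))

        factorials-decrement : ∀ r → 0 < ρ (toℕ r) → factorials ρ ≈ l r * factorials (decrement (toℕ r) ρ)
        factorials-decrement r 0<ρ = go r 0<ρ
          where
          go : ∀ {n} (r : Fin n) → 0 < ρ (toℕ r) →
            ∏ {n} (λ j → fromℕ (β N ρ (toℕ j) !)) ≈
            fromℕ (β N ρ (toℕ r)) * ∏ {n} (λ j → fromℕ (β N (decrement (toℕ r) ρ) (toℕ j) !))
          go {suc n} r 0<ρ = begin
            ∏ {suc n} f
              ≈⟨ ∏.sum-remove {i = r} f ⟩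
            f r * ∏ (f ∘ punchIn r)
              ≈⟨ *-cong (trans (reflexive (≡.cong (fromℕ ∘ _!) (≡.sym (β-decrement-≡ 0<ρ)))) (trans (·.×1-homo-* (suc b) (b !))
                   (*-congʳ (reflexive (≡.cong fromℕ (β-decrement-≡ 0<ρ))))))
                   (∏.sum-cong-≋ λ j → reflexive (≡.cong (fromℕ ∘ _!) (≡.sym (β-decrement-≢ (Fin.punchInᵢ≢i r j ∘ Fin.toℕ-injective))))) ⟩
            fromℕ (β N ρ (toℕ r)) * g r * ∏ (g ∘ punchIn r)
              ≈⟨ *-assoc _ _ _ ⟩
            fromℕ (β N ρ (toℕ r)) * (g r * ∏ (g ∘ punchIn r))
              ≈⟨ *-congˡ (∏.sum-remove {i = r} g) ⟨
            fromℕ (β N ρ (toℕ r)) * ∏ {suc n} g ∎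
            where
            b = β N (decrement (toℕ r) ρ) (toℕ r)
            f g : Fin (suc n) → Carrier
            f j = fromℕ (β N ρ (toℕ j) !)
            g j = fromℕ (β N (decrement (toℕ r) ρ) (toℕ j) !)

        -- The sum runs over all rows, so those that cannot lose a box have to contribute zero. If
        -- row `r` exceeds the next one, it does not exceed row `r` of `μ`, and lowering it creates
        -- a zero block. If it equals the next one, the lowered column equals the next column. If it
        -- is the last, it is empty and `l r` is zero.
        not-removable : ∀ r → ¬ Removable ρ (toℕ r) → l r * det (lowered r) ≈ 0#
        not-removable r ¬rem with ρ (suc (toℕ r)) ℕ.<? ρ (toℕ r)
        ... | yes ρ-drop = trans (*-congˡ (det-zero-block r (lowered r) zero-block)) (zeroʳ _)
          where
          ρ≡μ : ρ (toℕ r) ≤ μ (toℕ r)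
          ρ≡μ = ℕ.≮⇒≥ λ μ<ρ → ¬rem (μ<ρ , ρ-drop)
          0<ρ : 0 < ρ (toℕ r)
          0<ρ = ℕ.≤-<-trans z≤n ρ-drop
          β<ₛ : ∀ {i j} → i ≤ toℕ r → toℕ r < j → β N ρ j < β N μ i
          β<ₛ i≤r r<j = ℕ.+-mono-<-≤ (ℕ.≤-<-trans (ρ-anti r<j) (ℕ.<-≤-trans ρ-drop (ℕ.≤-trans ρ≡μ (μ-anti i≤r))))
            (ℕ.∸-monoʳ-≤ N (s≤s (ℕ.≤-trans i≤r (ℕ.<⇒≤ r<j))))
          zero-block : ∀ i j → toℕ i ≤ toℕ r → toℕ r ≤ toℕ j → lowered r i j ≈ 0#
          zero-block i j i≤r r≤j with j Fin.≟ r
          ... | yes ≡.refl = trans (falling-cong (β N μ (toℕ i)) (sym (fromℕ-pred (ℕ.<-≤-trans 0<ρ (ℕ.m≤m+n _ _)))))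
            (falling-zero (ℕ.<-≤-trans (ℕ.∸-monoʳ-< {o = 0} (s≤s z≤n) (ℕ.<-≤-trans 0<ρ (ℕ.m≤m+n _ _)))
              (ℕ.+-mono-≤ (ℕ.≤-trans ρ≡μ (μ-anti i≤r)) (ℕ.∸-monoʳ-≤ N (s≤s i≤r)))))
          ... | no j≢r = falling-zero (β<ₛ i≤r (ℕ.≤∧≢⇒< r≤j (j≢r ∘ ≡.sym ∘ Fin.toℕ-injective)))
        ... | no ¬drop = go r ¬drop
          where
          go : ∀ r → ¬ (ρ (suc (toℕ r)) < ρ (toℕ r)) → l r * det (lowered r) ≈ 0#
          go r ¬drop with ℕ.m≤n⇒m<n∨m≡n (Fin.toℕ<n r)
          ... | inj₂ last = trans (*-congʳ (reflexive (≡.cong fromℕ (≡.cong₂ ℕ._+_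
                  (ℕ.n≤0⇒n≡0 (ℕ.≤-trans (ℕ.≮⇒≥ ¬drop) (ℕ.≤-reflexive (≡.trans (≡.cong ρ last) ρ≡0))))
                  (≡.trans (≡.cong (N ∸_) last) (ℕ.n∸n≡0 N)))))) (zeroˡ _)
          ... | inj₁ r<N = trans (*-congˡ (det-adjacent′ r r<N (lowered r) columns)) (zeroʳ _)
            where
            ρ≡ : ρ (suc (toℕ r)) ≡ ρ (toℕ r)
            ρ≡ = ℕ.≤-antisym (ρ-anti (ℕ.n≤1+n _)) (ℕ.≮⇒≥ ¬drop)
            β-step : β N ρ (toℕ r) ≡ suc (β N ρ (suc (toℕ r)))
            β-step = ≡.trans (≡.cong₂ ℕ._+_ (≡.sym ρ≡) (∸-step r<N)) (ℕ.+-suc _ _)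
            columns : ∀ i (j : Fin N) → toℕ j ≡ suc (toℕ r) → lowered r i r ≈ lowered r i j
            columns i j eq = trans (reflexive (lowered-≡ r i)) (trans
              (falling-cong (β N μ (toℕ i)) (trans (+-congʳ (reflexive (≡.cong fromℕ β-step))) (trans (sym (fromℕ-pred {suc (β N ρ (suc (toℕ r)))} (s≤s z≤n)))
                 (reflexive (≡.cong (fromℕ ∘ β N ρ) (≡.sym eq))))))
              (reflexive (≡.sym (lowered-≢ r i {j} λ { ≡.refl → ℕ.1+n≢n (≡.sym eq) }))))

      decrement-anti : ∀ {ρ r} → Antitone ρ → ρ (suc r) < ρ r → Antitone (decrement r ρ)
      decrement-anti {ρ} {r} ρ-anti drop {i} {j} i≤j with i ℕ.≟ r | j ℕ.≟ r
      ... | yes ≡.refl | yes ≡.refl = ℕ.≤-refl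
      ... | no i≢r | yes ≡.refl rewrite decrement-≡ j ρ | decrement-≢ ρ i≢r = ℕ.≤-trans (ℕ.m∸n≤m (ρ j) 1) (ρ-anti i≤j)
      ... | no i≢r | no j≢r rewrite decrement-≢ ρ i≢r | decrement-≢ ρ j≢r = ρ-anti i≤j
      ... | yes ≡.refl | no j≢r rewrite decrement-≡ i ρ | decrement-≢ ρ j≢r =
        ℕ.≤-trans (ρ-anti (ℕ.≤∧≢⇒< i≤j (j≢r ∘ ≡.sym))) (ℕ.<⇒≤pred drop)

      decrement-≥ : ∀ {ρ r} → (∀ i → μ i ≤ ρ i) → μ r < ρ r → ∀ i → μ i ≤ decrement r ρ i
      decrement-≥ {ρ} {r} μ≤ρ μ<ρ i with i ℕ.≟ r
      ... | yes ≡.refl rewrite decrement-≡ i ρ   = ℕ.<⇒≤pred μ<ρ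
      ... | no i≢r     rewrite decrement-≢ ρ i≢r = μ≤ρ i

    -- Induction on the number `d` of boxes outside `μ`. The factorials stay on the left because `R`
    -- is any commutative ring; `ρ N ≡ 0` puts all boxes into the first `N` rows.
    dimension-formula : ∀ d {ρ} → Antitone ρ → ρ N ≡ 0 → (∀ i → μ i ≤ ρ i) → total N ρ ≡ d ℕ.+ total N μ →
      fromℕ (#standard (skew ρ (upTo N))) * ∏ {N} (λ j → fromℕ (β N ρ (toℕ j) !)) ≈ fromℕ (d !) * det (fallingMatrix N μ ρ)
    dimension-formula zero {ρ} ρ-anti ρ≡0 μ≤ρ eq = begin
      fromℕ (#standard (skew ρ (upTo N))) * P
        ≈⟨ *-congʳ (reflexive (≡.cong fromℕ (≡.trans (≡.cong #standard (skew-empty (All.tabulate λ i∈ → ℕ.≤-reflexive (ρ≡μ _ (∈-upTo⁻ i∈))))) #standard-[]))) ⟩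
      fromℕ 1 * P
        ≈⟨ *-congˡ (trans (det-lower-triangular (fallingMatrix N μ ρ) upper) (∏.sum-cong-≋ {N} diag)) ⟨
      fromℕ 1 * det (fallingMatrix N μ ρ) ∎
      where
      P = ∏ {N} (λ j → fromℕ (β N ρ (toℕ j) !))
      ρ≡μ : ∀ i → i < N → ρ i ≡ μ i
      ρ≡μ = total-≡ N μ≤ρ eq
      diag : ∀ j → fallingMatrix N μ ρ j j ≈ fromℕ (β N ρ (toℕ j) !)
      diag j rewrite ρ≡μ (toℕ j) (Fin.toℕ<n j) = falling-self (β N μ (toℕ j))
      upper : ∀ i j → toℕ i < toℕ j → fallingMatrix N μ ρ i j ≈ 0#
      upper i j i<j = falling-zero (ℕ.+-mono-≤-< (ℕ.≤-trans (ℕ.≤-reflexive (ρ≡μ (toℕ j) (Fin.toℕ<n j))) (μ-anti (ℕ.<⇒≤ i<j)))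
        (ℕ.∸-monoʳ-< (s≤s i<j) (Fin.toℕ<n j)))
    dimension-formula (suc d) {ρ} ρ-anti ρ≡0 μ≤ρ eq with skew ρ (upTo N) in cs≡
    -- Without a cell no row of `ρ` exceeds that of `μ`, although `ρ` has more boxes.
    ... | [] = contradiction (total-mono N λ i i<N → ℕ.≮⇒≥ λ μ<ρ → no-cell (∈-skew⁺ (∈-upTo⁺ i<N) ℕ.≤-refl μ<ρ))
                 (ℕ.<⇒≱ (≡.subst (total N μ <_) (≡.sym eq) (s≤s (ℕ.m≤n+m _ d))))
      where
      no-cell : ∀ {x} → ¬ (x ∈ skew ρ (upTo N))
      no-cell x∈ with () ← ≡.subst (_ ∈_) cs≡ x∈
    ... | x ∷ xs = begin
      fromℕ (#standard (x ∷ xs)) * P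
        ≈⟨ *-congʳ (trans (reflexive (≡.cong fromℕ (≡.trans (≡.cong #standard (≡.sym cs≡)) (#standard-skew μ-anti ρ-anti ρ≡0 cs≡))))
             (∑-filter (removable? ρ) count N id)) ⟩
      ∑ {N} t * P
        ≈⟨ ∑.*-distribʳ-sum P t ⟩
      ∑ {N} (λ r → t r * P)
        ≈⟨ ∑-cong _ (λ r → fromℕ (d !) * (l r * det (lowered r))) term≈ ⟩
      ∑ (λ r → fromℕ (d !) * (l r * det (lowered r)))
        ≈⟨ ∑.*-distribˡ-sum (fromℕ (d !)) (λ r → l r * det (lowered r)) ⟨
      fromℕ (d !) * ∑ (λ r → l r * det (lowered r))
        ≈⟨ *-congˡ (∑-lowered {d} eq) ⟩
      fromℕ (d !) * (fromℕ (suc d) * det F)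
        ≈⟨ solve 3 (λ a b f → a :* (b :* f) := b :* a :* f) refl _ _ _ ⟩
      fromℕ (suc d) * fromℕ (d !) * det F
        ≈⟨ *-congʳ (·.×1-homo-* (suc d) (d !)) ⟨
      fromℕ (suc d !) * det F ∎
      where
      open Step ρ-anti ρ≡0 μ≤ρ
      P = factorials ρ
      count : ℕ → ℕ
      count r = #standard (skew (decrement r ρ) (upTo N))
      t : Fin N → Carrier
      t r = if does (removable? ρ (toℕ r)) then fromℕ (count (toℕ r)) else 0#

      removable-term : ∀ r → Removable ρ (toℕ r) → fromℕ (count (toℕ r)) * P ≈ fromℕ (d !) * (l r * det (lowered r))
      removable-term r (μ<ρ , drop) = begin
        fromℕ (count (toℕ r)) * P
          ≈⟨ *-congˡ (factorials-decrement r 0<ρ) ⟩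
        fromℕ (count (toℕ r)) * (l r * factorials ρ⁻)
          ≈⟨ solve 3 (λ a b c → a :* (b :* c) := b :* (a :* c)) refl _ _ _ ⟩
        l r * (fromℕ (count (toℕ r)) * factorials ρ⁻)
          ≈⟨ *-congˡ (dimension-formula d {ρ⁻} (decrement-anti {ρ} ρ-anti drop)
               (≡.trans (decrement-≢ ρ (ℕ.<⇒≢ (Fin.toℕ<n r) ∘ ≡.sym)) ρ≡0) (decrement-≥ {ρ} μ≤ρ μ<ρ)
               (ℕ.suc-injective (≡.trans (total-decrement N ρ (Fin.toℕ<n r) 0<ρ) eq))) ⟩
        l r * (fromℕ (d !) * det (fallingMatrix N μ ρ⁻))
          ≈⟨ *-congˡ (*-congˡ (det-decrement r 0<ρ)) ⟩
        l r * (fromℕ (d !) * det (lowered r))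
          ≈⟨ solve 3 (λ a b c → b :* (a :* c) := a :* (b :* c)) refl _ _ _ ⟩
        fromℕ (d !) * (l r * det (lowered r)) ∎
        where
        ρ⁻ = decrement (toℕ r) ρ
        0<ρ : 0 < ρ (toℕ r)
        0<ρ = ℕ.≤-<-trans z≤n drop

      term≈ : ∀ r → t r * P ≈ fromℕ (d !) * (l r * det (lowered r))
      term≈ r with removable? ρ (toℕ r)
      ... | yes rem rewrite dec-true (removable? ρ (toℕ r)) rem = removable-term r rem
      ... | no ¬rem rewrite dec-false (removable? ρ (toℕ r)) ¬rem =
        trans (zeroˡ P) (sym (trans (*-congˡ (not-removable r ¬rem)) (zeroʳ _)))

-- Sums over initial segments, and the endomorphisms that adjoin or remove a variable.

module RangeSums {c ℓ} (R : CommutativeRing c ℓ) where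
  open CommutativeRing R hiding (zero)
  open Determinants R using (∑-cong)
  open SetoidReasoning setoid
  open RawSemiringDefinitions (RawRing.rawSemiring rawRing) using () renaming (sum to ∑)
  private
    module ∑ = SemiringSum semiring

  S : ℕ → (ℕ → Carrier) → Carrier
  S n g = ∑ {n} (g ∘ toℕ)

  S-cong : ∀ n {f g : ℕ → Carrier} → (∀ i → i < n → f i ≈ g i) → S n f ≈ S n g
  S-cong n eq = ∑-cong {n} _ _ λ i → eq (toℕ i) (Fin.toℕ<n i)

  S-zero : ∀ n {f : ℕ → Carrier} → (∀ i → i < n → f i ≈ 0#) → S n f ≈ 0#
  S-zero n eq = trans (S-cong n eq) (∑.sum-replicate-zero n)

  S-+ : ∀ n (f g : ℕ → Carrier) → S n (λ i → f i + g i) ≈ S n f + S n g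
  S-+ n f g = ∑.∑-distrib-+ {n} (f ∘ toℕ) (g ∘ toℕ)

  S-*ˡ : ∀ n x (f : ℕ → Carrier) → S n (λ i → x * f i) ≈ x * S n f
  S-*ˡ n x f = sym (∑.*-distribˡ-sum {n} x (f ∘ toℕ))

  S-*ʳ : ∀ n x (f : ℕ → Carrier) → S n (λ i → f i * x) ≈ S n f * x
  S-*ʳ n x f = sym (∑.*-distribʳ-sum {n} x (f ∘ toℕ))

  S-snoc : ∀ n (f : ℕ → Carrier) → S (suc n) f ≈ S n f + f n
  S-snoc zero    f = trans (+-identityʳ _) (sym (+-identityˡ _))
  S-snoc (suc n) f = trans (+-congˡ (S-snoc n (f ∘ suc))) (sym (+-assoc _ _ _))

  S-extend : ∀ {m n} (f : ℕ → Carrier) → m ≤ n → (∀ i → m ≤ i → f i ≈ 0#) → S n f ≈ S m f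
  S-extend {zero}  {n}     f _         f≈0 = S-zero n λ i _ → f≈0 i z≤n
  S-extend {suc m} {suc n} f (s≤s m≤n) f≈0 = +-congˡ (S-extend (f ∘ suc) m≤n (λ i m≤i → f≈0 (suc i) (s≤s m≤i)))

  S-single : ∀ {n} k (f : ℕ → Carrier) → k < n → (∀ i → i ≢ k → f i ≈ 0#) → S n f ≈ f k
  S-single {suc n} zero    f _         f≈0 = trans (+-congˡ (S-zero n λ i _ → f≈0 (suc i) (λ ()))) (+-identityʳ _)
  S-single {suc n} (suc k) f (s≤s k<n) f≈0 = trans (+-cong (f≈0 0 (λ ()))
    (S-single k (f ∘ suc) k<n λ i i≢k → f≈0 (suc i) (i≢k ∘ ℕ.suc-injective))) (+-identityˡ _)

  S-triangle : ∀ n (e : ℕ → ℕ → Carrier) → S n (λ k → S (suc k) (λ i → e i (k ∸ i))) ≈ S n (λ i → S (n ∸ i) (e i))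
  S-triangle zero    e = refl
  S-triangle (suc n) e = begin
    S (suc n) (λ k → S (suc k) (λ i → e i (k ∸ i)))
      ≈⟨ S-snoc n (λ k → S (suc k) (λ i → e i (k ∸ i))) ⟩
    S n (λ k → S (suc k) (λ i → e i (k ∸ i))) + S (suc n) (λ i → e i (n ∸ i))
      ≈⟨ +-congʳ (S-triangle n e) ⟩
    S n (λ i → S (n ∸ i) (e i)) + S (suc n) (λ i → e i (n ∸ i))
      ≈⟨ +-congʳ (trans (S-snoc n (λ i → S (n ∸ i) (e i))) (trans (+-congˡ (reflexive (≡.cong (λ m → S m (e n)) (ℕ.n∸n≡0 n)))) (+-identityʳ _))) ⟨
    S (suc n) (λ i → S (n ∸ i) (e i)) + S (suc n) (λ i → e i (n ∸ i))
      ≈⟨ S-+ (suc n) (λ i → S (n ∸ i) (e i)) (λ i → e i (n ∸ i)) ⟨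
    S (suc n) (λ i → S (n ∸ i) (e i) + e i (n ∸ i))
      ≈⟨ S-cong (suc n) (λ i i≤n → trans (reflexive (≡.cong (λ m → S m (e i)) (ℕ.+-∸-assoc 1 (s≤s⁻¹ i≤n)))) (S-snoc (n ∸ i) (e i))) ⟨
    S (suc n) (λ i → S (suc n ∸ i) (e i)) ∎

module Evaluation {c ℓ₁ ℓ₂} (K : HeytingField c ℓ₁ ℓ₂) (char0 : CharacteristicZero K) where
  open SymmetricFunctions K char0 public

  R : CommutativeRing c ℓ₁
  R = HeytingCommutativeRing.commutativeRing (HeytingField.heytingCommutativeRing K)

  open CommutativeRing R hiding (zero)
  open IntegerCoefficients R
  open Determinants R using (∑-cong)
  open RangeSums R
  open PowerSeries R hiding (T)
  open SetoidReasoning setoid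
  open RawSemiringDefinitions (RawRing.rawSemiring rawRing) using (_^_) renaming (sum to ∑)
  private
    module ∑ = SemiringSum semiring

  private
    zeroed : ∀ x {y} → y ≈ 0# → x * y ≈ 0#
    zeroed x y≈0 = trans (*-congˡ y≈0) (zeroʳ x)

  -- The adjoint of multiplication by hₖ.
  D : ℕ → Λ → Λ
  D k f = record
    { coeff     = λ α → coeff f (k ∷ α)
    ; padding   = λ α → trans (symmetric f (Perm.swap k 0 Perm.refl)) (padding f (k ∷ α))
    ; symmetric = λ α↭β → symmetric f (Perm.prep k α↭β)
    ; degree    = degree f
    ; bounded   = λ α d< → bounded f (k ∷ α) (ℕ.<-≤-trans d< (ℕ.m≤n+m _ k))
    }

  private
    sumΛ : ∀ n (F : ℕ → Λ) (d : ℕ) → (∀ i → i < n → ∀ α → d < sum α → coeff (F i) α ≈ 0#) → Λ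
    sumΛ n F d F-bounded = record
      { coeff     = λ α → S n (λ i → coeff (F i) α)
      ; padding   = λ α → S-cong n λ i _ → padding (F i) α
      ; symmetric = λ α↭β → S-cong n λ i _ → symmetric (F i) α↭β
      ; degree    = d
      ; bounded   = λ α d< → S-zero n λ i i<n → F-bounded i i<n α d<
      }

  -- A x f is f with the variable x adjoined, and A⁺ x f = A x f − f.
  A A⁺ : Carrier → Λ → Λ
  A x f = sumΛ (suc (degree f)) (λ k → x ^ k • D k f) (degree f)
    λ k _ α d< → zeroed (x ^ k) (bounded (D k f) α d<)
  -- The degree bound drops by one; the recursion of `inverse` ends because of it.
  A⁺ x f = sumΛ (degree f) (λ k → x ^ suc k • D (suc k) f) (degree f ∸ 1)
    λ k _ α d< → zeroed (x ^ suc k) (bounded f (suc k ∷ α) (s≤s (ℕ.≤-trans (lower (degree f) d<) (ℕ.m≤n+m _ k))))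
    where
    lower : ∀ d {n} → d ∸ 1 < n → d ≤ n
    lower zero    _ = z≤n
    lower (suc d) p = p

  -- `degree` is only a bound and may differ for equal functions, so the cut-off of the sum has to
  -- be movable.
  A-coeff : ∀ x f {n} → degree f < n → ∀ α → coeff (A x f) α ≈ S n (λ k → x ^ k * coeff f (k ∷ α))
  A-coeff x f d<n α = sym (S-extend (λ k → x ^ k * coeff f (k ∷ α)) d<n λ k d<k →
    zeroed (x ^ k) (bounded f (k ∷ α) (ℕ.<-≤-trans d<k (ℕ.m≤m+n k _))))

  record IsEndomorphism (Φ : Λ → Λ) : Set (c Level.⊔ ℓ₁) where
    field
      cong   : ∀ {f g} → f ≈Λ g → Φ f ≈Λ Φ g
      +-homo : ∀ f g → Φ (f +Λ g) ≈Λ Φ f +Λ Φ g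
      *-homo : ∀ f g → Φ (f *Λ g) ≈Λ Φ f *Λ Φ g
      •-homo : ∀ x f → Φ (x • f) ≈Λ x • Φ f
      1-homo : Φ 1Λ ≈Λ 1Λ

  ≈Λ-sym : ∀ {f g} → f ≈Λ g → g ≈Λ f
  ≈Λ-sym eq α = sym (eq α)

  ≈Λ-trans : ∀ {f g h} → f ≈Λ g → g ≈Λ h → f ≈Λ h
  ≈Λ-trans eq eq′ α = trans (eq α) (eq′ α)

  Function : Set c
  Function = List ℕ → Carrier

  convolution-S : ∀ n (F : ℕ → Function) G α →
    convolution (λ β → S n (λ i → F i β)) G α ≈ S n (λ i → convolution (F i) G α)
  convolution-S n F G []      = sym (S-*ʳ n (G []) (λ i → F i []))
  convolution-S n F G (a ∷ α) = trans (∑-cong {suc a} _ (λ b → S n (λ i → convolution (F i ∘ (toℕ b ∷_)) (G ∘ (a ∸ toℕ b ∷_)) α))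
    (λ b → convolution-S n (λ i → F i ∘ (toℕ b ∷_)) (G ∘ (a ∸ toℕ b ∷_)) α))
    (∑.∑-comm {suc a} {n} λ b i → convolution (F (toℕ i) ∘ (toℕ b ∷_)) (G ∘ (a ∸ toℕ b ∷_)) α)

  convolution-comm : ∀ F G α → convolution F G α ≈ convolution G F α
  convolution-comm F G []      = *-comm _ _
  convolution-comm F G (a ∷ α) = trans (∑-cong {suc a} _ _ λ i → convolution-comm (F ∘ (toℕ i ∷_)) (G ∘ (a ∸ toℕ i ∷_)) α)
    (reverse a (λ i j → convolution (G ∘ (j ∷_)) (F ∘ (i ∷_)) α))
    where
    reverse : ∀ n (g : ℕ → ℕ → Carrier) → S (suc n) (λ i → g i (n ∸ i)) ≈ S (suc n) (λ i → g (n ∸ i) i)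
    reverse zero    g = refl
    reverse (suc n) g = begin
      g 0 (suc n) + S (suc n) (λ i → g (suc i) (n ∸ i))
        ≈⟨ +-comm _ _ ⟩
      S (suc n) (λ i → g (suc i) (n ∸ i)) + g 0 (suc n)
        ≈⟨ +-cong (reverse n (λ i j → g (suc i) j)) (reflexive (≡.cong (λ m → g m (suc n)) (≡.sym (ℕ.n∸n≡0 n)))) ⟩
      S (suc n) (λ i → g (suc (n ∸ i)) i) + g (suc n ∸ suc n) (suc n)
        ≈⟨ +-congʳ (S-cong (suc n) λ i i≤n → reflexive (≡.cong (λ m → g m i) (≡.sym (ℕ.+-∸-assoc 1 (s≤s⁻¹ i≤n))))) ⟩
      S (suc n) (λ i → g (suc n ∸ i) i) + g (suc n ∸ suc n) (suc n)
        ≈⟨ S-snoc (suc n) (λ i → g (suc n ∸ i) i) ⟨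
      S (suc (suc n)) (λ i → g (suc n ∸ i) i) ∎

  convolution-•ˡ : ∀ x F G α → convolution (λ β → x * F β) G α ≈ x * convolution F G α
  convolution-•ˡ x F G []      = *-assoc _ _ _
  convolution-•ˡ x F G (a ∷ α) = trans
    (∑-cong {suc a} _ (λ b → x * convolution (F ∘ (toℕ b ∷_)) (G ∘ (a ∸ toℕ b ∷_)) α)
      λ b → convolution-•ˡ x (F ∘ (toℕ b ∷_)) (G ∘ (a ∸ toℕ b ∷_)) α)
    (S-*ˡ (suc a) x (λ b → convolution (F ∘ (b ∷_)) (G ∘ (a ∸ b ∷_)) α))

  convolution-0ˡ : ∀ {F} G → (∀ α → F α ≈ 0#) → ∀ α → convolution F G α ≈ 0#
  convolution-0ˡ G F≈0 α = convolution-zero _ G α λ β γ _ → trans (*-congʳ (F≈0 β)) (zeroˡ _)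

  private
    weighted : Carrier → (ℕ → Function) → ℕ → Function
    weighted x F i β = x ^ i * F i β

    convolution-weighted : ∀ x m n (F G : ℕ → Function) α →
      convolution (λ β → S m (λ i → x ^ i * F i β)) (λ β → S n (λ j → x ^ j * G j β)) α ≈
      S m (λ i → S n (λ j → x ^ i * x ^ j * convolution (F i) (G j) α))
    convolution-weighted x m n F G α = trans (convolution-S m (weighted x F) G′ α) (S-cong m λ i _ → begin
      convolution (weighted x F i) G′ α
        ≈⟨ convolution-•ˡ (x ^ i) (F i) G′ α ⟩
      x ^ i * convolution (F i) G′ α
        ≈⟨ *-congˡ (trans (convolution-comm (F i) G′ α) (convolution-S n (weighted x G) (F i) α)) ⟩
      x ^ i * S n (λ j → convolution (weighted x G j) (F i) α)
        ≈⟨ S-*ˡ n (x ^ i) (λ j → convolution (weighted x G j) (F i) α) ⟨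
      S n (λ j → x ^ i * convolution (weighted x G j) (F i) α)
        ≈⟨ S-cong n (λ j _ → trans (*-congˡ (trans (convolution-•ˡ (x ^ j) (G j) (F i) α) (*-congˡ (convolution-comm (G j) (F i) α))))
             (sym (*-assoc _ _ _))) ⟩
      S n (λ j → x ^ i * x ^ j * convolution (F i) (G j) α) ∎)
      where
      G′ : Function
      G′ β = S n (λ j → x ^ j * G j β)

    ^-+ : ∀ x m n → x ^ (m ℕ.+ n) ≈ x ^ m * x ^ n
    ^-+ x zero    n = sym (*-identityˡ _)
    ^-+ x (suc m) n = trans (*-congˡ (^-+ x m n)) (sym (*-assoc _ _ _))

  A-isEndomorphism : ∀ x → IsEndomorphism (A x)
  A-isEndomorphism x = record
    { cong   = λ {f} {g} f≈g α → let n = degree f ℕ.+ degree g in begin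
        coeff (A x f) α                              ≈⟨ A-coeff x f (s≤s (ℕ.m≤m+n (degree f) (degree g))) α ⟩
        S (suc n) (λ k → x ^ k * coeff f (k ∷ α))    ≈⟨ S-cong (suc n) (λ k _ → *-congˡ {x ^ k} (f≈g (k ∷ α))) ⟩
        S (suc n) (λ k → x ^ k * coeff g (k ∷ α))    ≈⟨ A-coeff x g (s≤s (ℕ.m≤n+m (degree g) (degree f))) α ⟨
        coeff (A x g) α                              ∎
    ; +-homo = λ f g α → let n = suc (degree f ℕ.⊔ degree g) in begin
        S n (λ k → x ^ k * (coeff f (k ∷ α) + coeff g (k ∷ α)))
          ≈⟨ S-cong n (λ k _ → distribˡ (x ^ k) (coeff f (k ∷ α)) (coeff g (k ∷ α))) ⟩
        S n (λ k → x ^ k * coeff f (k ∷ α) + x ^ k * coeff g (k ∷ α))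
          ≈⟨ S-+ n (λ k → x ^ k * coeff f (k ∷ α)) (λ k → x ^ k * coeff g (k ∷ α)) ⟩
        S n (λ k → x ^ k * coeff f (k ∷ α)) + S n (λ k → x ^ k * coeff g (k ∷ α))
          ≈⟨ +-cong (A-coeff x f (s≤s (ℕ.m≤m⊔n (degree f) (degree g))) α) (A-coeff x g (s≤s (ℕ.m≤n⊔m (degree f) (degree g))) α) ⟨
        coeff (A x f) α + coeff (A x g) α ∎
    ; *-homo = A-*
    ; •-homo = λ y f α → let n = suc (degree f) in trans
        (S-cong n λ k _ → solve 3 (λ p y f → p :* (y :* f) := y :* (p :* f)) refl (x ^ k) y (coeff f (k ∷ α)))
        (S-*ˡ n y (λ k → x ^ k * coeff f (k ∷ α)))
    ; 1-homo = λ α → trans (+-identityʳ _) (*-identityˡ _)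
    }
    where
    -- Convolution in the first exponent is the Cauchy product of the series ∑ x^k `D k f` and ∑ x^k
    -- `D k g`. The triangle of pairs with i + j ≤ d + d′ and the rectangle i ≤ d, j ≤ d′ contain
    -- the same nonzero terms.
    A-* : ∀ f g → A x (f *Λ g) ≈Λ A x f *Λ A x g
    A-* f g α = begin
      S n (λ k → x ^ k * S (suc k) (λ i → e i (k ∸ i)))
        ≈⟨ S-cong n {λ k → x ^ k * S (suc k) (λ i → e i (k ∸ i))} (λ k _ → trans (sym (S-*ˡ (suc k) (x ^ k) (λ i → e i (k ∸ i))))
             (S-cong (suc k) λ i i≤k → *-congʳ {e i (k ∸ i)} (trans (reflexive (≡.cong (x ^_) (≡.sym (ℕ.m+[n∸m]≡n (s≤s⁻¹ i≤k))))) (^-+ x i (k ∸ i))))) ⟩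
      S n (λ k → S (suc k) (λ i → x ^ i * x ^ (k ∸ i) * e i (k ∸ i)))
        ≈⟨ S-triangle n (λ i j → x ^ i * x ^ j * e i j) ⟩
      S n (λ i → S (n ∸ i) (λ j → x ^ i * x ^ j * e i j))
        ≈⟨ S-extend (λ i → S (n ∸ i) (λ j → x ^ i * x ^ j * e i j)) (s≤s (ℕ.m≤m+n d d′)) (λ i d<i → S-zero (n ∸ i) λ j _ → term≈0ˡ i j d<i) ⟩
      S (suc d) (λ i → S (n ∸ i) (λ j → x ^ i * x ^ j * e i j))
        ≈⟨ S-cong (suc d) (λ i i≤d → S-extend {suc d′} {n ∸ i} (λ j → x ^ i * x ^ j * e i j) (large i≤d) (λ j → term≈0ʳ i j)) ⟩
      S (suc d) (λ i → S (suc d′) (λ j → x ^ i * x ^ j * e i j))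
        ≈⟨ convolution-weighted x (suc d) (suc d′) (λ i → coeff (D i f)) (λ j → coeff (D j g)) α ⟨
      coeff (A x f *Λ A x g) α ∎
      where
      d = degree f
      d′ = degree g
      n = suc (d ℕ.+ d′)
      e : ℕ → ℕ → Carrier
      e i j = convolution (coeff f ∘ (i ∷_)) (coeff g ∘ (j ∷_)) α
      term≈0ˡ : ∀ i j → d < i → x ^ i * x ^ j * e i j ≈ 0#
      term≈0ˡ i j d<i = zeroed (x ^ i * x ^ j) (convolution-0ˡ (coeff g ∘ (j ∷_)) (λ β → bounded f (i ∷ β) (ℕ.<-≤-trans d<i (ℕ.m≤m+n i _))) α)
      term≈0ʳ : ∀ i j → d′ < j → x ^ i * x ^ j * e i j ≈ 0#
      term≈0ʳ i j d<j = zeroed (x ^ i * x ^ j) (trans (convolution-comm (coeff f ∘ (i ∷_)) (coeff g ∘ (j ∷_)) α)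
        (convolution-0ˡ (coeff f ∘ (i ∷_)) (λ β → bounded g (j ∷ β) (ℕ.<-≤-trans d<j (ℕ.m≤m+n j _))) α))
      large : ∀ {i} → i < suc d → suc d′ ≤ n ∸ i
      large {i} i≤d = ℕ.≤-trans (ℕ.≤-reflexive (≡.sym (ℕ.m+n∸m≡n d (suc d′))))
        (ℕ.≤-trans (ℕ.∸-monoʳ-≤ (d ℕ.+ suc d′) (s≤s⁻¹ i≤d)) (ℕ.≤-reflexive (≡.cong (_∸ i) (ℕ.+-suc d d′))))

  A-split : ∀ x f → A x f ≈Λ f +Λ A⁺ x f
  A-split x f α = +-congʳ (trans (*-identityˡ _) (padding f α))

  -- A x is unipotent, so it is injective and has an inverse.
  A-kernel : ∀ x f → A x f ≈Λ 0Λ → f ≈Λ 0Λ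
  A-kernel x f Af≈0 α = descend (suc (degree f)) α (ℕ.m≤m+n _ _)
    where
    -- Descending induction on `sum α`: the coefficient of `A⁺ x f` at `α` involves only
    -- coefficients of `f` of larger total degree, and those past `degree f` vanish.
    descend : ∀ n α → suc (degree f) ≤ n ℕ.+ sum α → coeff f α ≈ 0#
    descend zero    α d< = bounded f α d<
    descend (suc n) α d< = begin
      coeff f α                       ≈⟨ solve 2 (λ a b → a := a :+ b :- b) refl _ _ ⟩
      coeff f α + coeff (A⁺ x f) α - coeff (A⁺ x f) α ≈⟨ +-cong (trans (sym (A-split x f α)) (Af≈0 α)) (-‿cong rest≈0) ⟩
      0# - 0#                         ≈⟨ -‿inverseʳ 0# ⟩
      0#                              ∎
      where
      rest≈0 : coeff (A⁺ x f) α ≈ 0#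
      rest≈0 = S-zero (degree f) λ i _ → zeroed (x ^ suc i) (descend n (suc i ∷ α)
        (ℕ.≤-trans d< (ℕ.≤-trans (ℕ.≤-reflexive (≡.sym (ℕ.+-suc n (sum α)))) (ℕ.+-monoʳ-≤ n (s≤s (ℕ.m≤n+m (sum α) i))))))

  infixl 6 _-Λ_

  _-Λ_ : Λ → Λ → Λ
  f -Λ g = f +Λ (- 1#) • g

  -Λ-cancel : ∀ f g → f -Λ g ≈Λ 0Λ → f ≈Λ g
  -Λ-cancel f g eq α = begin
    coeff f α                                   ≈⟨ solve 2 (λ f g → f := (f :+ (:- :1) :* g) :+ g) refl (coeff f α) (coeff g α) ⟩
    coeff f α + - 1# * coeff g α + coeff g α    ≈⟨ +-congʳ (eq α) ⟩
    0# + coeff g α                              ≈⟨ +-identityˡ _ ⟩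
    coeff g α                                   ∎

  A-injective : ∀ x f g → A x f ≈Λ A x g → f ≈Λ g
  A-injective x f g eq = -Λ-cancel f g (A-kernel x (f -Λ g) λ α → begin
    coeff (A x (f -Λ g)) α                      ≈⟨ E.+-homo f ((- 1#) • g) α ⟩
    coeff (A x f) α + coeff (A x ((- 1#) • g)) α ≈⟨ +-cong (eq α) (E.•-homo (- 1#) g α) ⟩
    coeff (A x g) α + - 1# * coeff (A x g) α    ≈⟨ solve 1 (λ g → g :+ (:- :1) :* g := :0) refl _ ⟩
    0#                                          ∎)
    where module E = IsEndomorphism (A-isEndomorphism x)

  private
    -- Since A f = f + A⁺ f, subtracting from `f` a preimage of `A⁺ x f` gives a preimage of `f`. As
    -- `A⁺` lowers the degree, `n` steps suffice when `n` bounds the degree.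
    inverse : ℕ → Carrier → Λ → Λ
    inverse zero    x f = f
    inverse (suc n) x f = f -Λ inverse n x (A⁺ x f)

    A-inverse′ : ∀ n x f → degree f ≤ n → A x (inverse n x f) ≈Λ f
    A-inverse′ zero x f d≤0 α = trans (A-coeff x f (s≤s d≤0) α)
      (trans (+-identityʳ _) (trans (*-identityˡ _) (padding f α)))
    A-inverse′ (suc n) x f d≤n α = begin
      coeff (A x (f -Λ g)) α
        ≈⟨ trans (E.+-homo f ((- 1#) • g) α) (+-congˡ (E.•-homo (- 1#) g α)) ⟩
      coeff (A x f) α + - 1# * coeff (A x g) α
        ≈⟨ +-cong (A-split x f α) (*-congˡ (A-inverse′ n x (A⁺ x f) (ℕ.∸-monoˡ-≤ 1 d≤n) α)) ⟩
      coeff f α + coeff (A⁺ x f) α + - 1# * coeff (A⁺ x f) α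
        ≈⟨ solve 2 (λ f g → f :+ g :+ (:- :1) :* g := f) refl _ _ ⟩
      coeff f α ∎
      where
      g = inverse n x (A⁺ x f)
      module E = IsEndomorphism (A-isEndomorphism x)

  A⁻¹ : Carrier → Λ → Λ
  A⁻¹ x f = inverse (degree f) x f

  A⁻¹-degree : ∀ x f → degree (A⁻¹ x f) ≤ degree f
  A⁻¹-degree x f = go (degree f) f
    where
    go : ∀ n f → degree (inverse n x f) ≤ degree f
    go zero    f = ℕ.≤-refl
    go (suc n) f = ℕ.⊔-lub ℕ.≤-refl (ℕ.≤-trans (go n (A⁺ x f)) (ℕ.m∸n≤m (degree f) 1))

  A-A⁻¹ : ∀ x f → A x (A⁻¹ x f) ≈Λ f
  A-A⁻¹ x f = A-inverse′ (degree f) x f ℕ.≤-refl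

  -- An identity for `A⁻¹ x` may thus be checked after applying `A x`, which is how it inherits the
  -- properties of an endomorphism.
  A⁻¹-unique : ∀ x {f g} → A x g ≈Λ f → A⁻¹ x f ≈Λ g
  A⁻¹-unique x {f} {g} eq = A-injective x (A⁻¹ x f) g (≈Λ-trans {A x (A⁻¹ x f)} {f} {A x g} (A-A⁻¹ x f) (≈Λ-sym {A x g} {f} eq))

  A⁻¹-isEndomorphism : ∀ x → IsEndomorphism (A⁻¹ x)
  A⁻¹-isEndomorphism x = record
    { cong   = λ {f} {g} f≈g → A⁻¹-unique x {f} {A⁻¹ x g} (λ α → trans (A-A⁻¹ x g α) (sym (f≈g α)))
    ; +-homo = λ f g → A⁻¹-unique x {f +Λ g} {A⁻¹ x f +Λ A⁻¹ x g} λ α →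
        trans (E.+-homo (A⁻¹ x f) (A⁻¹ x g) α) (+-cong (A-A⁻¹ x f α) (A-A⁻¹ x g α))
    ; *-homo = λ f g → A⁻¹-unique x {f *Λ g} {A⁻¹ x f *Λ A⁻¹ x g} λ α →
        trans (E.*-homo (A⁻¹ x f) (A⁻¹ x g) α) (convolution-cong (A-A⁻¹ x f) (A-A⁻¹ x g) α)
    ; •-homo = λ y f → A⁻¹-unique x {y • f} {y • A⁻¹ x f} λ α → trans (E.•-homo y (A⁻¹ x f) α) (*-congˡ (A-A⁻¹ x f α))
    ; 1-homo = A⁻¹-unique x {1Λ} {1Λ} E.1-homo
    }
    where module E = IsEndomorphism (A-isEndomorphism x)

-- Values at complete functions and power sums; Newton's identities.

count≥ : ℕ → List ℕ → ℕ
count≥ k []      = 0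
count≥ k (a ∷ α) = (if does (k ℕ.≤? a) then 1 else 0) ℕ.+ count≥ k α

private
  total-+ : ∀ n (f g : ℕ → ℕ) → total n (λ i → f i ℕ.+ g i) ≡ total n f ℕ.+ total n g
  total-+ zero    f g = ≡.refl
  total-+ (suc n) f g = ≡.trans (≡.cong (f 0 ℕ.+ g 0 ℕ.+_) (total-+ n (f ∘ suc) (g ∘ suc)))
    (interchange (f 0) (g 0) _ _)
    where
    open import Algebra.Properties.CommutativeSemigroup ℕ.+-commutativeSemigroup using (interchange)

  total-initial : ∀ {n a} → a ≤ n → total n (λ i → if does (suc i ℕ.≤? a) then 1 else 0) ≡ a
  total-initial {n} z≤n     = total-zero n
  total-initial (s≤s a≤n)   = ≡.cong suc (total-initial a≤n)

-- The boxes of `α` counted by columns instead of rows: `count≥ (suc i) α` is the length of column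
-- `i`, and the columns from `n` on are empty.
total-count≥ : ∀ n α → sum α ≤ n → total n (λ i → count≥ (suc i) α) ≡ sum α
total-count≥ n []      _   = total-zero n
total-count≥ n (a ∷ α) α≤n = ≡.trans (total-+ n (λ i → if does (suc i ℕ.≤? a) then 1 else 0) (λ i → count≥ (suc i) α))
  (≡.cong₂ ℕ._+_ (total-initial (ℕ.≤-trans (ℕ.m≤m+n a _) α≤n)) (total-count≥ n α (ℕ.≤-trans (ℕ.m≤n+m _ a) α≤n)))

module Values {c ℓ₁ ℓ₂} (K : HeytingField c ℓ₁ ℓ₂) (char0 : CharacteristicZero K) where
  open Evaluation K char0 public
  open CommutativeRing R hiding (zero)
  open RingProperties ring using (-0#≈0#; -1*x≈-x)
  open IntegerCoefficients R
  open Determinants R using (∑-cong; homo-∑)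
  open RangeSums R
  open PowerSeries R hiding (T)
  open DimensionFormula R using (fromℕ-total)
  open SetoidReasoning setoid
  open RawSemiringDefinitions (RawRing.rawSemiring rawRing) using (_^_) renaming (sum to ∑)
  open RawSemiringDefinitions (RawRing.rawSemiring Λ-rawRing) using () renaming (sum to ∑Λ)
  private
    module · = SemiringMultiples semiring

  fromℕ-cancel : ∀ n .{{_ : NonZero n}} {x y} → fromℕ n * x ≈ fromℕ n * y → x ≈ y
  fromℕ-cancel n {x} {y} eq = begin
    x                     ≈⟨ expand x ⟩
    n⁻¹ * (fromℕ n * x)   ≈⟨ *-congˡ eq ⟩
    n⁻¹ * (fromℕ n * y)   ≈⟨ expand y ⟨
    y                     ∎
    where
    inverse = HeytingField.#⇒invertible K (char0 n)
    n⁻¹ = proj₁ inverse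
    expand : ∀ x → x ≈ n⁻¹ * (fromℕ n * x)
    expand x = begin
      x                              ≈⟨ *-identityˡ x ⟨
      1# * x                         ≈⟨ *-congʳ (proj₁ (proj₂ inverse)) ⟨
      n⁻¹ * (fromℕ n - 0#) * x       ≈⟨ solve 3 (λ i n x → i :* (n :- :0) :* x := i :* (n :* x)) refl n⁻¹ (fromℕ n) x ⟩
      n⁻¹ * (fromℕ n * x)            ∎

  module Hom {φ : Λ → Carrier} (φ-hom : IsAlgebraHomomorphism φ) where
    open IsAlgebraHomomorphism φ-hom public
    open RingMorphisms.IsRingHomomorphism isRingHomomorphism public
      using (+-homo; *-homo; 1#-homo) renaming (⟦⟧-cong to cong)

  hom : ∀ {φ : Λ → Carrier} → (∀ {f g} → f ≈Λ g → φ f ≈ φ g) → (∀ f g → φ (f +Λ g) ≈ φ f + φ g) →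
    (∀ f g → φ (f *Λ g) ≈ φ f * φ g) → (∀ x f → φ (x • f) ≈ x * φ f) → φ 1Λ ≈ 1# → IsAlgebraHomomorphism φ
  hom {φ} φ-cong φ-+ φ-* φ-• φ-1 = record
    { isRingHomomorphism = record
      { isSemiringHomomorphism = record
        { isNearSemiringHomomorphism = record
          { +-isMonoidHomomorphism = record
            { isMagmaHomomorphism = record
              { isRelHomomorphism = record { cong = φ-cong }
              ; homo = φ-+
              }
            ; ε-homo = trans (φ-cong {0Λ} {0# • 0Λ} (λ _ → sym (zeroˡ 0#))) (trans (φ-• 0# 0Λ) (zeroˡ _))
            }
          ; *-homo = φ-*
          }
        ; 1#-homo = φ-1
        }
      ; -‿homo = λ f → trans (φ-cong { -Λ f} {(- 1#) • f} (λ α → sym (-1*x≈-x _))) (trans (φ-• (- 1#) f) (-1*x≈-x _))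
      }
    ; •-homo = φ-•
    }

  hom-∘ : ∀ {φ Φ} → IsAlgebraHomomorphism φ → IsEndomorphism Φ → IsAlgebraHomomorphism (φ ∘ Φ)
  hom-∘ {φ} {Φ} φ-hom Φ-endo = hom (φ.cong ∘ Φ.cong)
    (λ f g → trans (φ.cong (Φ.+-homo f g)) (φ.+-homo (Φ f) (Φ g)))
    (λ f g → trans (φ.cong (Φ.*-homo f g)) (φ.*-homo (Φ f) (Φ g)))
    (λ x f → trans (φ.cong (Φ.•-homo x f)) (φ.•-homo x (Φ f)))
    (trans (φ.cong Φ.1-homo) φ.1#-homo)
    where
    module φ = Hom φ-hom
    module Φ = IsEndomorphism Φ-endo

  constant : Λ → Carrier
  constant f = coeff f []

  constant-hom : IsAlgebraHomomorphism constant
  constant-hom = hom (λ eq → eq []) (λ _ _ → refl) (λ _ _ → refl) (λ _ _ → refl) refl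

  -- A monomial of hₖ₊₁ either avoids `x` or is `x` times a monomial of hₖ in all variables, `x`
  -- included.
  A-h : ∀ x k → A x (h (suc k)) ≈Λ h (suc k) +Λ x • A x (h k)
  A-h x k α = +-cong (*-identityˡ _) (trans
    (S-cong (suc k) λ i _ → *-assoc x (x ^ i) (coeff (h k) (i ∷ α)))
    (S-*ˡ (suc k) x (λ i → x ^ i * coeff (h k) (i ∷ α))))

  private
    sum≡0⇒support≡[] : ∀ α → sum α ≡ 0 → support α ≡ []
    sum≡0⇒support≡[] []         _  = ≡.refl
    sum≡0⇒support≡[] (zero ∷ α) eq = sum≡0⇒support≡[] α eq

    support≡[]⇒sum≡0 : ∀ α → support α ≡ [] → sum α ≡ 0
    support≡[]⇒sum≡0 α eq = ≡.trans (≡.sym (sum-support α)) (≡.cong sum eq)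

    p-∷-≡ : ∀ k α → coeff (p (suc k)) (suc k ∷ α) ≈ coeff 1Λ α
    p-∷-≡ k α = indicator-cong (support (suc k ∷ α) ≟ᴸ (suc k ∷ [])) (sum α ℕ.≟ 0)
      (support≡[]⇒sum≡0 α ∘ List.∷-injectiveʳ) (≡.cong (suc k ∷_) ∘ sum≡0⇒support≡[] α)

    p-∷-≢ : ∀ {i k} α → i ≢ k → coeff (p (suc k)) (suc i ∷ α) ≈ 0#
    p-∷-≢ {i} {k} α i≢k = indicator-no (support (suc i ∷ α) ≟ᴸ (suc k ∷ [])) (i≢k ∘ ℕ.suc-injective ∘ List.∷-injectiveˡ)

  A-p : ∀ x k → A x (p (suc k)) ≈Λ p (suc k) +Λ (x ^ suc k) • 1Λ
  A-p x k α = +-cong (*-identityˡ _) (trans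
    (S-single {suc k} k (λ i → x ^ suc i * coeff (p (suc k)) (suc i ∷ α)) ℕ.≤-refl
      λ i i≢k → trans (*-congˡ (p-∷-≢ α i≢k)) (zeroʳ (x ^ suc i)))
    (*-congˡ (p-∷-≡ k α)))

  A⁻¹-h : ∀ z k → A⁻¹ z (h (suc k)) ≈Λ h (suc k) +Λ (- z) • h k
  A⁻¹-h z k = A⁻¹-unique z {h (suc k)} {h (suc k) +Λ (- z) • h k} λ α → begin
    coeff (A z (h (suc k) +Λ (- z) • h k)) α
      ≈⟨ trans (E.+-homo (h (suc k)) ((- z) • h k) α) (+-cong (A-h z k α) (E.•-homo (- z) (h k) α)) ⟩
    coeff (h (suc k)) α + z * coeff (A z (h k)) α + - z * coeff (A z (h k)) α
      ≈⟨ solve 3 (λ h z a → h :+ z :* a :+ (:- z) :* a := h) refl _ z _ ⟩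
    coeff (h (suc k)) α ∎
    where module E = IsEndomorphism (A-isEndomorphism z)

  A⁻¹-p : ∀ z k → A⁻¹ z (p (suc k)) ≈Λ p (suc k) +Λ (- (z ^ suc k)) • 1Λ
  A⁻¹-p z k = A⁻¹-unique z {p (suc k)} {p (suc k) +Λ (- (z ^ suc k)) • 1Λ} λ α → begin
    coeff (A z (p (suc k) +Λ (- (z ^ suc k)) • 1Λ)) α
      ≈⟨ trans (E.+-homo (p (suc k)) ((- (z ^ suc k)) • 1Λ) α) (+-cong (A-p z k α)
           (trans (E.•-homo (- (z ^ suc k)) 1Λ α) (*-congˡ (E.1-homo α)))) ⟩
    coeff (p (suc k)) α + z ^ suc k * coeff 1Λ α + - (z ^ suc k) * coeff 1Λ α
      ≈⟨ solve 3 (λ h z a → h :+ z :* a :+ (:- z) :* a := h) refl _ _ _ ⟩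
    coeff (p (suc k)) α ∎
    where module E = IsEndomorphism (A-isEndomorphism z)

  completes : (Λ → Carrier) → Seq
  completes φ k = φ (h k)

  module _ {φ : Λ → Carrier} (φ-hom : IsAlgebraHomomorphism φ) where
    private
      module φ = Hom φ-hom

    completes-A : ∀ x → completes (φ ∘ A x) ≋ G x (completes φ)
    completes-A x zero    = φ.cong (IsEndomorphism.1-homo (A-isEndomorphism x))
    completes-A x (suc k) = trans (φ.cong (A-h x k)) (trans (φ.+-homo (h (suc k)) (x • A x (h k)))
      (+-congˡ (trans (φ.•-homo x (A x (h k))) (*-congˡ (completes-A x k)))))

    completes-A⁻¹ : ∀ z → completes (φ ∘ A⁻¹ z) ≋ M z (completes φ)
    completes-A⁻¹ z zero    = φ.cong (IsEndomorphism.1-homo (A⁻¹-isEndomorphism z))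
    completes-A⁻¹ z (suc k) = trans (φ.cong (A⁻¹-h z k)) (trans (φ.+-homo (h (suc k)) ((- z) • h k))
      (+-congˡ (trans (φ.•-homo (- z) (h k)) (solve 2 (λ z h → (:- z) :* h := :- (z :* h)) refl z _))))

    private
      p-value : ∀ k y Φ → Φ ≈Λ p (suc k) +Λ y • 1Λ → φ Φ ≈ φ (p (suc k)) + y
      p-value k y Φ eq = trans (φ.cong eq) (trans (φ.+-homo (p (suc k)) (y • 1Λ))
        (+-congˡ (trans (φ.•-homo y 1Λ) (trans (*-congˡ φ.1#-homo) (*-identityʳ y)))))

    power-A : ∀ x k → φ (A x (p (suc k))) ≈ φ (p (suc k)) + x ^ suc k
    power-A x k = p-value k (x ^ suc k) (A x (p (suc k))) (A-p x k)

    power-A⁻¹ : ∀ z k → φ (A⁻¹ z (p (suc k))) ≈ φ (p (suc k)) - z ^ suc k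
    power-A⁻¹ z k = p-value k (- (z ^ suc k)) (A⁻¹ z (p (suc k))) (A⁻¹-p z k)

  -- The value of `f` in n variables: after `x 0, …, x (n − 1)` have been adjoined, the constant
  -- term sets the original variables to zero.
  evaluate : ℕ → (ℕ → Carrier) → Λ → Carrier
  evaluate zero    x f = constant f
  evaluate (suc n) x f = evaluate n (x ∘ suc) (A (x 0) f)

  -- Cancels the variables z, z + 1, ..., z + n - 1: the power sums lose theirs, and the generating
  -- function of the hₖ is multiplied by the factors 1 - (z + i) t.
  remove : Carrier → ℕ → Λ → Λ
  remove z zero    f = f
  remove z (suc n) f = remove (z + 1#) n (A⁻¹ z f)

  evaluate-hom : ∀ n x → IsAlgebraHomomorphism (evaluate n x)
  evaluate-hom zero    x = constant-hom
  evaluate-hom (suc n) x = hom-∘ (evaluate-hom n (x ∘ suc)) (A-isEndomorphism (x 0))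

  remove-hom : ∀ {φ} → IsAlgebraHomomorphism φ → ∀ n z → IsAlgebraHomomorphism (φ ∘ remove z n)
  remove-hom φ-hom zero    z = φ-hom
  remove-hom φ-hom (suc n) z = hom-∘ (remove-hom φ-hom n (z + 1#)) (A⁻¹-isEndomorphism z)

  completes-evaluate : ∀ n x → completes (evaluate n x) ≋ Gⁿ n x δ
  completes-evaluate zero    x zero    = refl
  completes-evaluate zero    x (suc k) = refl
  completes-evaluate (suc n) x = ≋-trans (completes-A (evaluate-hom n (x ∘ suc)) (x 0))
    (G-cong refl (completes-evaluate n (x ∘ suc)))

  completes-remove : ∀ {φ} → IsAlgebraHomomorphism φ → ∀ n z → completes (φ ∘ remove z n) ≋ Q z n (completes φ)
  completes-remove φ-hom zero    z = λ _ → refl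
  completes-remove φ-hom (suc n) z = ≋-trans (completes-A⁻¹ (remove-hom φ-hom n (z + 1#)) z)
    (M-cong refl (completes-remove φ-hom n (z + 1#)))

  power-evaluate : ∀ n x k → evaluate n x (p (suc k)) ≈ S n (λ i → x i ^ suc k)
  power-evaluate zero    x k = refl
  power-evaluate (suc n) x k = trans (power-A (evaluate-hom n (x ∘ suc)) (x 0) k)
    (trans (+-comm _ _) (+-congˡ (power-evaluate n (x ∘ suc) k)))

  ^-cong : ∀ n {x y} → x ≈ y → x ^ n ≈ y ^ n
  ^-cong zero    x≈y = refl
  ^-cong (suc n) x≈y = *-cong x≈y (^-cong n x≈y)

  power-remove : ∀ {φ} → IsAlgebraHomomorphism φ → ∀ n z k →
    φ (remove z n (p (suc k))) ≈ φ (p (suc k)) - S n (λ i → (z + fromℕ i) ^ suc k)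
  power-remove φ-hom zero    z k = sym (trans (+-congˡ -0#≈0#) (+-identityʳ _))
  power-remove {φ} φ-hom (suc n) z k = begin
    φ (remove (z + 1#) n (A⁻¹ z (p (suc k))))
      ≈⟨ power-A⁻¹ (remove-hom φ-hom n (z + 1#)) z k ⟩
    φ (remove (z + 1#) n (p (suc k))) - z ^ suc k
      ≈⟨ +-congʳ (power-remove φ-hom n (z + 1#) k) ⟩
    φ (p (suc k)) - S n (λ i → (z + 1# + fromℕ i) ^ suc k) - z ^ suc k
      ≈⟨ solve 3 (λ p s z → p :- s :- z := p :- (z :+ s)) refl _ _ _ ⟩
    φ (p (suc k)) - (z ^ suc k + S n (λ i → (z + 1# + fromℕ i) ^ suc k))
      ≈⟨ +-congˡ (-‿cong (+-cong (^-cong (suc k) (sym (+-identityʳ z))) (S-cong n λ i _ → ^-cong (suc k) (+-assoc z 1# (fromℕ i))))) ⟩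
    φ (p (suc k)) - S (suc n) (λ i → (z + fromℕ i) ^ suc k) ∎

  A-0 : ∀ x f → f ≈Λ 0Λ → A x f ≈Λ 0Λ
  A-0 x f f≈0 α = S-zero (suc (degree f)) λ i _ → trans (*-congˡ (f≈0 (i ∷ α))) (zeroʳ (x ^ i))

  remove-kernel : ∀ n z f → remove z n f ≈Λ 0Λ → f ≈Λ 0Λ
  remove-kernel zero    z f eq = eq
  remove-kernel (suc n) z f eq α = trans (sym (A-A⁻¹ z f α)) (A-0 z (A⁻¹ z f) (remove-kernel n (z + 1#) (A⁻¹ z f) eq) α)

  convolution-1ˡ : ∀ G α → convolution (coeff 1Λ) G α ≈ G α
  convolution-1ˡ G []      = *-identityˡ _
  convolution-1ˡ G (a ∷ α) = trans (+-cong (convolution-1ˡ (G ∘ (a ∷_)) α)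
    (S-zero a λ b _ → convolution-0ˡ {coeff 1Λ ∘ (suc b ∷_)} (G ∘ (a ∸ suc b ∷_)) (λ _ → refl) α)) (+-identityʳ _)

  -- In a product of pᵢ₊₁ with a complete function, the coefficient at `α` counts the variables with
  -- exponent at least i + 1. The offset `t` stands for the exponents already passed and lets the
  -- induction on `α` go through.
  convolution-p : ∀ i m t α → convolution (coeff (p (suc i))) (λ γ → indicator (t ℕ.+ sum γ ℕ.≟ m)) α ≈
    fromℕ (count≥ (suc i) α) * indicator (t ℕ.+ sum α ℕ.≟ suc i ℕ.+ m)
  convolution-p i m t []      = trans (zeroˡ _) (sym (zeroˡ _))
  convolution-p i m t (a ∷ α) = begin
    convolution (coeff (p (suc i))) (λ γ → indicator (t ℕ.+ (a ℕ.+ sum γ) ℕ.≟ m)) α + S a terms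
      ≈⟨ +-cong first (rest (suc i ℕ.≤? a)) ⟩
    fromℕ (count≥ (suc i) α) * I + fromℕ (if does (suc i ℕ.≤? a) then 1 else 0) * I
      ≈⟨ trans (+-comm _ _) (sym (distribʳ I _ _)) ⟩
    (fromℕ (if does (suc i ℕ.≤? a) then 1 else 0) + fromℕ (count≥ (suc i) α)) * I
      ≈⟨ *-congʳ (·.×-homo-+ 1# (if does (suc i ℕ.≤? a) then 1 else 0) (count≥ (suc i) α)) ⟨
    fromℕ (count≥ (suc i) (a ∷ α)) * I ∎
    where
    I = indicator (t ℕ.+ (a ℕ.+ sum α) ℕ.≟ suc i ℕ.+ m)
    g : ℕ → Function
    g b γ = indicator (t ℕ.+ (a ∸ suc b ℕ.+ sum γ) ℕ.≟ m)
    terms : ℕ → Carrier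
    terms b = convolution (coeff (p (suc i)) ∘ (suc b ∷_)) (g b) α
    assoc≡ : ∀ n → t ℕ.+ (a ℕ.+ n) ≡ t ℕ.+ a ℕ.+ n
    assoc≡ n = ≡.sym (ℕ.+-assoc t a n)
    first : convolution (coeff (p (suc i))) (λ γ → indicator (t ℕ.+ (a ℕ.+ sum γ) ℕ.≟ m)) α ≈ fromℕ (count≥ (suc i) α) * I
    first = trans (convolution-cong {coeff (p (suc i))} (λ _ → refl) (λ γ → reflexive (≡.cong (λ n → indicator (n ℕ.≟ m)) (assoc≡ (sum γ)))) α)
      (trans (convolution-p i m (t ℕ.+ a) α) (*-congˡ (reflexive (≡.cong (λ n → indicator (n ℕ.≟ suc i ℕ.+ m)) (≡.sym (assoc≡ (sum α)))))))
    regroup : ∀ {a} → suc i ≤ a → suc i ℕ.+ (t ℕ.+ (a ∸ suc i ℕ.+ sum α)) ≡ t ℕ.+ (a ℕ.+ sum α)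
    regroup {a} i<a = ≡.trans (x∙yz≈y∙xz (suc i) t _) (≡.cong (t ℕ.+_)
      (≡.trans (≡.sym (ℕ.+-assoc (suc i) (a ∸ suc i) (sum α))) (≡.cong (ℕ._+ sum α) (ℕ.m+[n∸m]≡n i<a))))
      where open import Algebra.Properties.CommutativeSemigroup ℕ.+-commutativeSemigroup using (x∙yz≈y∙xz)
    rest : (i<a? : Dec (suc i ≤ a)) → S a terms ≈ fromℕ (if does i<a? then 1 else 0) * I
    rest (no i≮a) = trans (S-zero a λ b b<a → convolution-0ˡ {coeff (p (suc i)) ∘ (suc b ∷_)} (g b)
      (λ β → p-∷-≢ {b} {i} β λ { ≡.refl → i≮a b<a }) α) (sym (zeroˡ I))
    rest (yes i<a) = begin
      S a terms
        ≈⟨ S-single i terms i<a (λ b b≢i → convolution-0ˡ {coeff (p (suc i)) ∘ (suc b ∷_)} (g b) (λ β → p-∷-≢ {b} {i} β b≢i) α) ⟩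
      terms i
        ≈⟨ convolution-cong {G = g i} (p-∷-≡ i) (λ _ → refl) α ⟩
      convolution (coeff 1Λ) (g i) α
        ≈⟨ convolution-1ˡ (g i) α ⟩
      g i α
        ≈⟨ indicator-cong (t ℕ.+ (a ∸ suc i ℕ.+ sum α) ℕ.≟ m) (t ℕ.+ (a ℕ.+ sum α) ℕ.≟ suc i ℕ.+ m)
             (λ eq → ≡.trans (≡.sym (regroup i<a)) (≡.cong (suc i ℕ.+_) eq))
             (λ eq → ℕ.+-cancelˡ-≡ (suc i) _ _ (≡.trans (regroup i<a) eq)) ⟩
      I
        ≈⟨ solve 1 (λ x → x := (:1 :+ :0) :* x) refl I ⟩
      fromℕ 1 * I ∎

  coeff-∑ : ∀ {n} (F : Fin n → Λ) α → coeff (∑Λ F) α ≈ ∑ (λ i → coeff (F i) α)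
  coeff-∑ {zero}  F α = refl
  coeff-∑ {suc n} F α = +-congˡ (coeff-∑ (F ∘ suc) α)

  -- Both sides live in degree `k`. There the product of pᵢ and hₖ₋ᵢ counts the exponents that are
  -- at least i, and the sum of these counts over i is the total degree.
  newton : ∀ k → fromℕ k • h k ≈Λ ∑Λ {k} (λ i → p (suc (toℕ i)) *Λ h (k ∸ suc (toℕ i)))
  newton k α = begin
    fromℕ k * I
      ≈⟨ degree≡ (sum α ℕ.≟ k) ⟩
    fromℕ (total k (λ i → count≥ (suc i) α)) * I
      ≈⟨ *-congʳ (fromℕ-total k (λ i → count≥ (suc i) α)) ⟩
    S k (λ i → fromℕ (count≥ (suc i) α)) * I
      ≈⟨ S-*ʳ k I (λ i → fromℕ (count≥ (suc i) α)) ⟨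
    S k (λ i → fromℕ (count≥ (suc i) α) * I)
      ≈⟨ S-cong k (λ i i<k → trans (convolution-p i (k ∸ suc i) 0 α)
           (*-congˡ (reflexive (≡.cong (λ n → indicator (sum α ℕ.≟ n)) (ℕ.m+[n∸m]≡n i<k))))) ⟨
    S k (λ i → coeff (p (suc i) *Λ h (k ∸ suc i)) α)
      ≈⟨ coeff-∑ {k} (λ i → p (suc (toℕ i)) *Λ h (k ∸ suc (toℕ i))) α ⟨
    coeff (∑Λ {k} (λ i → p (suc (toℕ i)) *Λ h (k ∸ suc (toℕ i)))) α ∎
    where
    I = coeff (h k) α
    degree≡ : (d : Dec (sum α ≡ k)) → fromℕ k * indicator d ≈ fromℕ (total k (λ i → count≥ (suc i) α)) * indicator d
    degree≡ (no _)       = trans (zeroʳ _) (sym (zeroʳ _))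
    degree≡ (yes ≡.refl) = *-congʳ (reflexive (≡.cong fromℕ (≡.sym (total-count≥ (sum α) α ℕ.≤-refl))))

  module _ {φ ψ : Λ → Carrier} (φ-hom : IsAlgebraHomomorphism φ) (ψ-hom : IsAlgebraHomomorphism ψ)
           (p-agree : ∀ k → φ (p (suc k)) ≈ ψ (p (suc k))) where
    private
      module φ = Hom φ-hom
      module ψ = Hom ψ-hom

      agree : ∀ n k → k < n → φ (h k) ≈ ψ (h k)
      agree (suc n) zero    _         = trans φ.1#-homo (sym ψ.1#-homo)
      agree (suc n) (suc k) (s≤s k<n) = fromℕ-cancel (suc k) (begin
        fromℕ (suc k) * φ (h (suc k))
          ≈⟨ expand φ-hom ⟩
        S (suc k) (λ i → φ (p (suc i)) * φ (h (k ∸ i)))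
          ≈⟨ S-cong (suc k) (λ i _ → *-cong (p-agree i) (agree n (k ∸ i) (ℕ.≤-<-trans (ℕ.m∸n≤m k i) k<n))) ⟩
        S (suc k) (λ i → ψ (p (suc i)) * ψ (h (k ∸ i)))
          ≈⟨ expand ψ-hom ⟨
        fromℕ (suc k) * ψ (h (suc k)) ∎)
        where
        expand : ∀ {χ} → IsAlgebraHomomorphism χ →
          fromℕ (suc k) * χ (h (suc k)) ≈ S (suc k) (λ i → χ (p (suc i)) * χ (h (k ∸ i)))
        expand {χ} χ-hom = begin
          fromℕ (suc k) * χ (h (suc k))     ≈⟨ χ.•-homo (fromℕ (suc k)) (h (suc k)) ⟨
          χ (fromℕ (suc k) • h (suc k))     ≈⟨ χ.cong (newton (suc k)) ⟩
          χ (∑Λ F)                          ≈⟨ homo-∑ Λ-rawRing χ.isRingHomomorphism F ⟩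
          ∑ (χ ∘ F)                         ≈⟨ ∑-cong (χ ∘ F) _ (λ i → χ.*-homo (p (suc (toℕ i))) (h (k ∸ toℕ i))) ⟩
          S (suc k) (λ i → χ (p (suc i)) * χ (h (k ∸ i))) ∎
          where
          module χ = Hom χ-hom
          F : Fin (suc k) → Λ
          F i = p (suc (toℕ i)) *Λ h (suc k ∸ suc (toℕ i))

    -- Newton's identities express a positive multiple of each hₖ by power sums and earlier complete
    -- functions; characteristic zero cancels the multiple. In this way a homomorphism known on
    -- power sums acquires a generating function.
    completes-agree : completes φ ≋ completes ψ
    completes-agree k = agree (suc k) k ℕ.≤-refl

-- The Jacobi-Trudi matrix with half-integer parameters.

⊖-cong : ∀ a b c d → a ℕ.+ d ≡ c ℕ.+ b → a ⊖ b ≡ c ⊖ d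
⊖-cong a b c d eq = ≡.trans (≡.sym (ℤ.+-cancelˡ-⊖ d a b)) (≡.trans
  (≡.cong₂ _⊖_ (≡.trans (ℕ.+-comm d a) (≡.trans eq (ℕ.+-comm c b))) (ℕ.+-comm d b)) (ℤ.+-cancelˡ-⊖ b c d))

degree-⊖ : ∀ a i j → + a ℤ.- + i ℤ.+ + j ≡ (a ℕ.+ j) ⊖ i
degree-⊖ a i j = ≡.trans (≡.cong (ℤ._+ + j) (ℤ.m-n≡m⊖n a i)) (ℤ.distribˡ-⊖-+-pos j a i)

-- The index splits into `β N μ i`, which belongs to the row, minus N - 1 - j, which belongs to the
-- column and becomes a power of t there.
degree-β : ∀ {N i j} (μ : ℕ → ℕ) → i < N → j < N → + μ i ℤ.- + i ℤ.+ + j ≡ β N μ i ⊖ (N ∸ suc j)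
degree-β {N} {i} {j} μ i<N j<N = ≡.trans (degree-⊖ (μ i) i j) (⊖-cong (μ i ℕ.+ j) i (β N μ i) (N ∸ suc j) (begin
  μ i ℕ.+ j ℕ.+ (N ∸ suc j)      ≡⟨ ℕ.+-assoc (μ i) j _ ⟩
  μ i ℕ.+ (j ℕ.+ (N ∸ suc j))    ≡⟨ ≡.cong (μ i ℕ.+_) (ℕ.suc-injective (≡.trans (ℕ.m+[n∸m]≡n j<N) (≡.sym (ℕ.m+[n∸m]≡n i<N)))) ⟩
  μ i ℕ.+ (i ℕ.+ (N ∸ suc i))    ≡⟨ ≡.cong (μ i ℕ.+_) (ℕ.+-comm i _) ⟩
  μ i ℕ.+ ((N ∸ suc i) ℕ.+ i)    ≡⟨ ℕ.+-assoc (μ i) _ i ⟨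
  β N μ i ℕ.+ i                  ∎))
  where open ≡.≡-Reasoning

entry-≥ : ∀ xs {i} → length xs ≤ i → entry xs i ≡ 0
entry-≥ []       _         = ≡.refl
entry-≥ (x ∷ xs) (s≤s ℓ≤i) = entry-≥ xs ℓ≤i

module JacobiTrudi {c ℓ₁ ℓ₂} (K : HeytingField c ℓ₁ ℓ₂) (char0 : CharacteristicZero K) where
  open Values K char0 public
  open CommutativeRing R hiding (zero)
  open IntegerCoefficients R
  open Determinants R using (∑-cong; homo-∑; homo-det; det-cong; det-last-row; detℕ)
  open RangeSums R
  open PowerSeries R hiding (T)
  open DimensionFormula R using (fallingMatrix)
  open SetoidReasoning setoid
  open RawSemiringDefinitions (RawRing.rawSemiring rawRing) using (_^_) renaming (sum to ∑)
  open RawSemiringDefinitions (RawRing.rawSemiring Λ-rawRing) using () renaming (sum to ∑Λ)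
  open Determinant rawRing using (det)

  ½+½≈1 : ½ + ½ ≈ 1#
  ½+½≈1 = begin
    1# * 2⁻¹ + 1# * 2⁻¹   ≈⟨ solve 1 (λ i → :1 :* i :+ :1 :* i := (:1 :+ (:1 :+ :0) :- :0) :* i) refl 2⁻¹ ⟩
    (fromℕ 2 - 0#) * 2⁻¹  ≈⟨ proj₂ (proj₂ inverse) ⟩
    1#                    ∎
    where
    inverse = HeytingField.#⇒invertible K (char0 2)
    2⁻¹ = proj₁ inverse

  fromℤ-⊖ : ∀ m n → fromℤ (m ⊖ n) ≈ fromℕ m - fromℕ n
  fromℤ-⊖ m       zero    = solve 1 (λ m → m := m :- :0) refl (fromℕ m)
  fromℤ-⊖ zero    (suc n) = sym (+-identityˡ _)
  fromℤ-⊖ (suc m) (suc n) = begin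
    fromℤ (suc m ⊖ suc n)           ≈⟨ reflexive (≡.cong fromℤ (ℤ.[1+m]⊖[1+n]≡m⊖n m n)) ⟩
    fromℤ (m ⊖ n)                   ≈⟨ fromℤ-⊖ m n ⟩
    fromℕ m - fromℕ n               ≈⟨ solve 2 (λ m n → m :- n := (:1 :+ m) :- (:1 :+ n)) refl _ _ ⟩
    fromℕ (suc m) - fromℕ (suc n)   ∎

  halfIntegers-shift : ∀ j t → shift (ℤ.- (+ j)) halfIntegers (+ suc t) ≈ ½ - fromℕ j + fromℕ t
  halfIntegers-shift j t = begin
    fromℤ (+ suc t ℤ.- + j) - ½
      ≈⟨ +-congʳ (trans (reflexive (≡.cong fromℤ (ℤ.m-n≡m⊖n (suc t) j))) (fromℤ-⊖ (suc t) j)) ⟩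
    1# + fromℕ t - fromℕ j - ½
      ≈⟨ +-congʳ (+-congʳ (+-congʳ ½+½≈1)) ⟨
    ½ + ½ + fromℕ t - fromℕ j - ½
      ≈⟨ solve 3 (λ h t j → h :+ h :+ t :- j :- h := h :- j :+ t) refl ½ (fromℕ t) (fromℕ j) ⟩
    ½ - fromℕ j + fromℕ t ∎

  signed : ∀ {n} → ℕ → Vector Carrier n → Carrier
  signed k x = (- 1#) ^ k * elementary k x

  Mᵛ : ∀ n → Vector Carrier n → Seq → Seq
  Mᵛ zero    x s = s
  Mᵛ (suc n) x s = M (x zero) (Mᵛ n (tail x) s)

  -- The expansion of ∏ (1 - xⱼ t); the recursion that defines `elementary` is multiplication by one
  -- more factor.
  Mᵛ-elementary : ∀ n (x : Vector Carrier n) s k → Mᵛ n x s k ≈ S (suc k) (λ i → signed (k ∸ i) x * s i)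
  Mᵛ-elementary zero x s k = sym (begin
    S (suc k) (λ i → signed (k ∸ i) x * s i)
      ≈⟨ S-snoc k (λ i → signed (k ∸ i) x * s i) ⟩
    S k (λ i → signed (k ∸ i) x * s i) + signed (k ∸ k) x * s k
      ≈⟨ trans (+-congʳ (S-zero k vanish)) (+-identityˡ _) ⟩
    signed (k ∸ k) x * s k
      ≈⟨ *-congʳ (reflexive (≡.cong (λ n → signed n x) (ℕ.n∸n≡0 k))) ⟩
    1# * 1# * s k
      ≈⟨ solve 1 (λ s → :1 :* :1 :* s := s) refl (s k) ⟩
    s k ∎)
    where
    vanish : ∀ i → i < k → signed (k ∸ i) x * s i ≈ 0#
    vanish i i<k rewrite ∸-step i<k = trans (*-congʳ (zeroʳ _)) (zeroˡ _)
  Mᵛ-elementary (suc n) x s zero    = Mᵛ-elementary n (tail x) s zero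
  Mᵛ-elementary (suc n) x s (suc k) = begin
    t (suc k) - x zero * t k
      ≈⟨ +-cong (trans (Mᵛ-elementary n (tail x) s (suc k)) (S-snoc (suc k) (λ i → signed (suc k ∸ i) (tail x) * s i)))
           (-‿cong (*-congˡ (Mᵛ-elementary n (tail x) s k))) ⟩
    S (suc k) u + last (tail x) - x zero * S (suc k) w
      ≈⟨ solve 4 (λ a l c b → a :+ l :- c :* b := a :+ (:- c) :* b :+ l) refl _ _ (x zero) _ ⟩
    S (suc k) u + - x zero * S (suc k) w + last (tail x)
      ≈⟨ +-cong (trans (+-congˡ (sym (S-*ˡ (suc k) (- x zero) w))) (sym (S-+ (suc k) u (λ i → - x zero * w i))))
           (*-congʳ (reflexive (≡.cong (λ m → (- 1#) ^ m * elementary m (tail x)) (ℕ.n∸n≡0 k)))) ⟩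
    S (suc k) (λ i → u i + - x zero * w i) + 1# * 1# * s (suc k)
      ≈⟨ +-cong (S-cong (suc k) term≈) (*-congʳ (reflexive (≡.cong (λ m → (- 1#) ^ m * elementary m x) (≡.sym (ℕ.n∸n≡0 k))))) ⟩
    S (suc k) (λ i → signed (suc k ∸ i) x * s i) + last x
      ≈⟨ S-snoc (suc k) (λ i → signed (suc k ∸ i) x * s i) ⟨
    S (suc (suc k)) (λ i → signed (suc k ∸ i) x * s i) ∎
    where
    t = Mᵛ n (tail x) s
    u w : ℕ → Carrier
    u i = signed (suc k ∸ i) (tail x) * s i
    w i = signed (k ∸ i) (tail x) * s i
    last : ∀ {n} → Vector Carrier n → Carrier
    last y = signed (suc k ∸ suc k) y * s (suc k)
    term≈ : ∀ i → i < suc k → u i + - x zero * w i ≈ signed (suc k ∸ i) x * s i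
    term≈ i (s≤s i≤k) rewrite ℕ.+-∸-assoc 1 i≤k =
      solve 5 (λ p e e′ c s → :- :1 :* p :* e :* s :+ (:- c) :* (p :* e′ :* s) := :- :1 :* p :* (e :+ c :* e′) :* s) refl
        ((- 1#) ^ (k ∸ i)) (elementary (suc (k ∸ i)) (tail x)) (elementary (k ∸ i) (tail x)) (x zero) (s i)

  elementary-zero : ∀ {n k} (x : Vector Carrier n) → n < k → elementary k x ≈ 0#
  elementary-zero {zero}  {suc k} x _         = refl
  elementary-zero {suc n} {suc k} x (s≤s n<k) = trans (+-cong (elementary-zero (tail x) (ℕ.m<n⇒m<1+n n<k))
    (trans (*-congˡ (elementary-zero (tail x) n<k)) (zeroʳ _))) (+-identityˡ _)

  Mᵛ-Q : ∀ n (x : Vector Carrier n) c s → (∀ j → x j ≈ c + fromℕ (toℕ j)) → Mᵛ n x s ≋ Q c n s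
  Mᵛ-Q zero    x c s x≈ = λ _ → refl
  Mᵛ-Q (suc n) x c s x≈ = M-cong (trans (x≈ zero) (+-identityʳ c))
    (Mᵛ-Q n (tail x) (c + 1#) s λ j → trans (x≈ (suc j)) (sym (+-assoc c 1# _)))

  -- `Mⁿ` goes through the points -½, -3/2, ... downwards, whereas `Q` starts at the least of them,
  -- ½ - j.
  Mⁿ-Q : ∀ j s → Mⁿ j (λ t → ½ - fromℕ (suc t)) s ≋ Q (½ - fromℕ j) j s
  Mⁿ-Q zero    s = λ _ → refl
  Mⁿ-Q (suc j) s = M-cong refl (≋-trans (Mⁿ-Q j s)
    (Q-cong j (solve 2 (λ h j → h :- j := h :- (:1 :+ j) :+ :1) refl ½ (fromℕ j)) (λ _ → refl)))

  -- The least of the half-integers ½ - N, ..., -½. Measured from it, the coordinates of ν are the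
  -- natural numbers `β N (row ν) j`.
  base : ℕ → Carrier
  base N = ½ - fromℕ N

  module _ {φ : Λ → Carrier} (φ-hom : IsAlgebraHomomorphism φ) where
    private
      module φ = Hom φ-hom

    -- The function is the coefficient of t^(k+1) in (1 - a₁ t) ⋯ (1 - aₖ t) ∑ hᵢ tⁱ: the term with
    -- h₀, absent from its definition, carries eₖ₊₁ of only k variables.
    φ-hₐ : ∀ a k → φ (hₐ a (+ suc k)) ≈ Mᵛ k (λ j → a (+ suc (toℕ j))) (completes φ) (suc k)
    φ-hₐ a k = begin
      φ (∑Λ {suc k} F)
        ≈⟨ homo-∑ Λ-rawRing φ.isRingHomomorphism F ⟩
      ∑ {suc k} (φ ∘ F)
        ≈⟨ ∑-cong (φ ∘ F) (λ i → signed (k ∸ toℕ i) x * φ (h (suc (toℕ i)))) (λ i → φ.•-homo _ (h (suc (toℕ i)))) ⟩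
      S (suc k) (λ i → signed (k ∸ i) x * φ (h (suc i)))
        ≈⟨ trans (+-congʳ (trans (*-congʳ (trans (*-congˡ (elementary-zero x ℕ.≤-refl)) (zeroʳ _))) (zeroˡ _))) (+-identityˡ _) ⟨
      S (suc (suc k)) (λ i → signed (suc k ∸ i) x * φ (h i))
        ≈⟨ Mᵛ-elementary k x (completes φ) (suc k) ⟨
      Mᵛ k x (completes φ) (suc k) ∎
      where
      x : Vector Carrier k
      x j = a (+ suc (toℕ j))
      F : Fin (suc k) → Λ
      F i = signed (k ∸ toℕ i) x • h (suc (toℕ i))

    entryValue : (ℕ → ℕ) → ℕ → ℕ → Carrier
    entryValue μ i j = φ (hₐ (shift (ℤ.- (+ j)) halfIntegers) (+ μ i ℤ.- + i ℤ.+ + j))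

    φ-multiSchur : ∀ N μ → φ (multiSchur N μ halfIntegers) ≈ det {N} (λ i j → entryValue (row μ) (toℕ i) (toℕ j))
    φ-multiSchur N μ = homo-det Λ-rawRing φ.isRingHomomorphism {N} λ i j →
      hₐ (shift (ℤ.- (+ toℕ j)) halfIntegers) (+ row μ (toℕ i) ℤ.- + toℕ i ℤ.+ + toℕ j)

    private
      negative : ∀ a z k → z ≡ -[1+ k ] → φ (hₐ a z) ≈ 0#
      negative a _ k ≡.refl = RingHom.0#-homo
        where module RingHom = RingMorphisms.IsRingHomomorphism φ.isRingHomomorphism

    -- Row `N` of `μ` is empty, so the last row of the larger matrix has the indices j - N: it is
    -- zero before the diagonal and one on it.
    stable : ∀ N μ → ℓ μ ≤ N → φ (multiSchur (suc N) μ halfIntegers) ≈ φ (multiSchur N μ halfIntegers)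
    stable N μ ℓ≤N = begin
      φ (multiSchur (suc N) μ halfIntegers)
        ≈⟨ φ-multiSchur (suc N) μ ⟩
      det {suc N} (λ i j → e (toℕ i) (toℕ j))
        ≈⟨ det-last-row (λ i j → e (toℕ i) (toℕ j)) below corner ⟩
      det {N} (λ i j → e (toℕ (inject₁ i)) (toℕ (inject₁ j)))
        ≈⟨ det-cong {N} (λ i j → reflexive (≡.cong₂ e (Fin.toℕ-inject₁ i) (Fin.toℕ-inject₁ j))) ⟩
      det {N} (λ i j → e (toℕ i) (toℕ j))
        ≈⟨ φ-multiSchur N μ ⟨
      φ (multiSchur N μ halfIntegers) ∎
      where
      e = entryValue (row μ)
      last-degree : ∀ j → + row μ N ℤ.- + N ℤ.+ + j ≡ j ⊖ N
      last-degree j = ≡.trans (degree-⊖ (row μ N) N j) (≡.cong (λ r → (r ℕ.+ j) ⊖ N) (entry-≥ (parts μ) ℓ≤N))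
      below : ∀ j → e (toℕ (Fin.fromℕ N)) (toℕ (inject₁ j)) ≈ 0#
      below j rewrite Fin.toℕ-fromℕ N | Fin.toℕ-inject₁ j =
        negative _ _ (N ∸ suc (toℕ j)) (≡.trans (last-degree (toℕ j)) (⊖-cong (toℕ j) N 0 (suc (N ∸ suc (toℕ j)))
          (≡.trans (ℕ.+-suc (toℕ j) _) (ℕ.m+[n∸m]≡n (Fin.toℕ<n j)))))
      corner : e (toℕ (Fin.fromℕ N)) (toℕ (Fin.fromℕ N)) ≈ 1#
      corner rewrite Fin.toℕ-fromℕ N = trans (reflexive (≡.cong (φ ∘ hₐ (shift (ℤ.- (+ N)) halfIntegers))
        (≡.trans (last-degree N) (ℤ.n⊖n≡0 N)))) φ.1#-homo

    stable-+ : ∀ e N μ → ℓ μ ≤ N → φ (multiSchur (e ℕ.+ N) μ halfIntegers) ≈ φ (multiSchur N μ halfIntegers)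
    stable-+ zero    N μ ℓ≤N = refl
    stable-+ (suc e) N μ ℓ≤N = trans (stable (e ℕ.+ N) μ (ℕ.≤-trans ℓ≤N (ℕ.m≤n+m N e))) (stable-+ e N μ ℓ≤N)

    φ-multiSchur-∅ : ∀ N → φ (multiSchur N ∅ halfIntegers) ≈ 1#
    φ-multiSchur-∅ zero    = φ.1#-homo
    φ-multiSchur-∅ (suc N) = trans (stable N ∅ z≤n) (φ-multiSchur-∅ N)

    module _ {N : ℕ} {x : ℕ → Carrier} (φ-completes : completes φ ≋ Q (base N) N (Gⁿ N x δ)) where
      private
        H = Gⁿ N x δ
        d : ℕ → Carrier
        d t = ½ - fromℕ (suc t)

        -- The coefficient of t^mᵢ after multiplication by mᵢ consecutive factors from `base N` on:
        -- a linear functional that depends on the row only. These factors are the series `c` of the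
        -- overview.
        L : (ℕ → ℕ) → Fin N → Seq → Carrier
        L μ i s = Q (base N) (β N μ (toℕ i)) s (β N μ (toℕ i))

        H-zero : ∀ n y → Gⁿ n y δ 0 ≡ 1#
        H-zero zero    y = ≡.refl
        H-zero (suc n) y = H-zero n (y ∘ suc)

        Mⁿ-zero : ∀ n y s → Mⁿ n y s 0 ≡ s 0
        Mⁿ-zero zero    y s = ≡.refl
        Mⁿ-zero (suc n) y s = Mⁿ-zero n y s

        L-T : ∀ m r s k → m ≡ r ℕ.+ k → Q (base N) m (Tⁿ r s) m ≈ Q (base N) m s k
        L-T m r s k ≡.refl = trans (Tⁿ-commutes r (Q (base N) m) (Q-T m (base N)) s m) (reflexive (Tⁿ-+ r (Q (base N) m s) k))

        -- For k = m - r ≥ 1, the parameters of the entry are the k - 1 numbers from ½ - j =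
        -- `base N` + (r + 1) on, and the cancelled points are the N numbers from `base N` on.
        -- `Q-exchange` turns them into m numbers from `base N` on, which depend on the row, and j
        -- numbers from ½ - j on, which depend on the column. For m < r both sides vanish.
        value : ∀ j r m z → r ≡ N ∸ suc j → j < N → z ≡ m ⊖ r →
          φ (hₐ (shift (ℤ.- (+ j)) halfIntegers) z) ≈ Q (base N) m (Tⁿ r (Mⁿ j d H)) m
        value j r m z r≡ j<N z≡ with ℕ.≤-<-connex r m
        ... | inj₂ m<r = trans (negative _ z (r ∸ suc m) (≡.trans z≡ (⊖-cong m r 0 (suc (r ∸ suc m))
                 (≡.trans (ℕ.+-suc m _) (ℕ.m+[n∸m]≡n m<r)))))
               (sym (trans (Tⁿ-commutes r (Q (base N) m) (Q-T m (base N)) (Mⁿ j d H) m) (reflexive (Tⁿ-< r _ m<r))))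
        ... | inj₁ r≤m = go (m ∸ r) (≡.sym (ℕ.m+[n∸m]≡n r≤m))
          where
          a = shift (ℤ.- (+ j)) halfIntegers
          N≡ : N ≡ suc r ℕ.+ j
          N≡ = ≡.trans (≡.sym (ℕ.m+[n∸m]≡n j<N)) (≡.trans (≡.cong (suc j ℕ.+_) (≡.sym r≡)) (≡.cong suc (ℕ.+-comm j r)))
          origin : ½ - fromℕ j ≈ base N + fromℕ (suc r)
          origin = begin
            ½ - fromℕ j
              ≈⟨ solve 3 (λ h j r → h :- j := h :- (r :+ j) :+ r) refl ½ (fromℕ j) (fromℕ (suc r)) ⟩
            ½ - (fromℕ (suc r) + fromℕ j) + fromℕ (suc r)
              ≈⟨ +-congʳ (+-congˡ (-‿cong (trans (reflexive (≡.cong fromℕ N≡)) (·.×-homo-+ 1# (suc r) j)))) ⟨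
            base N + fromℕ (suc r) ∎
            where module · = SemiringMultiples semiring
          go : ∀ k → m ≡ r ℕ.+ k → φ (hₐ a z) ≈ Q (base N) m (Tⁿ r (Mⁿ j d H)) m
          go k m≡ = trans (reflexive (≡.cong (φ ∘ hₐ a) (≡.trans z≡ (⊖-cong m r k 0 (≡.trans (ℕ.+-identityʳ m) (≡.trans m≡ (ℕ.+-comm r k)))))))
            (trans (at k m≡) (sym (L-T m r (Mⁿ j d H) k m≡)))
            where
            at : ∀ k → m ≡ r ℕ.+ k → φ (hₐ a (+ k)) ≈ Q (base N) m (Mⁿ j d H) k
            at zero    m≡ = trans φ.1#-homo (reflexive (≡.sym (≡.trans (Q-zero m (base N) (Mⁿ j d H)) (≡.trans (Mⁿ-zero j d H) (H-zero N x)))))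
            at (suc k) m≡ = begin
              φ (hₐ a (+ suc k))
                ≈⟨ φ-hₐ a k ⟩
              Mᵛ k (λ t → a (+ suc (toℕ t))) (completes φ) (suc k)
                ≈⟨ Mᵛ-Q k _ (½ - fromℕ j) (completes φ) (λ t → halfIntegers-shift j (toℕ t)) (suc k) ⟩
              Q (½ - fromℕ j) k (completes φ) (suc k)
                ≈⟨ Q-cong k origin φ-completes (suc k) ⟩
              Q (base N + fromℕ (suc r)) k (Q (base N) N H) (suc k)
                ≈⟨ reflexive (≡.cong (λ n → Q (base N + fromℕ (suc r)) k (Q (base N) n H) (suc k)) N≡) ⟩
              Q (base N + fromℕ (suc r)) k (Q (base N) (suc r ℕ.+ j) H) (suc k)
                ≈⟨ Q-exchange (suc r) k j (base N) H (suc k) ⟩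
              Q (base N) (suc r ℕ.+ k) (Q (base N + fromℕ (suc r)) j H) (suc k)
                ≈⟨ Q-cong (suc r ℕ.+ k) refl (≋-sym (≋-trans (Mⁿ-Q j H) (Q-cong j origin (λ _ → refl)))) (suc k) ⟩
              Q (base N) (suc r ℕ.+ k) (Mⁿ j d H) (suc k)
                ≈⟨ reflexive (≡.cong (λ n → Q (base N) n (Mⁿ j d H) (suc k)) (≡.sym (≡.trans m≡ (ℕ.+-suc r k)))) ⟩
              Q (base N) m (Mⁿ j d H) (suc k) ∎

      -- `Q-geometric` without excess degree evaluates the functional of row `i` at 1 / (1 - xⱼ t)
      -- to a falling factorial; `det-geometric` then leads to the entries found in `value`.
      jacobi-trudi : ∀ μ {ρ} → (∀ j → j < N → x j - base N ≈ fromℕ (β N ρ j)) →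
        det (fallingMatrix N (row μ) ρ) ≈ vandermonde N x * φ (multiSchur N μ halfIntegers)
      jacobi-trudi μ {ρ} x≈ = begin
        det (fallingMatrix N (row μ) ρ)
          ≈⟨ det-cong {N} (λ i j → falling-geometric (β N (row μ) (toℕ i)) (toℕ j) (Fin.toℕ<n j)) ⟨
        detℕ N (λ i j → L (row μ) i (G (x j) δ))
          ≈⟨ det-geometric (L (row μ)) (λ i → Q-isLinear (β N (row μ) (toℕ i)) (base N) (β N (row μ) (toℕ i))) x d ⟩
        vandermonde N x * detℕ N (λ i j → L (row μ) i (Tⁿ (N ∸ suc j) (Mⁿ j d H)))
          ≈⟨ *-congˡ (trans (φ-multiSchur N μ) (det-cong {N} λ i j →
               value (toℕ j) (N ∸ suc (toℕ j)) (β N (row μ) (toℕ i)) _ ≡.refl (Fin.toℕ<n j) (degree-β (row μ) (Fin.toℕ<n i) (Fin.toℕ<n j)))) ⟨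
        vandermonde N x * φ (multiSchur N μ halfIntegers) ∎
        where
        falling-geometric : ∀ m j → j < N → Q (base N) m (G (x j) δ) m ≈ falling (fromℕ (β N ρ j)) m
        falling-geometric m j j<N = begin
          Q (base N) m (G (x j) δ) m             ≈⟨ reflexive (≡.cong (Q (base N) m (G (x j) δ)) (≡.sym (ℕ.+-identityʳ m))) ⟩
          Q (base N) m (G (x j) δ) (m ℕ.+ 0)     ≈⟨ Q-geometric m (base N) (x j) 0 ⟩
          falling (x j - base N) m * 1#          ≈⟨ *-identityʳ _ ⟩
          falling (x j - base N) m               ≈⟨ falling-cong m (x≈ j j<N) ⟩
          falling (fromℕ (β N ρ j)) m            ∎

-- Frobenius coordinates: content sums along rows and along hooks.

colLength : ℕ → (ℕ → ℕ) → ℕ → ℕ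
colLength n ν j = total n (λ i → if does (j ℕ.<? ν i) then 1 else 0)

colLength-entry : ∀ {N} xs j → length xs ≤ N → colLength N (entry xs) j ≡ length (filter (j ℕ.<?_) xs)
colLength-entry {N} [] j _ = total-zero N
colLength-entry {suc N} (x ∷ xs) j (s≤s ℓ≤N) with j ℕ.<? x
... | yes j<x rewrite dec-true (j ℕ.<? x) j<x   = ≡.cong suc (colLength-entry xs j ℓ≤N)
... | no  j≮x rewrite dec-false (j ℕ.<? x) j≮x = colLength-entry xs j ℓ≤N

entry-antitone : ∀ {xs} → Linked _≥_ xs → Antitone (entry xs)
entry-antitone Linked.[] _ = z≤n
entry-antitone {x ∷ []} Linked.[-] {zero}  {zero}  _ = ℕ.≤-refl
entry-antitone {x ∷ []} Linked.[-] {zero}  {suc j} _ = z≤n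
entry-antitone {x ∷ []} Linked.[-] {suc i} {suc j} _ = z≤n
entry-antitone (x≥y Linked.∷ ys) {zero}  {zero}  _         = ℕ.≤-refl
entry-antitone (x≥y Linked.∷ ys) {zero}  {suc j} _         = ℕ.≤-trans (entry-antitone ys {0} {j} z≤n) x≥y
entry-antitone (x≥y Linked.∷ ys) {suc i} {suc j} (s≤s i≤j) = entry-antitone ys i≤j

row-antitone : ∀ ν → Antitone (row ν)
row-antitone ν = entry-antitone (decreasing ν)

module _ {P : ℕ → Set} (P? : ∀ i → Dec (P i)) where

  private
    filter-initial : ∀ n (g : ℕ → ℕ) → (∀ {i} → P (g (suc i)) → P (g i)) →
      let d = length (filter P? (applyUpTo g n)) in
      (∀ i → i < d → P (g i)) × (∀ i → d ≤ i → i < n → ¬ P (g i))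
    filter-initial zero    g closed = (λ _ ()) , (λ _ _ ())
    filter-initial (suc n) g closed with P? (g 0) | filter-initial n (g ∘ suc) closed
    ... | yes p₀ | inside , outside =
        (λ { zero _ → p₀ ; (suc i) (s≤s i<d) → inside i i<d })
      , (λ { (suc i) (s≤s d≤i) (s≤s i<n) → outside i d≤i i<n })
    ... | no ¬p₀ | inside , _ = (λ i i<d → contradiction (inside i i<d) (none (suc i))) , (λ i _ _ → none i)
      where
      none : ∀ i → ¬ P (g i)
      none zero    = ¬p₀
      none (suc i) = none i ∘ closed

  -- A predicate closed downwards selects an initial segment, so the length of the filtered list is
  -- its threshold. This gives `diagonal ν` its meaning.
  filter-upTo : ∀ n → (∀ {i} → P (suc i) → P i) →
    let d = length (filter P? (upTo n)) in (∀ i → i < d → P i) × (∀ i → d ≤ i → i < n → ¬ P i)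
  filter-upTo n closed = filter-initial n id closed

private
  diagonal-closed : ∀ ν {i} → suc i < row ν (suc i) → i < row ν i
  diagonal-closed ν {i} i<ν = ℕ.<-≤-trans (ℕ.<-trans (ℕ.n<1+n i) i<ν) (row-antitone ν (ℕ.n≤1+n i))

diagonal-inside : ∀ ν i → i < diagonal ν → i < row ν i
diagonal-inside ν = proj₁ (filter-upTo (λ i → i ℕ.<? row ν i) (ℓ ν) (diagonal-closed ν))

diagonal-outside : ∀ ν i → diagonal ν ≤ i → row ν i ≤ i
diagonal-outside ν i d≤i with i ℕ.<? ℓ ν
... | yes i<ℓ = ℕ.≮⇒≥ (proj₂ (filter-upTo (λ i → i ℕ.<? row ν i) (ℓ ν) (diagonal-closed ν)) i d≤i i<ℓ)
... | no  i≮ℓ = ℕ.≤-trans (ℕ.≤-reflexive (entry-≥ (parts ν) (ℕ.≮⇒≥ i≮ℓ))) z≤n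

-- The content sum of F over the boxes of ν, taken once along rows and
-- once along hooks; removing the first hook leaves the diagram with
-- rows ν (i + 1) − 1.
module Hooks {c ℓ} (R : CommutativeRing c ℓ) where
  open CommutativeRing R hiding (zero)
  open IntegerCoefficients R
  open RangeSums R
  open DimensionFormula R using (fromℕ; fromℕ-pred)
  open SetoidReasoning setoid

  module ContentSum (half : Carrier) (half+half≈1 : half + half ≈ 1#)
                    (F : Carrier → Carrier) (F-cong : ∀ {x y} → x ≈ y → F x ≈ F y) where
    -- The telescoped sum of F(c + ½) - F(c - ½) over the contents c of the boxes of row `i`.
    rowTerm : (ℕ → ℕ) → ℕ → Carrier
    rowTerm ν i = F (fromℕ (ν i) - fromℕ i - half) - F (- half - fromℕ i)

    private
      F-zero : ∀ {x y} → x ≈ y → F x - F y ≈ 0#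
      F-zero x≈y = trans (+-congʳ (F-cong x≈y)) (-‿inverseʳ _)

      rowTerm-zero : ∀ ν i → ν i ≡ 0 → rowTerm ν i ≈ 0#
      rowTerm-zero ν i ν≡0 = F-zero (trans (+-congʳ (+-congʳ (reflexive (≡.cong fromℕ ν≡0))))
        (solve 2 (λ i h → :0 :- i :- h := :- h :- i) refl (fromℕ i) half))

      -- The nonempty rows of an antitone `κ` form an initial segment, whose length is that of the
      -- first column.
      telescope : ∀ n κ → Antitone κ → (g : ℕ → Carrier) →
        S n (λ i → if does (0 ℕ.<? κ i) then g i - g (suc i) else 0#) ≈ g 0 - g (colLength n κ 0)
      telescope zero    κ κ-anti g = sym (-‿inverseʳ _)
      telescope (suc n) κ κ-anti g with 0 ℕ.<? κ 0
      ... | yes 0<κ rewrite dec-true (0 ℕ.<? κ 0) 0<κ = trans (+-congˡ (telescope n (κ ∘ suc) (κ-anti ∘ s≤s) (g ∘ suc)))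
        (solve 3 (λ a b c → a :- b :+ (b :- c) := a :- c) refl _ _ _)
      ... | no 0≮κ = begin
        S (suc n) (λ i → if does (0 ℕ.<? κ i) then g i - g (suc i) else 0#)
          ≈⟨ S-zero (suc n) (λ i _ → reflexive (≡.cong (λ b → if b then g i - g (suc i) else 0#) (dec-false (0 ℕ.<? κ i) (empty i)))) ⟩
        0#
          ≈⟨ -‿inverseʳ (g 0) ⟨
        g 0 - g 0
          ≈⟨ +-congˡ (-‿cong (reflexive (≡.cong g (≡.sym (columns≡0 (suc n) κ empty))))) ⟩
        g 0 - g (colLength (suc n) κ 0) ∎
        where
        empty : ∀ i → ¬ (0 < κ i)
        empty i 0<κ = 0≮κ (ℕ.<-≤-trans 0<κ (κ-anti z≤n))
        columns≡0 : ∀ n κ → (∀ i → ¬ (0 < κ i)) → colLength n κ 0 ≡ 0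
        columns≡0 zero    κ _     = ≡.refl
        columns≡0 (suc n) κ empty rewrite dec-false (0 ℕ.<? κ 0) (empty 0) = columns≡0 n (κ ∘ suc) (empty ∘ suc)

    -- The same content sum along the hook of the diagonal box `i`, whose contents run without gaps
    -- from minus the second to the first of its Frobenius coordinates.
    hookTerm : ℕ → (ℕ → ℕ) → ℕ → Carrier
    hookTerm N ν i = F (fromℕ (ν i ∸ suc i) + half) - F (- (fromℕ (colLength N ν i ∸ suc i) + half))

    rows≈hooks : ∀ d N {ν} → Antitone ν → ν N ≡ 0 → (∀ i → i < d → i < ν i) → (∀ i → d ≤ i → ν i ≤ i) →
      S N (rowTerm ν) ≈ S d (hookTerm N ν)
    rows≈hooks zero N {ν} ν-anti ν≡0 inside outside = S-zero N λ i _ →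
      rowTerm-zero ν i (ℕ.n≤0⇒n≡0 (ℕ.≤-trans (ν-anti z≤n) (outside 0 z≤n)))
    rows≈hooks (suc d) zero ν-anti ν≡0 inside outside = contradiction (inside 0 (s≤s z≤n)) (ℕ.<⇒≱ (s≤s (ℕ.≤-reflexive ν≡0)))
    rows≈hooks (suc d) (suc N) {ν} ν-anti ν≡0 inside outside = begin
      rowTerm ν 0 + S N (rowTerm ν ∘ suc)
        ≈⟨ +-congˡ (trans (S-cong N λ i _ → split i) (S-+ N (rowTerm ν⁻) t)) ⟩
      rowTerm ν 0 + (S N (rowTerm ν⁻) + S N t)
        ≈⟨ +-congˡ (+-cong (rows≈hooks d N {ν⁻} (λ i≤j → ℕ.∸-monoˡ-≤ 1 (ν-anti (s≤s i≤j))) (≡.cong (_∸ 1) ν≡0)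
             (λ i i<d → ℕ.<⇒≤pred (inside (suc i) (s≤s i<d))) (λ i d≤i → ℕ.∸-monoˡ-≤ 1 (outside (suc i) (s≤s d≤i))))
             (telescope N (ν ∘ suc) (ν-anti ∘ s≤s) g)) ⟩
      (a - g 0) + (S d (hookTerm N ν⁻) + (g 0 - g L))
        ≈⟨ solve 4 (λ a g s l → (a :- g) :+ (s :+ (g :- l)) := (a :- l) :+ s) refl a (g 0) _ (g L) ⟩
      (a - g L) + S d (hookTerm N ν⁻)
        ≈⟨ +-cong first (S-cong d rest) ⟩
      hookTerm (suc N) ν 0 + S d (hookTerm (suc N) ν ∘ suc) ∎
      where
      ν⁻ : ℕ → ℕ
      ν⁻ i = ν (suc i) ∸ 1
      g : ℕ → Carrier
      g i = F (- half - fromℕ i)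
      a = F (fromℕ (ν 0) - fromℕ 0 - half)
      L = colLength N (ν ∘ suc) 0
      t : ℕ → Carrier
      t i = if does (0 ℕ.<? ν (suc i)) then g i - g (suc i) else 0#

      -- The first box of row `suc i` has content -(i + 1) and contributes `g i - g (suc i)`; the
      -- other boxes of that row have the contents of row `i` of `ν⁻`.
      split : ∀ i → rowTerm ν (suc i) ≈ rowTerm ν⁻ i + t i
      split i with 0 ℕ.<? ν (suc i)
      ... | yes 0<ν rewrite dec-true (0 ℕ.<? ν (suc i)) 0<ν = begin
        F (fromℕ (ν (suc i)) - fromℕ (suc i) - half) - g (suc i)
          ≈⟨ +-congʳ (F-cong (trans (solve 3 (λ n i h → n :- (:1 :+ i) :- h := n :- :1 :- i :- h) refl (fromℕ (ν (suc i))) (fromℕ i) half)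
               (+-congʳ (+-congʳ (sym (fromℕ-pred 0<ν)))))) ⟩
        F (fromℕ (ν⁻ i) - fromℕ i - half) - g (suc i)
          ≈⟨ solve 3 (λ x y z → x :- z := x :- y :+ (y :- z)) refl _ (g i) _ ⟩
        rowTerm ν⁻ i + (g i - g (suc i)) ∎
      ... | no 0≮ν rewrite dec-false (0 ℕ.<? ν (suc i)) 0≮ν = trans (rowTerm-zero ν (suc i) ν≡)
          (sym (trans (+-congʳ (rowTerm-zero ν⁻ i (≡.cong (_∸ 1) ν≡))) (+-identityˡ _)))
        where
        ν≡ : ν (suc i) ≡ 0
        ν≡ = ℕ.n≤0⇒n≡0 (ℕ.≮⇒≥ 0≮ν)

      first : a - g L ≈ hookTerm (suc N) ν 0
      first rewrite dec-true (0 ℕ.<? ν 0) (inside 0 (s≤s z≤n)) = +-cong (F-cong (begin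
          fromℕ (ν 0) - 0# - half             ≈⟨ solve 2 (λ n h → n :- :0 :- h := n :- (h :+ h) :+ h) refl (fromℕ (ν 0)) half ⟩
          fromℕ (ν 0) - (half + half) + half  ≈⟨ +-congʳ (+-congˡ (-‿cong half+half≈1)) ⟩
          fromℕ (ν 0) - 1# + half             ≈⟨ +-congʳ (fromℕ-pred (inside 0 (s≤s z≤n))) ⟨
          fromℕ (ν 0 ∸ 1) + half              ∎))
        (-‿cong (F-cong (solve 2 (λ h l → :- h :- l := :- (l :+ h)) refl half (fromℕ L))))

      rest : ∀ i → i < d → hookTerm N ν⁻ i ≈ hookTerm (suc N) ν (suc i)
      rest i i<d = +-cong (F-cong (+-congʳ (reflexive (≡.cong fromℕ (ℕ.∸-+-assoc (ν (suc i)) 1 (suc i))))))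
        (-‿cong (F-cong (-‿cong (+-congʳ (reflexive (≡.cong fromℕ columns≡))))))
        where
        column-shift : ∀ n κ → colLength n (λ i → κ i ∸ 1) i ≡ colLength n κ (suc i)
        column-shift zero    κ = ≡.refl
        column-shift (suc n) κ = ≡.cong₂ ℕ._+_ (head≡ (κ 0)) (column-shift n (κ ∘ suc))
          where
          head≡ : ∀ k → (if does (i ℕ.<? k ∸ 1) then 1 else 0) ≡ (if does (suc i ℕ.<? k) then 1 else 0)
          head≡ zero    = ≡.refl
          head≡ (suc k) = ≡.refl
        columns≡ : colLength N ν⁻ i ∸ suc i ≡ colLength (suc N) ν (suc i) ∸ suc (suc i)
        columns≡ rewrite dec-true (suc i ℕ.<? ν 0) (ℕ.<-≤-trans (inside (suc i) (s≤s i<d)) (ν-anti z≤n)) =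
          ≡.cong (_∸ suc i) (column-shift N (ν ∘ suc))

module FrobeniusCoordinates {c ℓ₁ ℓ₂} (K : HeytingField c ℓ₁ ℓ₂) (char0 : CharacteristicZero K) where
  open JacobiTrudi K char0 public
  open CommutativeRing R hiding (zero)
  open IntegerCoefficients R
  open RangeSums R
  open SetoidReasoning setoid
  open RawSemiringDefinitions (RawRing.rawSemiring rawRing) using (_^_) renaming (sum to ∑)

  private
    neg-^ : ∀ n y → (- y) ^ n ≈ (- 1#) ^ n * y ^ n
    neg-^ zero    y = sym (*-identityˡ 1#)
    neg-^ (suc n) y = trans (*-congˡ (neg-^ n y))
      (solve 3 (λ y s p → :- y :* (s :* p) := :- :1 :* s :* (y :* p)) refl y _ _)

    S-base : ∀ n (F : Carrier → Carrier) → (∀ {x y} → x ≈ y → F x ≈ F y) →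
      S n (λ i → F (base n + fromℕ i)) ≈ S n (λ i → F (- ½ - fromℕ i))
    S-base zero    F F-cong = refl
    S-base (suc n) F F-cong = begin
      F (base (suc n) + 0#) + S n (λ i → F (base (suc n) + fromℕ (suc i)))
        ≈⟨ +-cong (F-cong first) (S-cong n λ i _ → F-cong
             (solve 3 (λ h n i → h :- (:1 :+ n) :+ (:1 :+ i) := h :- n :+ i) refl ½ (fromℕ n) (fromℕ i))) ⟩
      F (- ½ - fromℕ n) + S n (λ i → F (base n + fromℕ i))
        ≈⟨ trans (+-comm _ _) (+-congʳ (S-base n F F-cong)) ⟩
      S n (λ i → F (- ½ - fromℕ i)) + F (- ½ - fromℕ n)
        ≈⟨ S-snoc n (λ i → F (- ½ - fromℕ i)) ⟨
      S (suc n) (λ i → F (- ½ - fromℕ i)) ∎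
      where
      first : base (suc n) + 0# ≈ - ½ - fromℕ n
      first = begin
        ½ - (1# + fromℕ n) + 0#         ≈⟨ +-congʳ (+-congˡ (-‿cong (+-congʳ (sym ½+½≈1)))) ⟩
        ½ - (½ + ½ + fromℕ n) + 0#      ≈⟨ solve 2 (λ h n → h :- (h :+ h :+ n) :+ :0 := :- h :- n) refl ½ (fromℕ n) ⟩
        - ½ - fromℕ n                   ∎

  coordinate : Diagram → ℕ → Carrier
  coordinate ν i = fromℕ (row ν i) - fromℕ i - ½

  -- A concrete homomorphism with the required power sums. An empty row `i` has the coordinate -½ -
  -- i, one of the cancelled points, so any N ≥ ℓ ν serves.
  valueAt : Diagram → ℕ → Λ → Carrier
  valueAt ν N = evaluate N (coordinate ν) ∘ remove (base N) N

  valueAt-hom : ∀ ν N → IsAlgebraHomomorphism (valueAt ν N)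
  valueAt-hom ν N = remove-hom (evaluate-hom N (coordinate ν)) N (base N)

  IsFrobeniusValue : Diagram → (Λ → Carrier) → Set _
  IsFrobeniusValue ν = IsValueAt {diagonal ν} {diagonal ν} (λ i → fromℕ (frobeniusP ν i) + ½) (λ i → fromℕ (frobeniusQ ν i) + ½)

  -- Power sums of the coordinates minus those of the cancelled points are the row terms for F(y) =
  -- y^k. Regrouped along hooks, -F(-y) yields the sign (-1)^(k-1).
  valueAt-frobenius : ∀ ν N → ℓ ν ≤ N → IsFrobeniusValue ν (valueAt ν N)
  valueAt-frobenius ν N ℓ≤N = record
    { isAlgebraHomomorphism = valueAt-hom ν N
    ; power-sum             = λ { zero {{()}} ; (suc k) → power k }
    }
    where
    power : ∀ k → valueAt ν N (p (suc k)) ≈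
      ∑ {diagonal ν} (λ i → (fromℕ (frobeniusP ν i) + ½) ^ suc k) + (- 1#) ^ k * ∑ {diagonal ν} (λ i → (fromℕ (frobeniusQ ν i) + ½) ^ suc k)
    power k = begin
      valueAt ν N (p (suc k))
        ≈⟨ power-remove (evaluate-hom N (coordinate ν)) N (base N) k ⟩
      evaluate N (coordinate ν) (p (suc k)) - S N (λ i → F (base N + fromℕ i))
        ≈⟨ +-cong (power-evaluate N (coordinate ν) k) (-‿cong (S-base N F F-cong)) ⟩
      S N (F ∘ coordinate ν) - S N (λ i → F (- ½ - fromℕ i))
        ≈⟨ S-minus N (F ∘ coordinate ν) (λ i → F (- ½ - fromℕ i)) ⟨
      S N (rowTerm (row ν))
        ≈⟨ rows≈hooks d N (row-antitone ν) (entry-≥ (parts ν) ℓ≤N) (diagonal-inside ν) (diagonal-outside ν) ⟩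
      S d (hookTerm N (row ν))
        ≈⟨ S-cong d (λ i _ → +-congˡ {F (fromℕ (row ν i ∸ suc i) + ½)} (trans (-‿cong (neg-^ (suc k) _)) (trans
             (solve 2 (λ s y → :- (:- :1 :* s :* y) := s :* y) refl ((- 1#) ^ k) _)
             (*-congˡ (F-cong (+-congʳ (reflexive (≡.cong (λ c → fromℕ (c ∸ suc i)) (colLength-entry (parts ν) i ℓ≤N))))))))) ⟩
      S d (λ i → F (fromℕ (row ν i ∸ suc i) + ½) + (- 1#) ^ k * F (fromℕ (col ν i ∸ suc i) + ½))
        ≈⟨ trans (S-+ d (λ i → F (fromℕ (row ν i ∸ suc i) + ½)) (λ i → (- 1#) ^ k * F (fromℕ (col ν i ∸ suc i) + ½)))
             (+-congˡ (S-*ˡ d ((- 1#) ^ k) (λ i → F (fromℕ (col ν i ∸ suc i) + ½)))) ⟩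
      S d (λ i → F (fromℕ (row ν i ∸ suc i) + ½)) + (- 1#) ^ k * S d (λ i → F (fromℕ (col ν i ∸ suc i) + ½)) ∎
      where
      d = diagonal ν
      F : Carrier → Carrier
      F y = y ^ suc k
      F-cong : ∀ {x y} → x ≈ y → F x ≈ F y
      F-cong = ^-cong (suc k)
      open Hooks.ContentSum R ½ ½+½≈1 F F-cong
      S-minus : ∀ n f g → S n (λ i → f i - g i) ≈ S n f - S n g
      S-minus n f g = trans (S-cong n λ i _ → solve 2 (λ a b → a :- b := a :+ (:- :1) :* b) refl (f i) (g i))
        (trans (S-+ n f (λ i → - 1# * g i)) (trans (+-congˡ (S-*ˡ n (- 1#) g))
          (solve 2 (λ a b → a :+ (:- :1) :* b := a :- b) refl _ _)))

-- Uniqueness: a symmetric function is determined by its values at large diagrams.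

private
  -- Stopping at the first zero loses nothing for an antitone sequence, so `entry` recovers `ν`.
  rows : ℕ → (ℕ → ℕ) → List ℕ
  rows zero    ν = []
  rows (suc n) ν with ν 0
  ... | zero  = []
  ... | suc k = suc k ∷ rows n (ν ∘ suc)

  rows-length : ∀ n ν → length (rows n ν) ≤ n
  rows-length zero    ν = z≤n
  rows-length (suc n) ν with ν 0
  ... | zero  = z≤n
  ... | suc k = s≤s (rows-length n (ν ∘ suc))

  rows-positive : ∀ n ν → All (0 <_) (rows n ν)
  rows-positive zero    ν = All.[]
  rows-positive (suc n) ν with ν 0
  ... | zero  = All.[]
  ... | suc k = s≤s z≤n All.∷ rows-positive n (ν ∘ suc)

  rows-decreasing : ∀ n ν → Antitone ν → Linked _≥_ (rows n ν)
  rows-decreasing zero    ν ν-anti = Linked.[]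
  rows-decreasing (suc n) ν ν-anti with ν 0 in ν₀
  ... | zero  = Linked.[]
  ... | suc k = extend n (ν ∘ suc) (rows-decreasing n (ν ∘ suc) (ν-anti ∘ s≤s))
      (≡.subst (ν 1 ≤_) ν₀ (ν-anti z≤n))
    where
    extend : ∀ n κ → Linked _≥_ (rows n κ) → κ 0 ≤ suc k → Linked _≥_ (suc k ∷ rows n κ)
    extend zero    κ _ _ = Linked.[-]
    extend (suc n) κ lnk κ≤ with κ 0
    ... | zero  = Linked.[-]
    ... | suc m = κ≤ Linked.∷ lnk

  rows-entry : ∀ n ν → Antitone ν → ν n ≡ 0 → ∀ i → entry (rows n ν) i ≡ ν i
  rows-entry zero    ν ν-anti ν≡0 i = ≡.sym (ℕ.n≤0⇒n≡0 (ℕ.≤-trans (ν-anti z≤n) (ℕ.≤-reflexive ν≡0)))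
  rows-entry (suc n) ν ν-anti ν≡0 i with ν 0 in ν₀
  rows-entry (suc n) ν ν-anti ν≡0 i       | zero  = ≡.sym (ℕ.n≤0⇒n≡0 (ℕ.≤-trans (ν-anti z≤n) (ℕ.≤-reflexive ν₀)))
  rows-entry (suc n) ν ν-anti ν≡0 zero    | suc k = ≡.sym ν₀
  rows-entry (suc n) ν ν-anti ν≡0 (suc i) | suc k = rows-entry n (ν ∘ suc) (ν-anti ∘ s≤s) ν≡0 i

  entry≤sum : ∀ xs → entry xs 0 ≤ sum xs
  entry≤sum []       = z≤n
  entry≤sum (x ∷ xs) = ℕ.m≤m+n x _

module Uniqueness {c ℓ₁ ℓ₂} (K : HeytingField c ℓ₁ ℓ₂) (char0 : CharacteristicZero K) where
  open FrobeniusCoordinates K char0 public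
  open CommutativeRing R hiding (zero)
  open IntegerCoefficients R
  open Determinants R using (∑-cong; homo-∑)
  open RangeSums R
  open SetoidReasoning setoid
  open RawSemiringDefinitions (RawRing.rawSemiring rawRing) using (_^_) renaming (sum to ∑)
  open RawSemiringDefinitions (RawRing.rawSemiring Λ-rawRing) using () renaming (sum to ∑Λ)
  private
    module · = SemiringMultiples semiring

  polynomial : ℕ → (ℕ → Carrier) → Carrier → Carrier
  polynomial zero    a x = 0#
  polynomial (suc n) a x = a 0 + x * polynomial n (a ∘ suc) x

  polynomial-S : ∀ n a x → S n (λ k → x ^ k * a k) ≈ polynomial n a x
  polynomial-S zero    a x = refl
  polynomial-S (suc n) a x = +-cong (*-identityˡ _) (trans
    (S-cong n λ k _ → *-assoc x (x ^ k) (a (suc k)))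
    (trans (S-*ˡ n x (λ k → x ^ k * a (suc k))) (*-congˡ (polynomial-S n (a ∘ suc) x))))

  private
    quotient : Carrier → ℕ → (ℕ → Carrier) → ℕ → Carrier
    quotient r zero    a k       = 0#
    quotient r (suc n) a zero    = polynomial (suc n) (a ∘ suc) r
    quotient r (suc n) a (suc k) = quotient r n (a ∘ suc) k

    division : ∀ r n a x → polynomial (suc n) a x ≈ polynomial (suc n) a r + (x - r) * polynomial n (quotient r n a) x
    division r zero    a x = solve 3 (λ a x r → a :+ x :* :0 := a :+ r :* :0 :+ (x :- r) :* :0) refl (a 0) x r
    division r (suc n) a x = begin
      a 0 + x * polynomial (suc n) (a ∘ suc) x
        ≈⟨ +-congˡ (*-congˡ (division r n (a ∘ suc) x)) ⟩
      a 0 + x * (P + (x - r) * q)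
        ≈⟨ solve 5 (λ a x p r q → a :+ x :* (p :+ (x :- r) :* q) := a :+ r :* p :+ (x :- r) :* (p :+ x :* q)) refl (a 0) x P r q ⟩
      a 0 + r * P + (x - r) * (P + x * q) ∎
      where
      P = polynomial (suc n) (a ∘ suc) r
      q = polynomial n (quotient r n (a ∘ suc)) x

    -- The coefficients of the quotient are the Horner tails at `r`; each `a k` is one tail minus
    -- `r` times the next, the value at `r` being the first.
    back-substitution : ∀ r n a → polynomial (suc n) a r ≈ 0# → (∀ k → k < n → quotient r n a k ≈ 0#) →
      ∀ k → k < suc n → a k ≈ 0#
    back-substitution r n       a P≈0 q≈0 zero    _ = begin
      a 0                                              ≈⟨ solve 3 (λ a r p → a := a :+ r :* p :- r :* p) refl (a 0) r _ ⟩
      a 0 + r * polynomial n (a ∘ suc) r - r * polynomial n (a ∘ suc) r ≈⟨ +-cong P≈0 (-‿cong (trans (*-congˡ (tail≈0 n q≈0)) (zeroʳ r))) ⟩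
      0# - 0#                                          ≈⟨ -‿inverseʳ 0# ⟩
      0#                                               ∎
      where
      tail≈0 : ∀ n → (∀ k → k < n → quotient r n a k ≈ 0#) → polynomial n (a ∘ suc) r ≈ 0#
      tail≈0 zero    _   = refl
      tail≈0 (suc n) q≈0 = q≈0 0 (s≤s z≤n)
    back-substitution r (suc n) a P≈0 q≈0 (suc k) (s≤s k<n) =
      back-substitution r n (a ∘ suc) (q≈0 0 (s≤s z≤n)) (λ k k<n → q≈0 (suc k) (s≤s k<n)) k k<n

  -- Dividing by x - (T + s) leaves a quotient that vanishes at all later points, since their
  -- distances t - T are invertible integers. Each division uses up one point, hence the threshold
  -- `suc T`.
  polynomial-vanishes : ∀ n a s T → (∀ t → T ≤ t → polynomial n a (fromℕ t + s) ≈ 0#) → ∀ k → k < n → a k ≈ 0#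
  polynomial-vanishes (suc n) a s T P≈0 = back-substitution r n a (P≈0 T ℕ.≤-refl)
    (polynomial-vanishes n (quotient r n a) s (suc T) q≈0)
    where
    r = fromℕ T + s
    q≈0 : ∀ t → T < t → polynomial n (quotient r n a) (fromℕ t + s) ≈ 0#
    q≈0 t T<t = fromℕ-cancel (t ∸ T) {{ℕ.>-nonZero (ℕ.m<n⇒0<n∸m T<t)}} (begin
      fromℕ (t ∸ T) * q
        ≈⟨ *-congʳ difference ⟩
      (x - r) * q
        ≈⟨ solve 2 (λ p q → q := p :+ q :- p) refl (polynomial (suc n) a r) ((x - r) * q) ⟩
      polynomial (suc n) a r + (x - r) * q - polynomial (suc n) a r
        ≈⟨ +-cong (trans (sym (division r n a x)) (P≈0 t (ℕ.<⇒≤ T<t))) (-‿cong (P≈0 T ℕ.≤-refl)) ⟩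
      0# - 0#
        ≈⟨ -‿inverseʳ 0# ⟩
      0#
        ≈⟨ zeroʳ _ ⟨
      fromℕ (t ∸ T) * 0# ∎)
      where
      x = fromℕ t + s
      q = polynomial n (quotient r n a) x
      difference : fromℕ (t ∸ T) ≈ x - r
      difference = begin
        fromℕ (t ∸ T)
          ≈⟨ solve 3 (λ d T s → d := (T :+ d) :+ s :- (T :+ s)) refl (fromℕ (t ∸ T)) (fromℕ T) s ⟩
        fromℕ T + fromℕ (t ∸ T) + s - r
          ≈⟨ +-congʳ (+-congʳ (trans (sym (·.×-homo-+ 1# T (t ∸ T))) (reflexive (≡.cong fromℕ (ℕ.m+[n∸m]≡n (ℕ.<⇒≤ T<t)))))) ⟩
        x - r ∎

  evaluate-A : ∀ n y x f → evaluate n y (A x f) ≈ S (suc (degree f)) (λ k → x ^ k * evaluate n y (D k f))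
  evaluate-A n y x f = begin
    evaluate n y (A x f)
      ≈⟨ E.cong (λ α → sym (coeff-∑ F α)) ⟩
    evaluate n y (∑Λ F)
      ≈⟨ homo-∑ Λ-rawRing E.isRingHomomorphism F ⟩
    ∑ (evaluate n y ∘ F)
      ≈⟨ ∑-cong (evaluate n y ∘ F) (λ i → x ^ toℕ i * evaluate n y (D (toℕ i) f)) (λ i → E.•-homo (x ^ toℕ i) (D (toℕ i) f)) ⟩
    S (suc (degree f)) (λ k → x ^ k * evaluate n y (D k f)) ∎
    where
    module E = Hom (evaluate-hom n y)
    F : Fin (suc (degree f)) → Λ
    F i = x ^ toℕ i • D (toℕ i) f

  -- The threshold binds only the first row. That row is taken above both `T` and the second row,
  -- and large arguments determine a polynomial, so the lower rows remain unrestricted, as in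
  -- `vanishing′`.
  vanishing : ∀ n (s : ℕ → Carrier) T f → 0 < n →
    (∀ ν → Antitone ν → ν n ≡ 0 → T ≤ ν 0 → evaluate n (λ i → fromℕ (ν i) + s i) f ≈ 0#) →
    ∀ α → length α ≡ n → coeff f α ≈ 0#
  vanishing′ : ∀ n (s : ℕ → Carrier) f →
    (∀ ν → Antitone ν → ν n ≡ 0 → evaluate n (λ i → fromℕ (ν i) + s i) f ≈ 0#) →
    ∀ α → length α ≡ n → coeff f α ≈ 0#
  vanishing′ zero    s f f≈0 [] _ = f≈0 (λ _ → 0) (λ _ → z≤n) ≡.refl
  vanishing′ (suc n) s f f≈0 = vanishing (suc n) s 0 f (s≤s z≤n) (λ ν anti ν≡0 _ → f≈0 ν anti ν≡0)

  -- Fixing the lower rows leaves a polynomial in the first one.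
  vanishing (suc n) s T f _ f≈0 (k ∷ α) eq with k ℕ.≤? degree f
  ... | no  k≰d = bounded f (k ∷ α) (ℕ.<-≤-trans (ℕ.≰⇒> k≰d) (ℕ.m≤m+n k _))
  ... | yes k≤d = vanishing′ n (s ∘ suc) (D k f) Dₖ≈0 α (ℕ.suc-injective eq)
    where
    Dₖ≈0 : ∀ ν → Antitone ν → ν n ≡ 0 → evaluate n (λ i → fromℕ (ν i) + s (suc i)) (D k f) ≈ 0#
    Dₖ≈0 ν ν-anti ν≡0 = polynomial-vanishes (suc (degree f)) (λ k → evaluate n y (D k f)) (s 0) (T ⊔ ν 0) P≈0 k (s≤s k≤d)
      where
      y : ℕ → Carrier
      y i = fromℕ (ν i) + s (suc i)
      P≈0 : ∀ t → T ⊔ ν 0 ≤ t → polynomial (suc (degree f)) (λ k → evaluate n y (D k f)) (fromℕ t + s 0) ≈ 0#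
      P≈0 t T≤t = begin
        polynomial (suc (degree f)) (λ k → evaluate n y (D k f)) (fromℕ t + s 0)
          ≈⟨ polynomial-S (suc (degree f)) (λ k → evaluate n y (D k f)) (fromℕ t + s 0) ⟨
        S (suc (degree f)) (λ k → (fromℕ t + s 0) ^ k * evaluate n y (D k f))
          ≈⟨ evaluate-A n y (fromℕ t + s 0) f ⟨
        evaluate n y (A (fromℕ t + s 0) f)
          ≈⟨ f≈0 ν⁺ ν⁺-anti ν≡0 (ℕ.≤-trans (ℕ.m≤m⊔n T (ν 0)) T≤t) ⟩
        0# ∎
        where
        ν⁺ : ℕ → ℕ
        ν⁺ zero    = t
        ν⁺ (suc i) = ν i
        ν⁺-anti : Antitone ν⁺
        ν⁺-anti {zero}  {zero}  _         = ℕ.≤-refl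
        ν⁺-anti {zero}  {suc j} _         = ℕ.≤-trans (ν-anti z≤n) (ℕ.≤-trans (ℕ.m≤n⊔m T (ν 0)) T≤t)
        ν⁺-anti {suc i} {suc j} (s≤s i≤j) = ν-anti i≤j

  coeff-support : ∀ f α → coeff f α ≈ coeff f (support α)
  coeff-support f []          = refl
  coeff-support f (zero  ∷ α) = trans (padding f α) (coeff-support f α)
  coeff-support f (suc a ∷ α) = coeff-support (D (suc a) f) α

  private
    length-support : ∀ α → length (support α) ≤ sum α
    length-support []          = z≤n
    length-support (zero  ∷ α) = length-support α
    length-support (suc a ∷ α) = s≤s (ℕ.≤-trans (length-support α) (ℕ.m≤n+m _ a))

    coeff-replicate : ∀ f n α → coeff f (replicate n 0 ++ α) ≈ coeff f α
    coeff-replicate f zero    α = refl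
    coeff-replicate f (suc n) α = trans (padding f _) (coeff-replicate f n α)

  -- A monomial of degree at most `n` involves at most `n` variables, so discarding and adding zero
  -- exponents brings it to length exactly `n`.
  ≈0-by-length : ∀ n f → degree f ≤ n → (∀ α → length α ≡ n → coeff f α ≈ 0#) → f ≈Λ 0Λ
  ≈0-by-length n f d≤n f≈0 α with degree f ℕ.<? sum α
  ... | yes d<α = bounded f α d<α
  ... | no  d≮α = begin
    coeff f α                                  ≈⟨ coeff-support f α ⟩
    coeff f (support α)                        ≈⟨ coeff-replicate f k (support α) ⟨
    coeff f (replicate k 0 ++ support α)       ≈⟨ f≈0 _ (≡.trans (List.length-++ (replicate k 0)) (≡.trans
                                                    (≡.cong (ℕ._+ length (support α)) (List.length-replicate k)) (ℕ.m∸n+n≡m short))) ⟩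
    0#                                         ∎
    where
    k = n ∸ length (support α)
    short : length (support α) ≤ n
    short = ℕ.≤-trans (length-support α) (ℕ.≤-trans (ℕ.≮⇒≥ d≮α) d≤n)

  remove-degree : ∀ n z f → degree (remove z n f) ≤ degree f
  remove-degree zero    z f = ℕ.≤-refl
  remove-degree (suc n) z f = ℕ.≤-trans (remove-degree n (z + 1#) (A⁻¹ z f)) (A⁻¹-degree z f)

  -- `remove` has trivial kernel and does not raise the degree, so it suffices to kill
  -- `remove (base N) N f`. The lower bound on `size ν` is met by making the first row long.
  determined-by-values : ∀ m f → (∀ ν N → ℓ ν ≤ N → m ≤ size ν → valueAt ν N f ≈ 0#) → f ≈Λ 0Λ
  determined-by-values m f f≈0 = remove-kernel N (base N) f
    (≈0-by-length N (remove (base N) N f) (ℕ.≤-trans (remove-degree N (base N) f) (ℕ.n≤1+n _))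
      (vanishing N (λ i → - fromℕ i - ½) m (remove (base N) N f) (s≤s z≤n) at))
    where
    -- At least the degree, for `≈0-by-length`; `suc` provides a first row to carry the threshold
    -- even in degree 0.
    N = suc (degree f)
    at : ∀ ν → Antitone ν → ν N ≡ 0 → m ≤ ν 0 → evaluate N (λ i → fromℕ (ν i) + (- fromℕ i - ½)) (remove (base N) N f) ≈ 0#
    at ν ν-anti ν≡0 m≤ν = trans (evaluate-≈ N (remove (base N) N f) λ i → begin
        fromℕ (ν i) + (- fromℕ i - ½)     ≈⟨ solve 3 (λ n i h → n :+ (:- i :- h) := n :- i :- h) refl (fromℕ (ν i)) (fromℕ i) ½ ⟩
        fromℕ (ν i) - fromℕ i - ½         ≈⟨ +-congʳ (+-congʳ (reflexive (≡.cong fromℕ (≡.sym (rows-entry N ν ν-anti ν≡0 i))))) ⟩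
        coordinate diagram i              ∎)
      (f≈0 diagram N (rows-length N ν) (ℕ.≤-trans m≤ν (ℕ.≤-trans (ℕ.≤-reflexive (≡.sym (rows-entry N ν ν-anti ν≡0 0))) (entry≤sum (rows N ν)))))
      where
      diagram : Diagram
      diagram = record { parts = rows N ν ; decreasing = rows-decreasing N ν ν-anti ; positive = rows-positive N ν }
      evaluate-≈ : ∀ n {x y} f → (∀ i → x i ≈ y i) → evaluate n x f ≈ evaluate n y f
      evaluate-≈ zero    f eq = refl
      evaluate-≈ (suc n) {x} {y} f eq = trans (evaluate-≈ n (A (x 0) f) (eq ∘ suc))
        (Hom.cong (evaluate-hom n (y ∘ suc)) λ α → S-cong (suc (degree f)) λ k _ → *-congʳ {coeff f (k ∷ α)} (^-cong k (eq 0)))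

-- Top-degree components of multiparameter Schur functions.

open import Data.Nat.Combinatorics using (_P_)
open import Data.Nat.Combinatorics.Base using (_P′_)

P-! : ∀ {m n} → m ≤ n → (n P m) ℕ.* (n ∸ m) ! ≡ n !
P-! {m} {n} m≤n with m ℕ.≤ᵇ n | ℕ.≤⇒≤ᵇ m≤n
... | true | _ = P′-! m m≤n
  where
  P′-! : ∀ m → m ≤ n → (n P′ m) ℕ.* (n ∸ m) ! ≡ n !
  P′-! zero    _   = ℕ.*-identityˡ (n !)
  P′-! (suc m) m<n = begin
    (n ∸ m) ℕ.* (n P′ m) ℕ.* (n ∸ suc m) !    ≡⟨ ≡.cong (ℕ._* (n ∸ suc m) !) (ℕ.*-comm (n ∸ m) (n P′ m)) ⟩
    (n P′ m) ℕ.* (n ∸ m) ℕ.* (n ∸ suc m) !    ≡⟨ ℕ.*-assoc (n P′ m) (n ∸ m) _ ⟩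
    (n P′ m) ℕ.* ((n ∸ m) ℕ.* (n ∸ suc m) !)  ≡⟨ ≡.cong (λ k → (n P′ m) ℕ.* (k ℕ.* (n ∸ suc m) !)) (∸-step m<n) ⟩
    (n P′ m) ℕ.* suc (n ∸ suc m) !            ≡⟨ ≡.cong (λ k → (n P′ m) ℕ.* k !) (∸-step m<n) ⟨
    (n P′ m) ℕ.* (n ∸ m) !                    ≡⟨ P′-! m (ℕ.<⇒≤ m<n) ⟩
    n !                                       ∎
    where open ≡.≡-Reasoning

total-entry : ∀ {N} xs → length xs ≤ N → total N (entry xs) ≡ sum xs
total-entry {N} [] _ = total-zero N
total-entry {suc N} (x ∷ xs) (s≤s ℓ≤N) = ≡.cong (x ℕ.+_) (total-entry xs ℓ≤N)

module Filtration {c ℓ₁ ℓ₂} (K : HeytingField c ℓ₁ ℓ₂) (char0 : CharacteristicZero K) where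
  open Uniqueness K char0 public
  open CommutativeRing R hiding (zero)
  open RingProperties ring using (-0#≈0#)
  open IntegerCoefficients R
  open RangeSums R
  open SetoidReasoning setoid
  open RawSemiringDefinitions (RawRing.rawSemiring rawRing) using () renaming (sum to ∑)
  open RawSemiringDefinitions (RawRing.rawSemiring Λ-rawRing) using () renaming (sum to ∑Λ; _^_ to _^Λ_)
  open Determinant Λ-rawRing using (det)
  private
    module ∑ = Summation +-commutativeMonoid
    module ∑ℤ = Summation ℤ.+-0-commutativeMonoid

  convolution-≈ : ∀ F G F′ G′ α →
    (∀ β γ → sum β ℕ.+ sum γ ≡ sum α → F β * G γ ≈ F′ β * G′ γ) → convolution F G α ≈ convolution F′ G′ α
  convolution-≈ F G F′ G′ []      FG≈ = FG≈ [] [] ≡.refl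
  convolution-≈ F G F′ G′ (a ∷ α) FG≈ = ∑.sum-cong-≋ {suc a} λ i →
    convolution-≈ _ _ _ _ α λ β γ eq → FG≈ (toℕ i ∷ β) (a ∸ toℕ i ∷ γ) (≡.trans
      (CommutativeSemigroupProperties.interchange ℕ.+-commutativeSemigroup (toℕ i) (sum β) (a ∸ toℕ i) (sum γ))
      (≡.cong₂ ℕ._+_ (ℕ.m+[n∸m]≡n (Fin.toℕ≤pred[n] i)) eq))

  -- `d` is an integer because Jacobi-Trudi indices can be negative: the zero entry then still
  -- counts as having degree `d`, and degrees add up in every term of the determinant.
  record SameTop (d : ℤ) (f g : Λ) : Set (c Level.⊔ ℓ₁) where
    field
      lowˡ : ∀ α → d ℤ.< + sum α → coeff f α ≈ 0#
      lowʳ : ∀ α → d ℤ.< + sum α → coeff g α ≈ 0#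
      top  : ∀ α → + sum α ≡ d → coeff f α ≈ coeff g α

  open SameTop

  top-0 : ∀ d → SameTop d 0Λ 0Λ
  top-0 d = record { lowˡ = λ _ _ → refl ; lowʳ = λ _ _ → refl ; top = λ _ _ → refl }

  top-+ : ∀ {d f g f′ g′} → SameTop d f f′ → SameTop d g g′ → SameTop d (f +Λ g) (f′ +Λ g′)
  top-+ F G = record
    { lowˡ = λ α d< → trans (+-cong (lowˡ F α d<) (lowˡ G α d<)) (+-identityˡ 0#)
    ; lowʳ = λ α d< → trans (+-cong (lowʳ F α d<) (lowʳ G α d<)) (+-identityˡ 0#)
    ; top  = λ α eq → +-cong (top F α eq) (top G α eq)
    }

  -- In degree d + e, either both factors are at their tops or one of them exceeds its bound and
  -- both products vanish.
  top-* : ∀ {d e f g f′ g′} → SameTop d f f′ → SameTop e g g′ → SameTop (d ℤ.+ e) (f *Λ g) (f′ *Λ g′)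
  top-* {d} {e} {f} {g} {f′} {g′} F G = record
    { lowˡ = λ α d< → convolution-zero (coeff f) (coeff g) α λ β γ eq → low (lowˡ F) (lowˡ G) β γ
        (≡.subst (d ℤ.+ e ℤ.<_) (≡.cong +_ (≡.sym eq)) d<)
    ; lowʳ = λ α d< → convolution-zero (coeff f′) (coeff g′) α λ β γ eq → low (lowʳ F) (lowʳ G) β γ
        (≡.subst (d ℤ.+ e ℤ.<_) (≡.cong +_ (≡.sym eq)) d<)
    ; top  = λ α eq → convolution-≈ (coeff f) (coeff g) (coeff f′) (coeff g′) α λ β γ eq′ →
        same β γ (≡.trans (≡.cong +_ eq′) eq)
    }
    where
    zeroˡ′ : ∀ {x y} → x ≈ 0# → x * y ≈ 0#
    zeroˡ′ x≈0 = trans (*-congʳ x≈0) (zeroˡ _)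
    zeroʳ′ : ∀ {x y} → y ≈ 0# → x * y ≈ 0#
    zeroʳ′ y≈0 = trans (*-congˡ y≈0) (zeroʳ _)
    low : ∀ {u v : Function} → (∀ β → d ℤ.< + sum β → u β ≈ 0#) → (∀ γ → e ℤ.< + sum γ → v γ ≈ 0#) →
      ∀ β γ → d ℤ.+ e ℤ.< + (sum β ℕ.+ sum γ) → u β * v γ ≈ 0#
    low u≈0 v≈0 β γ de< with d ℤ.<? + sum β | e ℤ.<? + sum γ
    ... | yes d< | _      = zeroˡ′ (u≈0 β d<)
    ... | no _   | yes e< = zeroʳ′ (v≈0 γ e<)
    ... | no d≮  | no e≮  = contradiction de< (ℤ.≤⇒≯ (ℤ.+-mono-≤ (ℤ.≮⇒≥ d≮) (ℤ.≮⇒≥ e≮)))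
    same : ∀ β γ → + (sum β ℕ.+ sum γ) ≡ d ℤ.+ e → coeff f β * coeff g γ ≈ coeff f′ β * coeff g′ γ
    same β γ eq with ℤ.<-cmp d (+ sum β) | ℤ.<-cmp e (+ sum γ)
    ... | tri< d< _ _ | _           = trans (zeroˡ′ (lowˡ F β d<)) (sym (zeroˡ′ (lowʳ F β d<)))
    ... | tri≈ _ _ _  | tri< e< _ _ = trans (zeroʳ′ (lowˡ G γ e<)) (sym (zeroʳ′ (lowʳ G γ e<)))
    ... | tri> _ _ _  | tri< e< _ _ = trans (zeroʳ′ (lowˡ G γ e<)) (sym (zeroʳ′ (lowʳ G γ e<)))
    ... | tri≈ _ d≡ _ | tri≈ _ e≡ _ = *-cong (top F β (≡.sym d≡)) (top G γ (≡.sym e≡))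
    ... | tri≈ _ d≡ _ | tri> _ _ e> = contradiction eq (ℤ.<⇒≢ (ℤ.+-mono-≤-< (ℤ.≤-reflexive (≡.sym d≡)) e>))
    ... | tri> _ _ d> | tri≈ _ e≡ _ = contradiction eq (ℤ.<⇒≢ (ℤ.+-mono-<-≤ d> (ℤ.≤-reflexive (≡.sym e≡))))
    ... | tri> _ _ d> | tri> _ _ e> = contradiction eq (ℤ.<⇒≢ (ℤ.+-mono-< d> e>))

  top-h : ∀ k → SameTop (+ k) (h k) (h k)
  top-h k = record
    { lowˡ = λ α d< → bounded (h k) α (ℤ.drop‿+<+ d<)
    ; lowʳ = λ α d< → bounded (h k) α (ℤ.drop‿+<+ d<)
    ; top  = λ _ _ → refl
    }

  top-∑ : ∀ {n d} (F G : Fin n → Λ) → (∀ i → SameTop d (F i) (G i)) → SameTop d (∑Λ F) (∑Λ G)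
  top-∑ {zero}  F G FG = top-0 _
  top-∑ {suc n} F G FG = top-+ {f = F zero} {∑Λ (F ∘ suc)} {G zero} {∑Λ (G ∘ suc)} (FG zero) (top-∑ (F ∘ suc) (G ∘ suc) (FG ∘ suc))

  top-sign : ∀ n → SameTop (+ 0) ((-Λ 1Λ) ^Λ n) ((-Λ 1Λ) ^Λ n)
  top-sign zero    = top-h 0
  top-sign (suc n) = top-* {f = -Λ 1Λ} {(-Λ 1Λ) ^Λ n} { -Λ 1Λ} {(-Λ 1Λ) ^Λ n} minus (top-sign n)
    where
    minus : SameTop (+ 0) (-Λ 1Λ) (-Λ 1Λ)
    minus = record
      { lowˡ = λ α d< → trans (-‿cong (lowˡ (top-h 0) α d<)) -0#≈0#
      ; lowʳ = λ α d< → trans (-‿cong (lowˡ (top-h 0) α d<)) -0#≈0#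
      ; top  = λ _ _ → refl
      }

  -- Since degrees split as `a i + b j`, every term of the expansion has the degree ∑ a + ∑ b.
  top-det : ∀ {n} (a b : Fin n → ℤ) (X Y : Fin n → Fin n → Λ) → (∀ i j → SameTop (a i ℤ.+ b j) (X i j) (Y i j)) →
    SameTop (∑ℤ.sum a ℤ.+ ∑ℤ.sum b) (det X) (det Y)
  top-det {zero}  a b X Y XY = top-h 0
  top-det {suc n} a b X Y XY = top-∑ (term X) (term Y) λ j → ≡.subst (λ d → SameTop d (term X j) (term Y j)) (degree≡ j)
    (top-* {f = sign j *Λ X zero j} {rest X j} {sign j *Λ Y zero j} {rest Y j}
      (top-* {f = sign j} {X zero j} {sign j} {Y zero j} (top-sign (toℕ j)) (XY zero j))
      (top-det (a ∘ suc) (b ∘ punchIn j) (λ i → removeAt (X (suc i)) j) (λ i → removeAt (Y (suc i)) j)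
        (λ i k → XY (suc i) (punchIn j k))))
    where
    sign : Fin (suc n) → Λ
    sign j = (-Λ 1Λ) ^Λ toℕ j
    rest : (Fin (suc n) → Fin (suc n) → Λ) → Fin (suc n) → Λ
    rest Z j = det (λ i → removeAt (Z (suc i)) j)
    term : (Fin (suc n) → Fin (suc n) → Λ) → Fin (suc n) → Λ
    term Z j = (sign j *Λ Z zero j) *Λ rest Z j
    degree≡ : ∀ j → (+ 0 ℤ.+ (a zero ℤ.+ b j)) ℤ.+ (∑ℤ.sum (a ∘ suc) ℤ.+ ∑ℤ.sum (b ∘ punchIn j)) ≡ ∑ℤ.sum a ℤ.+ ∑ℤ.sum b
    degree≡ j = ≡.trans (≡.cong (λ z → z ℤ.+ (∑ℤ.sum (a ∘ suc) ℤ.+ ∑ℤ.sum (b ∘ punchIn j))) (ℤ.+-identityˡ (a zero ℤ.+ b j)))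
      (≡.trans (CommutativeSemigroupProperties.interchange ℤ.+-commutativeSemigroup (a zero) (b j) _ _)
        (≡.cong (λ z → ∑ℤ.sum a ℤ.+ z) (≡.sym (∑ℤ.sum-remove {i = j} b))))

  top-hₐ : ∀ a z → SameTop z (hₐ a z) (hℤ z)
  top-hₐ a -[1+ n ]  = top-0 _
  top-hₐ a (+ zero)  = top-h 0
  top-hₐ a (+ suc k) = record
    { lowˡ = λ α d< → trans (coeff-∑ {suc k} F α) (S-zero (suc k) λ i i≤k → trans
        (*-congˡ (indicator-no (sum α ℕ.≟ suc i) (ℕ.>⇒≢ (ℕ.≤-<-trans i≤k (ℤ.drop‿+<+ d<))))) (zeroʳ (signed (k ∸ i) x)))
    ; lowʳ = lowˡ (top-h (suc k))
    ; top  = λ α eq → begin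
        coeff (∑Λ F) α
          ≈⟨ coeff-∑ {suc k} F α ⟩
        S (suc k) (λ i → signed (k ∸ i) x * coeff (h (suc i)) α)
          ≈⟨ S-single k (λ i → signed (k ∸ i) x * coeff (h (suc i)) α) ℕ.≤-refl (λ i i≢k → trans
               (*-congˡ (indicator-no (sum α ℕ.≟ suc i) λ eq′ → i≢k (ℕ.suc-injective (≡.trans (≡.sym eq′) (ℤ.+-injective eq))))) (zeroʳ (signed (k ∸ i) x))) ⟩
        signed (k ∸ k) x * coeff (h (suc k)) α
          ≈⟨ *-congʳ (reflexive (≡.cong (λ n → signed n x) (ℕ.n∸n≡0 k))) ⟩
        1# * 1# * coeff (h (suc k)) α
          ≈⟨ solve 1 (λ y → :1 :* :1 :* y := y) refl _ ⟩
        coeff (h (suc k)) α ∎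
    }
    where
    x : Fin k → Carrier
    x j = a (+ suc (toℕ j))
    F : Fin (suc k) → Λ
    F i = signed (k ∸ toℕ i) x • h (suc (toℕ i))

  -- The -i of the rows and the +j of the columns cancel in the total degree.
  top-multiSchur : ∀ μ a → SameTop (+ size μ) (multiSchur (ℓ μ) μ a) (schur μ)
  top-multiSchur μ a = ≡.subst (λ d → SameTop d (multiSchur (ℓ μ) μ a) (schur μ)) degree≡
    (top-det {ℓ μ} u v _ _ λ i j → top-hₐ (shift (ℤ.- (+ toℕ j)) a) (u i ℤ.+ v j))
    where
    u v : Fin (ℓ μ) → ℤ
    u i = + row μ (toℕ i) ℤ.- + toℕ i
    v j = + toℕ j
    sum-entry : ∀ xs → ∑ℤ.sum {length xs} (λ i → + entry xs (toℕ i)) ≡ + sum xs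
    sum-entry []       = ≡.refl
    sum-entry (x ∷ xs) = ≡.cong (λ s → + x ℤ.+ s) (sum-entry xs)
    degree≡ : ∑ℤ.sum u ℤ.+ ∑ℤ.sum v ≡ + size μ
    degree≡ = ≡.trans (≡.sym (∑ℤ.∑-distrib-+ u v)) (≡.trans (∑ℤ.sum-cong-≗ {ℓ μ} λ i →
        ≡.trans (ℤ.+-assoc (+ row μ (toℕ i)) (ℤ.- (+ toℕ i)) (+ toℕ i))
          (≡.trans (≡.cong (λ z → + row μ (toℕ i) ℤ.+ z) (ℤ.+-inverseˡ (+ toℕ i))) (ℤ.+-identityʳ _)))
      (sum-entry (parts μ)))

-- The dimension quotient as a value of the multiparameter Schur function.

module FrobeniusSchur {c ℓ₁ ℓ₂} (K : HeytingField c ℓ₁ ℓ₂) (char0 : CharacteristicZero K) where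
  open Filtration K char0 public
  open CommutativeRing R hiding (zero)
  open IntegerCoefficients R
  open Determinants R using (∏)
  open PowerSeries R hiding (T)
  open DimensionFormula R using (fallingMatrix; dimension-formula; ⊈⇒det≈0)
  open SetoidReasoning setoid
  open Determinant rawRing using (det)
  private
    module · = SemiringMultiples semiring

  private
    inverseˡ : ∀ n .{{_ : NonZero n}} → 1# / n * fromℕ n ≈ 1#
    inverseˡ n = begin
      1# * n⁻¹ * fromℕ n      ≈⟨ solve 2 (λ i n → :1 :* i :* n := i :* (n :- :0)) refl n⁻¹ (fromℕ n) ⟩
      n⁻¹ * (fromℕ n - 0#)    ≈⟨ proj₁ (proj₂ inverse) ⟩
      1#                      ∎
      where
      inverse = HeytingField.#⇒invertible K (char0 n)
      n⁻¹ = proj₁ inverse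

    /-def : ∀ x n .{{_ : NonZero n}} → x / n ≈ x * (1# / n)
    /-def x n = *-congˡ (sym (*-identityˡ _))

    /-cross : ∀ x y b q .{{_ : NonZero b}} .{{_ : NonZero q}} → x * fromℕ q ≈ y * fromℕ b → x / b ≈ y / q
    /-cross x y b q eq = begin
      x / b                                       ≈⟨ /-def x b ⟩
      x * (1# / b)                                ≈⟨ solve 2 (λ x b → x :* b := x :* b :* :1) refl x (1# / b) ⟩
      x * (1# / b) * 1#                           ≈⟨ *-congˡ (inverseˡ q) ⟨
      x * (1# / b) * (1# / q * fromℕ q)           ≈⟨ solve 4 (λ x i j q → x :* i :* (j :* q) := x :* q :* i :* j) refl x (1# / b) (1# / q) (fromℕ q) ⟩
      x * fromℕ q * (1# / b) * (1# / q)           ≈⟨ *-congʳ (*-congʳ eq) ⟩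
      y * fromℕ b * (1# / b) * (1# / q)           ≈⟨ solve 4 (λ y i j b → y :* b :* i :* j := y :* j :* (i :* b)) refl y (1# / b) (1# / q) (fromℕ b) ⟩
      y * (1# / q) * (1# / b * fromℕ b)           ≈⟨ *-congˡ (inverseˡ b) ⟩
      y * (1# / q) * 1#                           ≈⟨ *-identityʳ _ ⟩
      y * (1# / q)                                ≈⟨ /-def y q ⟨
      y / q                                       ∎

    /-injective : ∀ x y q .{{_ : NonZero q}} → x / q ≈ y / q → x ≈ y
    /-injective x y q eq = begin
      x                           ≈⟨ expand x ⟩
      x / q * fromℕ q             ≈⟨ *-congʳ eq ⟩
      y / q * fromℕ q             ≈⟨ expand y ⟨
      y                           ∎
      where
      expand : ∀ x → x ≈ x / q * fromℕ q
      expand x = begin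
        x                         ≈⟨ *-identityʳ x ⟨
        x * 1#                    ≈⟨ *-congˡ (inverseˡ q) ⟨
        x * (1# / q * fromℕ q)    ≈⟨ *-assoc _ _ _ ⟨
        x * (1# / q) * fromℕ q    ≈⟨ *-congʳ (/-def x q) ⟨
        x / q * fromℕ q           ∎

    ∏-cancel : ∀ {n} (f : Fin n → ℕ) → (∀ i → NonZero (f i)) → ∀ {x y} →
      ∏ (λ i → fromℕ (f i)) * x ≈ ∏ (λ i → fromℕ (f i)) * y → x ≈ y
    ∏-cancel {zero}  f f≢0 eq = trans (sym (*-identityˡ _)) (trans eq (*-identityˡ _))
    ∏-cancel {suc n} f f≢0 eq = ∏-cancel (f ∘ suc) (f≢0 ∘ suc)
      (fromℕ-cancel (f zero) {{f≢0 zero}} (trans (sym (*-assoc _ _ _)) (trans eq (*-assoc _ _ _))))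

  module _ (μ ν : Diagram) (N : ℕ) (ℓμ≤N : ℓ μ ≤ N) where
    private
      -- Enough rows for both diagrams; `stable-+` leads back to size `N`.
      N′ = N ℕ.+ ℓ ν
      ν≡0 : ∀ i → ℓ ν ≤ i → row ν i ≡ 0
      ν≡0 i = entry-≥ (parts ν)

    factorials : Carrier
    factorials = ∏ {N′} (λ j → fromℕ (β N′ (row ν) (toℕ j) !))

    -- If `μ ⊈ ν` both sides vanish, by `⊈⇒det≈0`; otherwise the empty rows up to `N′` add no cells.
    dim-det : size μ ≤ size ν →
      fromℕ (dim μ ν) * factorials ≈ fromℕ ((size ν ∸ size μ) !) * det (fallingMatrix N′ (row μ) (row ν))
    dim-det m≤n with μ ⊆? ν
    ... | yes μ⊆ν = trans (*-congʳ (reflexive (≡.cong fromℕ (≡.trans (dim-#standard μ ν)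
            (≡.trans (≡.cong (λ b → if b then #standard (skewCells μ ν) else 0) (dec-true (μ ⊆? ν) μ⊆ν))
              (≡.cong #standard (≡.sym (Skew.skew-extend (row μ) N ν≡0))))))))
          (dimension-formula N′ (row-antitone μ) (size ν ∸ size μ) (row-antitone ν) (ν≡0 N′ (ℕ.m≤n+m (ℓ ν) N)) μ≤ν
            (≡.trans (total-entry (parts ν) (ℕ.m≤n+m (ℓ ν) N)) (≡.trans (≡.sym (ℕ.m∸n+n≡m m≤n))
              (≡.cong (size ν ∸ size μ ℕ.+_) (≡.sym (total-entry (parts μ) (ℕ.≤-trans ℓμ≤N (ℕ.m≤m+n N (ℓ ν)))))))))
      where
      μ≤ν : ∀ i → row μ i ≤ row ν i
      μ≤ν i with i ℕ.<? ℓ μ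
      ... | yes i<ℓ = ≡.subst (λ k → row μ k ≤ row ν k) (Fin.toℕ-fromℕ< i<ℓ) (μ⊆ν (fromℕ< i<ℓ))
      ... | no  i≮ℓ = ℕ.≤-trans (ℕ.≤-reflexive (entry-≥ (parts μ) (ℕ.≮⇒≥ i≮ℓ))) z≤n
    ... | no μ⊈ν = begin
      fromℕ (dim μ ν) * factorials
        ≈⟨ *-congʳ (reflexive (≡.cong fromℕ (≡.trans (dim-#standard μ ν)
             (≡.cong (λ b → if b then #standard (skewCells μ ν) else 0) (dec-false (μ ⊆? ν) μ⊈ν))))) ⟩
      0# * factorials
        ≈⟨ trans (zeroˡ _) (sym (zeroʳ _)) ⟩
      fromℕ ((size ν ∸ size μ) !) * 0#
        ≈⟨ *-congˡ (⊈⇒det≈0 N′ (row-antitone μ) (row-antitone ν)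
             (ℕ.<-≤-trans (Fin.toℕ<n i) (ℕ.≤-trans ℓμ≤N (ℕ.m≤m+n N (ℓ ν)))) (ℕ.≰⇒> (proj₂ outside))) ⟨
      fromℕ ((size ν ∸ size μ) !) * det (fallingMatrix N′ (row μ) (row ν)) ∎
      where
      outside = Fin.¬∀⟶∃¬ (ℓ μ) _ (λ i → row μ (toℕ i) ℕ.≤? row ν (toℕ i)) μ⊈ν
      i = proj₁ outside

    module _ {φ : Λ → Carrier} (φ-value : IsFrobeniusValue ν φ) where
      private
        module V = IsValueAt φ-value
        module V′ = IsValueAt (valueAt-frobenius ν N′ (ℕ.m≤n+m (ℓ ν) N))
        φ-hom = V.isAlgebraHomomorphism

        -- `φ` is given by its power sums; `valueAt` has the same ones and a known generating
        -- function.
        φ-completes : completes φ ≋ Q (base N′) N′ (Gⁿ N′ (coordinate ν) δ)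
        φ-completes = ≋-trans
          (completes-agree φ-hom (valueAt-hom ν N′) (λ k → trans (V.power-sum (suc k)) (sym (V′.power-sum (suc k)))))
          (≋-trans (completes-remove (evaluate-hom N′ (coordinate ν)) N′ (base N′))
            (Q-cong N′ refl (completes-evaluate N′ (coordinate ν))))

        coordinate-β : ∀ j → j < N′ → coordinate ν j - base N′ ≈ fromℕ (β N′ (row ν) j)
        coordinate-β j j<N′ = begin
          fromℕ (row ν j) - fromℕ j - ½ - (½ - fromℕ N′)
            ≈⟨ solve 4 (λ r j h n → r :- j :- h :- (h :- n) := r :+ n :- j :- (h :+ h)) refl (fromℕ (row ν j)) (fromℕ j) ½ (fromℕ N′) ⟩
          fromℕ (row ν j) + fromℕ N′ - fromℕ j - (½ + ½)
            ≈⟨ +-cong (+-congʳ (+-congˡ (trans (reflexive (≡.cong fromℕ (≡.sym (ℕ.m+[n∸m]≡n j<N′)))) (·.×-homo-+ 1# (suc j) (N′ ∸ suc j))))) (-‿cong ½+½≈1) ⟩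
          fromℕ (row ν j) + (1# + fromℕ j + fromℕ (N′ ∸ suc j)) - fromℕ j - 1#
            ≈⟨ solve 3 (λ r j n → r :+ (:1 :+ j :+ n) :- j :- :1 := r :+ n) refl (fromℕ (row ν j)) (fromℕ j) (fromℕ (N′ ∸ suc j)) ⟩
          fromℕ (row ν j) + fromℕ (N′ ∸ suc j)
            ≈⟨ ·.×-homo-+ 1# (row ν j) (N′ ∸ suc j) ⟨
          fromℕ (β N′ (row ν) j) ∎

      det-value : det (fallingMatrix N′ (row μ) (row ν)) ≈ vandermonde N′ (coordinate ν) * φ (multiSchur N μ halfIntegers)
      det-value = trans (jacobi-trudi φ-hom {N′} {coordinate ν} φ-completes μ {row ν} coordinate-β) (*-congˡ (trans
        (reflexive (≡.cong (λ n → φ (multiSchur n μ halfIntegers)) (ℕ.+-comm N (ℓ ν)))) (stable-+ φ-hom (ℓ ν) N μ ℓμ≤N)))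

  -- `dim-det` and `det-value` are used for `μ` and for `∅`. Multiplied crosswise they share the
  -- Vandermonde factor `V`, and it is the product `f` of factorials that is cancelled.
  multiSchur-isFrobeniusSchur : ∀ N μ → ℓ μ ≤ N → IsFrobeniusSchur μ (multiSchur N μ halfIntegers)
  multiSchur-isFrobeniusSchur N μ ℓ≤N ν m≤n φ φ-value =
    /-cross (fromℕ (dim μ ν)) s (dim ∅ ν) (n P m) {{dim∅≢0 ν}} {{P≢0 m≤n}}
      (∏-cancel {N′} (λ j → β N′ (row ν) (toℕ j) !) (λ j → ℕ._!≢0 (β N′ (row ν) (toℕ j))) (begin
        f * (fromℕ (dim μ ν) * fromℕ (n P m))
          ≈⟨ solve 3 (λ f a q → f :* (a :* q) := q :* (a :* f)) refl f (fromℕ (dim μ ν)) (fromℕ (n P m)) ⟩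
        fromℕ (n P m) * (fromℕ (dim μ ν) * f)
          ≈⟨ *-congˡ (trans (dim-det μ ν N ℓ≤N m≤n) (*-congˡ (det-value μ ν N ℓ≤N φ-value))) ⟩
        fromℕ (n P m) * (fromℕ ((n ∸ m) !) * (V * s))
          ≈⟨ solve 4 (λ q k v s → q :* (k :* (v :* s)) := s :* (q :* k :* v)) refl (fromℕ (n P m)) (fromℕ ((n ∸ m) !)) V s ⟩
        s * (fromℕ (n P m) * fromℕ ((n ∸ m) !) * V)
          ≈⟨ *-congˡ (*-congʳ (trans (sym (·.×1-homo-* (n P m) ((n ∸ m) !))) (reflexive (≡.cong fromℕ (P-! m≤n))))) ⟩
        s * (fromℕ (n !) * V)
          -- For `∅` the value is 1 and all `n` boxes are removed, so `fromℕ (n !) * V` is `dim ∅ ν`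
          -- times the factorials.
          ≈⟨ *-congˡ (*-congˡ (trans (det-value ∅ ν N z≤n φ-value) (trans (*-congˡ (φ-multiSchur-∅ φ-hom N)) (*-identityʳ V)))) ⟨
        s * (fromℕ (n !) * det (fallingMatrix N′ (row ∅) (row ν)))
          ≈⟨ *-congˡ (dim-det ∅ ν N z≤n z≤n) ⟨
        s * (fromℕ (dim ∅ ν) * f)
          ≈⟨ solve 3 (λ s b f → s :* (b :* f) := f :* (s :* b)) refl s (fromℕ (dim ∅ ν)) f ⟩
        f * (s * fromℕ (dim ∅ ν)) ∎))
    where
    m = size μ
    n = size ν
    N′ = N ℕ.+ ℓ ν
    s = φ (multiSchur N μ halfIntegers)
    f = factorials ∅ ν N z≤n
    V = vandermonde N′ (coordinate ν)
    φ-hom = IsValueAt.isAlgebraHomomorphism φ-value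

  -- `valueAt` provides a point over every large `ν`; there the two quotients agree and have the
  -- same nonzero denominator.
  frobeniusSchur-unique : ∀ μ f g → IsFrobeniusSchur μ f → IsFrobeniusSchur μ g → f ≈Λ g
  frobeniusSchur-unique μ f g f-FS g-FS = -Λ-cancel f g (determined-by-values (size μ) (f -Λ g) λ ν N ℓ≤N m≤n →
    let φ = valueAt ν N
        φ-value = valueAt-frobenius ν N ℓ≤N
        module φ = Hom (valueAt-hom ν N)
    in begin
      φ (f -Λ g)             ≈⟨ trans (φ.+-homo f ((- 1#) • g)) (+-congˡ (φ.•-homo (- 1#) g)) ⟩
      φ f + - 1# * φ g       ≈⟨ +-congʳ (/-injective (φ f) (φ g) (size ν P size μ) {{P≢0 m≤n}}
                                  (trans (sym (f-FS ν m≤n φ φ-value)) (g-FS ν m≤n φ φ-value))) ⟩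
      φ g + - 1# * φ g       ≈⟨ solve 1 (λ y → y :+ (:- :1) :* y := :0) refl _ ⟩
      0#                     ∎)

  -- By uniqueness `f` is the multiparameter Schur function, whose top component is that of
  -- `schur μ`.
  leading-term : ∀ μ f → IsFrobeniusSchur μ f → ∃[ g ] (f ≈Λ schur μ +Λ g) × (g hasDegree< size μ)
  leading-term μ f f-FS = s -Λ schur μ
    , (λ α → trans (frobeniusSchur-unique μ f s f-FS (multiSchur-isFrobeniusSchur (ℓ μ) μ ℕ.≤-refl) α)
        (solve 2 (λ s t → s := t :+ (s :+ (:- :1) :* t)) refl _ _))
    , low
    where
    s = multiSchur (ℓ μ) μ halfIntegers
    module T = SameTop (top-multiSchur μ halfIntegers)
    low : (s -Λ schur μ) hasDegree< size μ
    low α m≤α with ℕ.m≤n⇒m<n∨m≡n m≤α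
    ... | inj₁ m<α = trans (+-cong (T.lowˡ α (ℤ.+<+ m<α)) (*-congˡ (T.lowʳ α (ℤ.+<+ m<α))))
            (solve 0 (:0 :+ (:- :1) :* :0 := :0) refl)
    ... | inj₂ m≡α = trans (+-congʳ (T.top α (≡.cong +_ (≡.sym m≡α))))
            (solve 1 (λ y → y :+ (:- :1) :* y := :0) refl _)

theorem3 : ∀ {c ℓ₁ ℓ₂} (K : HeytingField c ℓ₁ ℓ₂) (char0 : CharacteristicZero K) →
    let open SymmetricFunctions K char0 in
    (μ : Diagram) →
    ∃! _≈Λ_ (IsFrobeniusSchur μ)
    × (∀ FS → IsFrobeniusSchur μ FS →
    (∃[ g ] (FS ≈Λ schur μ +Λ g) × (g hasDegree< size μ))
    × (∀ (N : ℕ) → ℓ μ ≤ N → FS ≈Λ multiSchur N μ halfIntegers))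
theorem3 K char0 μ =
    (s , s-FS , λ {f} f-FS → frobeniusSchur-unique μ s f s-FS f-FS)
  , λ FS FS-FS → leading-term μ FS FS-FS , λ N ℓ≤N →
      frobeniusSchur-unique μ FS (multiSchur N μ halfIntegers) FS-FS (multiSchur-isFrobeniusSchur N μ ℓ≤N)
  where
  open FrobeniusSchur K char0
  s = multiSchur (ℓ μ) μ halfIntegers
  s-FS = multiSchur-isFrobeniusSchur (ℓ μ) μ ℕ.≤-refl
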